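{- Suppose that the marked surface $\mathbb{S}$ has at least one puncture and that $k\geq 3$. Then the cluster algebra $\mathscr{A}({\rm SL}_k,\mathbb{S})$ has finite mutation type if and only if $\mathbb{S}$ is a once-punctured bigon and $k=3$. Likewise, $\mathscr{A}'({\rm SL}_k,\mathbb{S})$ has finite mutation type if and only if either $\mathbb{S}$ is a once-punctured bigon and $k\in\{3,4\}$, or $\mathbb{S}$ is a once-punctured triangle and $k=3$.
   Context: **Marked surfaces.** $\mathbb{S}=(\mathbf{S},\mathbb{M})$ is an oriented marked surface (Fomin–Shapiro–Thurston); punctures are marked points in the interior. Excluded throughout: spheres with at most $2$ punctures, the unpunctured monogon and digon, the once-punctured monogon. A once-punctured bigon (triangle) is a disk with one puncture and two (three) marked points on the boundary. A boundary interval is a piece of $\partial\mathbf S$ connecting adjacent boundary points. A triangulation is a maximal set of noncrossing arcs. It is regular if it has no loop enclosing a single puncture, and taut if it is regular and each triangle has at most one side which is a boundary interval; any $\mathbb{S}$ with a puncture admits a taut triangulation. **Finite mutation type.** A cluster algebra has finite mutation type if only finitely many quivers arise, up to isomorphism, as mutable parts of quivers of its seeds. **Initial quivers.** $\mathscr{A}({\rm SL}_k,\mathbb{S})$ (resp. $\mathscr{A}'({\rm SL}_k,\mathbb{S})$) is the cluster algebra associated to the moduli space of ${\rm SL}_k$-local systems on $\mathbb{S}$ decorated by affine flags at all marked points (resp. affine flags at punctures and vectors at boundary points). Its initial quivers are as follows. Let $Q_k$ be the quiver with vertices $(a,b,c)\in\mathbb{N}^3$, $a+b+c=k$, excluding $(k,0,0),(0,k,0),(0,0,k)$,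 and, for every $(i,j,l)\in\mathbb{N}^3$ with $i+j+l=k-2$, arrows $(i{+}1,j{+}1,l)\to(i{+}1,j,l{+}1)\to(i,j{+}1,l{+}1)\to(i{+}1,j{+}1,l)$. For a triangle $\delta$ place a copy of $Q_k$ in $\delta$, with $(k,0,0),(0,k,0),(0,0,k)$ at its corners in clockwise order. For $\mathscr{A}({\rm SL}_k,\mathbb{S})$ and any regular triangulation, glue these along the $k-1$ vertices of each common side of triangles and cancel oriented $2$-cycles; the vertices on boundary intervals are frozen. For $\mathscr{A}'({\rm SL}_k,\mathbb{S})$ and any taut triangulation, do the same except that a triangle with a boundary-interval side (drawn as its bottom side) receives instead the quiver $Q_k^1$ with vertices $L_1,\dots,L_{k-1}$ (on the left side), $R_1,\dots,R_{k-1}$ (on the right side; index $k-1$ nearest the top corner), a frozen vertex $M$ on the bottom side, and arrows $R_a\to L_a$ $(1\le a\le k-1)$, $L_a\to R_{a-1}\to R_a$ $(2\le a\le k-1)$, $L_1\to M\to R_1$. Different triangulations give mutation-equivalent seeds. -}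

module Defs where

open import Data.Bool.Base using (Bool; true; false; not)
open import Data.Fin.Base using (Fin; zero; suc; toℕ; fromℕ<; opposite)
import Data.Fin.Properties as Fin
open import Data.Integer.Base as ℤ using (ℤ; +_; 0ℤ)
open import Data.List.Base
  using (List; []; _∷_; _++_; length; lookup; map; concatMap; filter; allFin; upTo)
open import Data.List.Relation.Unary.All using (All)
open import Data.List.Relation.Unary.Any using (Any)
open import Data.Nat.Base using (ℕ; zero; suc; _+_; _*_; _∸_; _≤_; _<_; z<s)
open import Data.Nat.DivMod using (_mod_)
open import Data.Nat.ListAction using (sum)
import Data.Nat.Properties as ℕ
open import Data.Nat.Tactic.RingSolver using (solve-∀)
open import Data.Product.Base using (Σ-syntax; ∃; ∃-syntax; _×_; _,_)
import Data.Product.Properties as Product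
open import Data.Sum.Base using (_⊎_; inj₁; inj₂)
import Data.Sum.Properties as Sum
open import Function.Bundles using (_↔_; Inverse)
open import Relation.Binary.Construct.Closure.Equivalence using (EqClosure)
open import Relation.Binary.Definitions using (DecidableEquality)
open import Relation.Binary.PropositionalEquality using (_≡_; refl; sym; trans; subst)
open import Relation.Nullary.Decidable using (Dec; yes; no; map′; _×-dec_)
open import Relation.Nullary.Negation using (¬_)

------------------------------------------------------------------------
-- Marked surfaces

data Excluded : (genus punctures : ℕ) (boundary : List ℕ) → Set where
  sphere           : ∀ {p} → p ≤ 2 → Excluded 0 p []
  monogon          : Excluded 0 0 (1 ∷ [])
  digon            : Excluded 0 0 (2 ∷ [])
  puncturedMonogon : Excluded 0 1 (1 ∷ [])

-- A connected oriented marked surface, recorded by the data which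
-- determine it up to orientation-preserving homeomorphism.  The list
-- `boundary` has one entry for each boundary component: the number of
-- marked points on that component.
record MarkedSurface : Set where
  field
    genus punctures : ℕ
    boundary        : List ℕ
    boundaryMarked  : All (0 <_) boundary
    hasMarkedPoint  : 0 < punctures + length boundary
    notExcluded     : ¬ Excluded genus punctures boundary

  -- (c , j) is the j-th marked point of the component c.  The points of a
  -- component are numbered cyclically, in the direction that keeps the
  -- surface on the right.
  BoundaryPoint : Set
  BoundaryPoint = Σ[ c ∈ Fin (length boundary) ] Fin (lookup boundary c)

  MarkedPoint : Set
  MarkedPoint = Fin punctures ⊎ BoundaryPoint

open MarkedSurface

IsOncePuncturedPolygon : ℕ → MarkedSurface → Set
IsOncePuncturedPolygon m S = genus S ≡ 0 × punctures S ≡ 1 × boundary S ≡ m ∷ []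

IsOncePuncturedBigon IsOncePuncturedTriangle : MarkedSurface → Set
IsOncePuncturedBigon    = IsOncePuncturedPolygon 2
IsOncePuncturedTriangle = IsOncePuncturedPolygon 3

------------------------------------------------------------------------
-- Triangulations

-- The cyclic successor.
next : ∀ {n} → Fin n → Fin n
next {suc n} i = suc (toℕ i) mod suc n

-- An edge with a direction.  `arc e true` and `arc e false` are the two
-- directions of the arc e.  The boundary interval that starts at the
-- boundary point p only occurs in the direction described at
-- `BoundaryPoint`.
data DirectedEdge (S : MarkedSurface) (#arcs : ℕ) : Set where
  arc      : Fin #arcs → Bool → DirectedEdge S #arcs
  interval : BoundaryPoint S → DirectedEdge S #arcs

IsInterval : ∀ {S n} → DirectedEdge S n → Set
IsInterval x = ∃[ p ] x ≡ interval p

isInterval? : ∀ {S n} (x : DirectedEdge S n) → Dec (IsInterval x)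
isInterval? (arc _ _)    = no λ ()
isInterval? (interval p) = yes (p , refl)

-- A gluing of triangles along the arcs, with marked points at the corners.
-- Each triangle is traversed clockwise: its side i runs from its corner i
-- to its corner i + 1 (mod 3).  Every arc is then traversed once in each
-- direction, and every boundary interval once, with its triangle on the
-- right; this is the bijection `sides`.
record Gluing (S : MarkedSurface) : Set where
  field
    #triangles #arcs : ℕ
    tail head        : Fin #arcs → MarkedPoint S
    sides            : (Fin #triangles × Fin 3) ↔ DirectedEdge S #arcs

  Triangle Arc Edge : Set
  Triangle = Fin #triangles
  Arc      = Fin #arcs
  Edge     = DirectedEdge S #arcs

  side : Triangle → Fin 3 → Edge
  side δ i = Inverse.to sides (δ , i)

  source target : Edge → MarkedPoint S
  source (arc e true)       = tail e
  source (arc e false)      = head e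
  source (interval p)       = inj₂ p
  target (arc e true)       = head e
  target (arc e false)      = tail e
  target (interval (c , j)) = inj₂ (c , next j)

  corner : Triangle → Fin 3 → MarkedPoint S
  corner δ i = source (side δ i)

  -- Side i of δ and side j of ε are the two sides of one arc.
  Glued : Triangle × Fin 3 → Triangle × Fin 3 → Set
  Glued (δ , i) (ε , j) = ∃[ e ] ∃[ d ] side δ i ≡ arc e d × side ε j ≡ arc e (not d)

  Adjacent : Triangle → Triangle → Set
  Adjacent δ ε = ∃[ i ] ∃[ j ] Glued (δ , i) (ε , j)

  -- Consecutive corners around a marked point: the side that leaves the
  -- first corner is glued to the side that arrives at the second one.
  Turn : Triangle × Fin 3 → Triangle × Fin 3 → Set
  Turn c (ε , j′) = ∃[ j ] Glued c (ε , j) × next j ≡ j′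

-- A triangulation of S, up to homeomorphism: a gluing whose result is S.
-- The field `link` says that corners which carry the same marked point are
-- identified by the gluing, so that the marked points are exactly the
-- vertices of the glued surface.  The field `euler` is
-- V - E + F = 2 - 2g - b.
record Triangulation (S : MarkedSurface) : Set where
  field
    gluing : Gluing S

  open Gluing gluing public

  field
    sidesMeet    : ∀ δ i → target (side δ i) ≡ corner δ (next i)
    cornersCover : ∀ p → ∃[ δ ] ∃[ i ] corner δ i ≡ p
    link         : ∀ δ i ε j → corner δ i ≡ corner ε j →
                   EqClosure Turn (δ , i) (ε , j)
    connected    : ∀ δ ε → EqClosure Adjacent δ ε
    euler        : (punctures S + sum (boundary S)) + #triangles
                     + (2 * genus S + length (boundary S))
                   ≡ 2 + (#arcs + sum (boundary S))

  -- A once-punctured monogon has only one triangulation, by the arc f from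
  -- its marked point to the puncture.  So the loop e encloses a single
  -- puncture exactly when the triangle on one side of e has an arc f as
  -- both of its other sides.
  EnclosesSinglePuncture : Arc → Set
  EnclosesSinglePuncture e =
    ∃[ δ ] ∃[ i ] ∃[ d ] ∃[ f ] ∃[ d₁ ] ∃[ d₂ ]
      side δ i ≡ arc e d ×
      side δ (next i) ≡ arc f d₁ ×
      side δ (next (next i)) ≡ arc f d₂

  Regular : Set
  Regular = ∀ e → ¬ EnclosesSinglePuncture e

  Taut : Set
  Taut = Regular ×
    (∀ δ i j → IsInterval (side δ i) → IsInterval (side δ j) → i ≡ j)

  HasBoundarySide : Triangle → Set
  HasBoundarySide δ = ∃[ i ] IsInterval (side δ i)

  hasBoundarySide? : ∀ δ → Dec (HasBoundarySide δ)
  hasBoundarySide? δ = Fin.any? λ i → isInterval? (side δ i)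

------------------------------------------------------------------------
-- Quivers and mutation

-- A quiver without loops and oriented 2-cycles, given by its
-- skew-symmetric matrix
--   b x y = #(arrows x → y) - #(arrows y → x).
record Quiver : Set₁ where
  field
    Vertex : Set
    b      : Vertex → Vertex → ℤ

record IceQuiver : Set₁ where
  field
    Mutable Frozen : Set
    _≟_            : DecidableEquality (Mutable ⊎ Frozen)
    b              : Mutable ⊎ Frozen → Mutable ⊎ Frozen → ℤ

open IceQuiver using (Mutable)

count : ∀ {V : Set} → DecidableEquality V → V → V → List (V × V) → ℕ
count _≟_ x y arrows =
  length (filter (λ a → Product.≡-dec _≟_ _≟_ a (x , y)) arrows)

-- Taking the difference of the two counts cancels oriented 2-cycles.
iceQuiver : ∀ {M F : Set} → DecidableEquality (M ⊎ F) →
            List ((M ⊎ F) × (M ⊎ F)) → IceQuiver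
iceQuiver {M} {F} _≟_ arrows = record
  { Mutable = M
  ; Frozen  = F
  ; _≟_     = _≟_
  ; b       = λ x y → + count _≟_ x y arrows ℤ.- + count _≟_ y x arrows
  }

mutateMatrix : ∀ {V : Set} → DecidableEquality V → V → (V → V → ℤ) → V → V → ℤ
mutateMatrix _≟_ v b x y with x ≟ v | y ≟ v
... | yes _ | _     = ℤ.- b x y
... | no _  | yes _ = ℤ.- b x y
... | no _  | no _  =
  b x y ℤ.+ (b x v ℤ.⊔ 0ℤ) ℤ.* (b v y ℤ.⊔ 0ℤ)
        ℤ.- (b y v ℤ.⊔ 0ℤ) ℤ.* (b v x ℤ.⊔ 0ℤ)

mutate : (Q : IceQuiver) → Mutable Q → IceQuiver
mutate Q v = record
  { Mutable = Mutable Q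
  ; Frozen  = Frozen
  ; _≟_     = _≟_
  ; b       = mutateMatrix _≟_ (inj₁ v) b
  }
  where open IceQuiver Q using (Frozen; _≟_; b)

mutateAlong : (Q : IceQuiver) → List (Mutable Q) → IceQuiver
mutateAlong Q []       = Q
mutateAlong Q (v ∷ vs) = mutateAlong (mutate Q v) vs

mutablePart : IceQuiver → Quiver
mutablePart Q = record
  { Vertex = Mutable Q
  ; b      = λ x y → IceQuiver.b Q (inj₁ x) (inj₁ y)
  }

_≅_ : Quiver → Quiver → Set
Q ≅ R = Σ[ f ∈ Q.Vertex ↔ R.Vertex ]
          (∀ x y → R.b (Inverse.to f x) (Inverse.to f y) ≡ Q.b x y)
  where
  module Q = Quiver Q
  module R = Quiver R

-- The quivers of the seeds of a cluster algebra are the quivers obtained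
-- from the initial one by sequences of mutations at mutable vertices.
FiniteMutationType : IceQuiver → Set₁
FiniteMutationType Q =
  ∃[ Rs ] (∀ vs → Any (mutablePart (mutateAlong Q vs) ≅_) Rs)

------------------------------------------------------------------------
-- The quivers of a single triangle

module _ (k : ℕ) where

  -- The k - 1 vertices on a directed side: the index s stands for the
  -- (1 + s)-th vertex from the start.
  SidePosition : Set
  SidePosition = Fin (k ∸ 1)

  position : (s : ℕ) → .(0 < s) → .(s < k) → SidePosition
  position s 0<s s<k = fromℕ< {s ∸ 1} (ℕ.∸-monoˡ-< s<k 0<s)

  -- The vertices of Q_k; given the sum, the bounds exclude the corners.
  record Node : Set where
    constructor node
    field
      a b c : ℕ
      .total : a + b + c ≡ k
      .a<k   : a < k
      .b<k   : b < k
      .c<k   : c < k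

  -- The vertex (1 + a , 1 + b , 1 + c) of Q_k.
  record InnerNode : Set where
    constructor inner
    field
      a b c : ℕ
      .total : suc a + suc b + suc c ≡ k

  _≟ⁱ_ : DecidableEquality InnerNode
  inner a b c _ ≟ⁱ inner a′ b′ c′ _ =
    map′ (λ { (refl , refl , refl) → refl }) (λ { refl → refl , refl , refl })
         (a ℕ.≟ a′ ×-dec b ℕ.≟ b′ ×-dec c ℕ.≟ c′)

  data Location : Set where
    onSide : Fin 3 → SidePosition → Location
    inside : InnerNode → Location

  private
    positive : ∀ {x y} → x + y ≡ k → x < k → 0 < y
    positive {x} {zero}  x+0≡k x<k = contra
      where
      contra : 0 < 0
      contra = subst (0 <_) (ℕ.n∸n≡0 k)
        (subst (λ z → 0 < k ∸ z) (trans (sym (ℕ.+-identityʳ x)) x+0≡k) (ℕ.m<n⇒0<n∸m x<k))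
    positive {x} {suc y} _     _   = z<s

    below : ∀ {x} y → x + suc y ≡ k → x < k
    below {x} y x+y≡k = subst (x <_) x+y≡k (ℕ.m<m+n x z<s)

  -- The corners (k,0,0), (0,k,0), (0,0,k) are the corners 0, 1, 2, and the
  -- position on a side is measured along its clockwise direction.
  locate : Node → Location
  locate (node a b zero t a<k b<k _) =
    onSide zero
      (position b (positive (trans (sym (ℕ.+-identityʳ (a + b))) t) a<k) b<k)
  locate (node zero b (suc c) t _ b<k c<k) =
    onSide (suc zero) (position (suc c) z<s c<k)
  locate (node (suc a) zero (suc c) t a<k _ c<k) =
    onSide (suc (suc zero)) (position (suc a) z<s a<k)
  locate (node (suc a) (suc b) (suc c) t _ _ _) =
    inside (inner a b c t)

  -- The three arrows of Q_k for i + j + l = k - 2.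
  arrowsAt : ∀ i j l → .(2 + (i + j + l) ≡ k) → List (Node × Node)
  arrowsAt i j l s = (p , q) ∷ (q , r) ∷ (r , p) ∷ []
    where
    p q r : Node
    p = node (suc i) (suc j) l
          (trans (e₁ i j l) s)
          (below (j + l) (trans (e₂ i j l) s))
          (below (i + l) (trans (e₃ i j l) s))
          (below (suc (i + j)) (trans (e₄ i j l) s))
      where
      e₁ : ∀ i j l → suc i + suc j + l ≡ 2 + (i + j + l)
      e₁ = solve-∀
      e₂ : ∀ i j l → suc i + suc (j + l) ≡ 2 + (i + j + l)
      e₂ = solve-∀
      e₃ : ∀ i j l → suc j + suc (i + l) ≡ 2 + (i + j + l)
      e₃ = solve-∀
      e₄ : ∀ i j l → l + suc (suc (i + j)) ≡ 2 + (i + j + l)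
      e₄ = solve-∀
    q = node (suc i) j (suc l)
          (trans (e₁ i j l) s)
          (below (j + l) (trans (e₂ i j l) s))
          (below (suc (i + l)) (trans (e₃ i j l) s))
          (below (i + j) (trans (e₄ i j l) s))
      where
      e₁ : ∀ i j l → suc i + j + suc l ≡ 2 + (i + j + l)
      e₁ = solve-∀
      e₂ : ∀ i j l → suc i + suc (j + l) ≡ 2 + (i + j + l)
      e₂ = solve-∀
      e₃ : ∀ i j l → j + suc (suc (i + l)) ≡ 2 + (i + j + l)
      e₃ = solve-∀
      e₄ : ∀ i j l → suc l + suc (i + j) ≡ 2 + (i + j + l)
      e₄ = solve-∀
    r = node i (suc j) (suc l)
          (trans (e₁ i j l) s)
          (below (suc (j + l)) (trans (e₂ i j l) s))
          (below (i + l) (trans (e₃ i j l) s))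
          (below (i + j) (trans (e₄ i j l) s))
      where
      e₁ : ∀ i j l → i + suc j + suc l ≡ 2 + (i + j + l)
      e₁ = solve-∀
      e₂ : ∀ i j l → i + suc (suc (j + l)) ≡ 2 + (i + j + l)
      e₂ = solve-∀
      e₃ : ∀ i j l → suc j + suc (i + l) ≡ 2 + (i + j + l)
      e₃ = solve-∀
      e₄ : ∀ i j l → suc l + suc (i + j) ≡ 2 + (i + j + l)
      e₄ = solve-∀

  arrowsAt? : ∀ i j l → List (Node × Node)
  arrowsAt? i j l with 2 + (i + j + l) ℕ.≟ k
  ... | yes s = arrowsAt i j l s
  ... | no  _ = []

  -- All arrows of Q_k; the bound i , j , l < k loses nothing.
  arrowsQ : List (Node × Node)
  arrowsQ =
    concatMap (λ i → concatMap (λ j → concatMap (λ l → arrowsAt? i j l)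
      (upTo k)) (upTo k)) (upTo k)

  -- The vertices of Q_k^1.  `L s` and `R s` stand for L_{1+s} and R_{1+s}.
  data Node¹ : Set where
    L R : SidePosition → Node¹
    M   : Node¹

  -- L_a → R_{a-1} → R_a, for s and t at the indices a - 1 and a.
  slanted : SidePosition → SidePosition → List (Node¹ × Node¹)
  slanted s t with suc (toℕ s) ℕ.≟ toℕ t
  ... | yes _ = (L t , R s) ∷ (R s , R t) ∷ []
  ... | no  _ = []

  -- L_1 → M → R_1.
  bottom : SidePosition → List (Node¹ × Node¹)
  bottom t with toℕ t ℕ.≟ 0
  ... | yes _ = (L t , M) ∷ (M , R t) ∷ []
  ... | no  _ = []

  arrowsQ¹ : List (Node¹ × Node¹)
  arrowsQ¹ = concatMap
    (λ t → (R t , L t) ∷ bottom t ++ concatMap (λ s → slanted s t) (allFin (k ∸ 1)))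
    (allFin (k ∸ 1))

------------------------------------------------------------------------
-- The initial quivers

mapArrows : ∀ {X Y : Set} → (X → Y) → List (X × X) → List (Y × Y)
mapArrows f = map λ { (x , y) → f x , f y }

module _ (S : MarkedSurface) where

  _≟ᵇ_ : DecidableEquality (BoundaryPoint S)
  _≟ᵇ_ = Product.≡-dec Fin._≟_ Fin._≟_

-- Both directions of an arc see the same k - 1 vertices, in opposite orders.
arcVertex : ∀ {n} k → Fin n → Bool → SidePosition k → Fin n × SidePosition k
arcVertex k e true  s = e , s
arcVertex k e false s = e , opposite s

module 𝒜 (k : ℕ) {S : MarkedSurface} (T : Triangulation S) where
  open Triangulation T

  Vertex : Set
  Vertex = (Arc × SidePosition k ⊎ Triangle × InnerNode k)
           ⊎ (BoundaryPoint S × SidePosition k)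

  _≟_ : DecidableEquality Vertex
  _≟_ = Sum.≡-dec
    (Sum.≡-dec (Product.≡-dec Fin._≟_ Fin._≟_) (Product.≡-dec Fin._≟_ (_≟ⁱ_ k)))
    (Product.≡-dec (_≟ᵇ_ S) Fin._≟_)

  edgeVertex : Edge → SidePosition k → Vertex
  edgeVertex (arc e d)    s = inj₁ (inj₁ (arcVertex k e d s))
  edgeVertex (interval p) s = inj₂ (p , s)

  placeAt : Triangle → Location k → Vertex
  placeAt δ (onSide i s) = edgeVertex (side δ i) s
  placeAt δ (inside y)   = inj₁ (inj₂ (δ , y))

  place : Triangle → Node k → Vertex
  place δ x = placeAt δ (locate k x)

  quiver : IceQuiver
  quiver = iceQuiver _≟_
    (concatMap (λ δ → mapArrows (place δ) (arrowsQ k)) (allFin #triangles))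

module 𝒜′ (k : ℕ) {S : MarkedSurface} (T : Triangulation S) where
  open Triangulation T

  -- A triangle that receives a copy of Q_k, not of Q_k^1.
  record InnerTriangle : Set where
    constructor innerTriangle
    field
      triangle    : Triangle
      .noBoundary : ¬ HasBoundarySide triangle

  open InnerTriangle using (triangle)

  _≟ᵗ_ : DecidableEquality InnerTriangle
  innerTriangle δ _ ≟ᵗ innerTriangle ε _ =
    map′ (λ { refl → refl }) (λ { refl → refl }) (δ Fin.≟ ε)

  Vertex : Set
  Vertex = (Arc × SidePosition k ⊎ InnerTriangle × InnerNode k) ⊎ BoundaryPoint S

  _≟_ : DecidableEquality Vertex
  _≟_ = Sum.≡-dec
    (Sum.≡-dec (Product.≡-dec Fin._≟_ Fin._≟_) (Product.≡-dec _≟ᵗ_ (_≟ⁱ_ k)))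
    (_≟ᵇ_ S)

  -- When T is taut this is only applied to arcs; the value in the second
  -- clause is arbitrary.
  edgeVertex : Edge → SidePosition k → Vertex
  edgeVertex (arc e d)    s = inj₁ (inj₁ (arcVertex k e d s))
  edgeVertex (interval p) _ = inj₂ p

  placeAt : InnerTriangle → Location k → Vertex
  placeAt δ (onSide i s) = edgeVertex (side (triangle δ) i) s
  placeAt δ (inside y)   = inj₁ (inj₂ (δ , y))

  place : InnerTriangle → Node k → Vertex
  place δ x = placeAt δ (locate k x)

  -- The bottom side is side i, the boundary interval at p.  The next side
  -- clockwise is the left one, directed towards the top corner; the one
  -- after that is the right one, directed away from the top corner.
  place¹ : Triangle → Fin 3 → BoundaryPoint S → Node¹ k → Vertex
  place¹ δ i p (L s) = edgeVertex (side δ (next i)) s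
  place¹ δ i p (R s) = edgeVertex (side δ (next (next i))) (opposite s)
  place¹ δ i p M     = inj₂ p

  arrowsIn : (δ : Triangle) → Dec (HasBoundarySide δ) → List (Vertex × Vertex)
  arrowsIn δ (yes (i , p , _)) = mapArrows (place¹ δ i p) (arrowsQ¹ k)
  arrowsIn δ (no none)         = mapArrows (place (innerTriangle δ none)) (arrowsQ k)

  quiver : IceQuiver
  quiver = iceQuiver _≟_
    (concatMap (λ δ → arrowsIn δ (hasBoundarySide? δ)) (allFin #triangles))

{-# OPTIONS --safe #-}
-- A connected set of triangles of a triangulation spans an induced subquiver,
-- on the vertices of the arcs that are glued inside the set and on the inner
-- vertices of the triangles.  Explore the triangulation from one triangle,
-- asking of one side at a time whether it is a boundary interval, is glued to
-- a known triangle or leads to a new one.  For k ≤ 6 every exploration soon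
-- ends.  Either some mutations of the subquiver produce vertices x, y, z with
-- b x y ≥ 2, b z x ≥ 1 and b z x > b y z, so that mutating alternately at x
-- and y gives unbounded entries, and the type is infinite; or all triangles
-- have been found and there are at most as many arcs as triangles, so that
-- Euler's formula and the existence of a puncture make the surface a
-- once-punctured polygon.  For k ≥ 7 one copy of Q_k, or the copies of Q_k^1
-- around two consecutive arcs at a puncture, already contains such a
-- subquiver, a copy of the one for k = 7.  Conversely, the same exploration of
-- a once-punctured polygon ends with the fan of triangles around the puncture,
-- whose quiver has a mutation class of at most six matrices up to isomorphism.

module Submission where

open import Defs
open import Data.Bool.Base using (Bool; true; false; T; not; _∧_; _∨_)
open import Data.Bool.Properties as Bool using (T-∨; T?)
open import Data.Empty using (⊥; ⊥-elim-irr)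
open import Data.Fin.Base as Fin using (Fin; toℕ; zero; suc; opposite; _↑ˡ_; _↑ʳ_)
open import Data.Fin.Patterns
open import Data.Fin.Permutation using (↔⇒≡)
import Data.Fin.Properties as Fin
open import Data.Integer.Base as ℤ using (ℤ; +_; -[1+_]; 0ℤ; 1ℤ; ∣_∣)
import Data.Integer.Properties as ℤ
import Data.Integer.Tactic.RingSolver as ℤ-Solver
open import Data.List.Base as List
  using (List; []; _∷_; _++_; length; lookup; filter; map; concatMap; allFin; upTo; applyUpTo;
    cartesianProduct; mapMaybe; deduplicate; head; drop; null; tabulate)
open import Data.List.Membership.Propositional using (_∈_; lose; find)
open import Data.List.Membership.Propositional.Properties
  using (∈-lookup; ∈-map⁺; ∈-filter⁺; ∈-filter⁻; ∈-cartesianProduct⁺; ∈-allFin; ∈-++⁺ˡ;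
    ∈-++⁺ʳ; ∈-concatMap⁺; ∈-upTo⁺)
open import Data.List.Properties as List using (length-filter)
open import Data.List.Relation.Unary.All as All using (All; []; _∷_)
import Data.List.Relation.Unary.All.Properties as All
open import Data.List.Relation.Unary.AllPairs as AllPairs using ([]; _∷_; AllPairs)
import Data.List.Relation.Unary.AllPairs.Properties as AllPairs
open import Data.List.Relation.Unary.Any as Any using (Any; here; there)
import Data.List.Relation.Unary.Any.Properties as Any
import Data.List.Relation.Unary.Unique.DecPropositional as Unique
import Data.List.Relation.Unary.Unique.DecPropositional.Properties as Unique
open import Data.List.Relation.Unary.Unique.Propositional using (Unique)
open import Data.Maybe.Base as Maybe using (Maybe; just; nothing; fromMaybe)
import Data.Maybe.Properties as Maybe
open import Data.Nat.Base as ℕ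
  using (ℕ; zero; suc; z≤n; s≤s; _≤_; _<_; _+_; _*_; _∸_; _≤ᵇ_; _<ᵇ_; _≡ᵇ_)
open import Data.Nat.DivMod using (_%_; _/_)
open import Data.Nat.ListAction using (sum)
import Data.Nat.Properties as ℕ
open import Data.Nat.Tactic.RingSolver using (solve-∀)
open import Data.Product.Base as Product using (Σ-syntax; ∃-syntax; _×_; _,_; proj₁; proj₂)
import Data.Product.Properties as Product
open import Data.Sum.Base as Sum using (_⊎_; inj₁; inj₂)
open import Data.Sum.Function.Propositional using (_⊎-↔_)
import Data.Sum.Properties as Sum
open import Data.Unit.Base using (⊤; tt)
open import Data.Vec.Base as Vec using (Vec; []; _∷_)
import Data.Vec.Properties as Vec
open import Function.Base using (_∘_; id; case_of_)
open import Function.Bundles using (_↔_; Inverse; mk↔ₛ′; Equivalence; _⇔_; mk⇔)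
open import Function.Construct.Composition using (_↔-∘_)
open import Function.Construct.Identity using (↔-id)
open import Function.Construct.Symmetry using (↔-sym)
open import Function.Definitions using (Injective)
open import Relation.Binary.Construct.Closure.Equivalence using (EqClosure)
open import Relation.Binary.Construct.Closure.ReflexiveTransitive
  using (_◅_) renaming (ε to done)
open import Relation.Binary.Construct.Closure.Symmetric using (fwd; bwd)
open import Relation.Binary.Definitions using (DecidableEquality; tri<; tri≈; tri>)
open import Relation.Binary.PropositionalEquality
open import Relation.Nullary.Decidable
  using (Dec; yes; no; _×-dec_; ¬?; isYes; toWitness; map′; decidable-stable; recompute)
open import Relation.Nullary.Negation using (¬_; contradiction)

open IceQuiver using (Mutable; Frozen; b)

-- Matrix mutation

-- The surface and its triangulation are unknown, while a mutation sequence can only be evaluated on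
-- an explicit matrix. Two facts bridge this gap. A mutated entry depends only on entries between
-- its own two vertices and the mutated one, so mutation commutes with restriction to a set of
-- mutable vertices, and growth in a subquiver is growth in the whole quiver. Moreover Q_k is
-- invariant under cyclic permutation of its coordinates, so an explored triangle may be turned
-- until the side through which it was reached has number 0; this keeps the number of cases at each
-- step small and independent of the surface. A patch gives a faithful copy of a subquiver only if
-- no triangle is glued to itself. Regularity provides this, together with the exclusion of the
-- once-punctured monogon. A certificate for k = 7 extends to larger k because it lives in a window
-- of fixed size: a corner region of Q_k, or the indices of Q_k^1 nearest to the boundary, which the
-- gluings around a puncture match with one another.

module _ {V : Set} (_≟_ : DecidableEquality V) (v : V) (B : V → V → ℤ) where

  mutate-row : ∀ y → mutateMatrix _≟_ v B v y ≡ ℤ.- B v y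
  mutate-row y with v ≟ v
  ... | yes _  = refl
  ... | no v≢v = contradiction refl v≢v

  mutate-column : ∀ x → mutateMatrix _≟_ v B x v ≡ ℤ.- B x v
  mutate-column x with x ≟ v | v ≟ v
  ... | yes _ | _      = refl
  ... | no _  | yes _  = refl
  ... | no _  | no v≢v = contradiction refl v≢v

  exchange : V → V → ℤ
  exchange x y =
    B x y ℤ.+ (B x v ℤ.⊔ 0ℤ) ℤ.* (B v y ℤ.⊔ 0ℤ)
          ℤ.- (B y v ℤ.⊔ 0ℤ) ℤ.* (B v x ℤ.⊔ 0ℤ)

  mutate-other : ∀ {x y} → x ≢ v → y ≢ v → mutateMatrix _≟_ v B x y ≡ exchange x y
  mutate-other {x} {y} x≢v y≢v with x ≟ v | y ≟ v
  ... | yes x≡v | _       = contradiction x≡v x≢v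
  ... | no _    | yes y≡v = contradiction y≡v y≢v
  ... | no _    | no _    = refl

  mutate-skew : (∀ x y → B y x ≡ ℤ.- B x y) →
    ∀ x y → mutateMatrix _≟_ v B y x ≡ ℤ.- mutateMatrix _≟_ v B x y
  mutate-skew skew x y with x ≟ v | y ≟ v
  ... | yes _ | yes _ = cong ℤ.-_ (skew x y)
  ... | yes _ | no _  = cong ℤ.-_ (skew x y)
  ... | no _  | yes _ = cong ℤ.-_ (skew x y)
  ... | no _  | no _  rewrite skew x y =
    negated (B x y) ((B y v ℤ.⊔ 0ℤ) ℤ.* (B v x ℤ.⊔ 0ℤ)) ((B x v ℤ.⊔ 0ℤ) ℤ.* (B v y ℤ.⊔ 0ℤ))
    where
    negated : ∀ a p q → ℤ.- a ℤ.+ p ℤ.- q ≡ ℤ.- (a ℤ.+ q ℤ.- p)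
    negated = ℤ-Solver.solve-∀

-- Bounds on entries and infinite mutation type

∣i⊔0∣≤∣i∣ : ∀ i → ∣ i ℤ.⊔ 0ℤ ∣ ≤ ∣ i ∣
∣i⊔0∣≤∣i∣ (+ n)    = ℕ.≤-reflexive (cong ∣_∣ (ℤ.i≥j⇒i⊔j≡i {+ n} {0ℤ} (ℤ.+≤+ z≤n)))
∣i⊔0∣≤∣i∣ -[1+ n ] = z≤n

EntriesBounded : {V : Set} → (V → V → ℤ) → ℕ → Set
EntriesBounded B N = ∀ x y → ∣ B x y ∣ ≤ N

mutate-bounded : {V : Set} (_≟_ : DecidableEquality V) (v : V) {B : V → V → ℤ} {N : ℕ} →
  EntriesBounded B N → EntriesBounded (mutateMatrix _≟_ v B) (N + N * N + N * N)
mutate-bounded _≟_ v {B} {N} bounded x y with x ≟ v | y ≟ v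
... | yes _ | _     = ℕ.≤-trans (ℕ.≤-reflexive (ℤ.∣-i∣≡∣i∣ (B x y)))
                        (ℕ.≤-trans (bounded x y)
                          (ℕ.≤-trans (ℕ.m≤m+n N (N * N)) (ℕ.m≤m+n _ (N * N))))
... | no _  | yes _ = ℕ.≤-trans (ℕ.≤-reflexive (ℤ.∣-i∣≡∣i∣ (B x y)))
                        (ℕ.≤-trans (bounded x y)
                          (ℕ.≤-trans (ℕ.m≤m+n N (N * N)) (ℕ.m≤m+n _ (N * N))))
... | no _  | no _  =
  ℕ.≤-trans (ℤ.∣i-j∣≤∣i∣+∣j∣ (B x y ℤ.+ product x v y) (product y v x))
    (ℕ.+-mono-≤
      (ℕ.≤-trans (ℤ.∣i+j∣≤∣i∣+∣j∣ (B x y) (product x v y))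
        (ℕ.+-mono-≤ (bounded x y) (product-bounded x v y)))
      (product-bounded y v x))
  where
  product : ∀ x y z → ℤ
  product x y z = (B x y ℤ.⊔ 0ℤ) ℤ.* (B y z ℤ.⊔ 0ℤ)
  product-bounded : ∀ x y z → ∣ product x y z ∣ ≤ N * N
  product-bounded x y z =
    ℕ.≤-trans (ℕ.≤-reflexive (ℤ.abs-* (B x y ℤ.⊔ 0ℤ) (B y z ℤ.⊔ 0ℤ)))
      (ℕ.*-mono-≤ (ℕ.≤-trans (∣i⊔0∣≤∣i∣ (B x y)) (bounded x y))
                  (ℕ.≤-trans (∣i⊔0∣≤∣i∣ (B y z)) (bounded y z)))

-- The vertices of an `IceQuiver` form arbitrary types, so a common bound on the entries is carried
-- as data. It comes from the length of the list of arrows and is updated by each mutation.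
record Tame (Q : IceQuiver) : Set where
  field
    skew    : ∀ x y → b Q y x ≡ ℤ.- b Q x y
    bound   : ℕ
    bounded : EntriesBounded (b Q) bound

open Tame

iceQuiver-tame : ∀ {M F : Set} (_≟_ : DecidableEquality (M ⊎ F)) arrows → Tame (iceQuiver _≟_ arrows)
iceQuiver-tame _≟_ arrows .skew x y =
  flipped (+ count _≟_ x y arrows) (+ count _≟_ y x arrows)
  where
  flipped : ∀ p q → q ℤ.- p ≡ ℤ.- (p ℤ.- q)
  flipped = ℤ-Solver.solve-∀
iceQuiver-tame _≟_ arrows .bound = length arrows + length arrows
iceQuiver-tame _≟_ arrows .bounded x y =
  ℕ.≤-trans (ℤ.∣i-j∣≤∣i∣+∣j∣ (+ count _≟_ x y arrows) (+ count _≟_ y x arrows))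
    (ℕ.+-mono-≤ (length-filter _ arrows) (length-filter _ arrows))

mutate-tame : ∀ {Q} v → Tame Q → Tame (mutate Q v)
mutate-tame {Q} v tame .skew    = mutate-skew (IceQuiver._≟_ Q) (inj₁ v) (b Q) (tame .skew)
mutate-tame {Q} v tame .bound   = tame .bound + tame .bound * tame .bound + tame .bound * tame .bound
mutate-tame {Q} v tame .bounded = mutate-bounded (IceQuiver._≟_ Q) (inj₁ v) {b Q} (tame .bounded)

mutateAlong-tame : ∀ {Q} vs → Tame Q → Tame (mutateAlong Q vs)
mutateAlong-tame []       tame = tame
mutateAlong-tame (v ∷ vs) tame = mutateAlong-tame vs (mutate-tame v tame)

-- Only entries between mutable vertices are considered: these are what an isomorphism of mutable
-- parts preserves.
UnboundedEntries : IceQuiver → Set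
UnboundedEntries Q = ∀ N → Σ[ vs ∈ List (Mutable Q) ]
  let B = Quiver.b (mutablePart (mutateAlong Q vs)) in ∃[ x ] ∃[ y ] N < ∣ B x y ∣

unbounded-after : ∀ {Q} vs → UnboundedEntries (mutateAlong Q vs) → UnboundedEntries Q
unbounded-after []       unbounded = unbounded
unbounded-after (v ∷ vs) unbounded N
  with ws , large ← unbounded-after vs unbounded N = v ∷ ws , large

module _ {Q : IceQuiver} (tame : Tame Q) (unbounded : UnboundedEntries Q) where

  private
    Word : Set
    Word = List (Mutable Q)

    boundAfter : Word → ℕ
    boundAfter vs = mutateAlong-tame vs tame .bound

    -- Each word is chosen to exceed the bound recorded for the preceding one, so these bounds
    -- increase strictly.
    words : ℕ → Word
    words zero    = []
    words (suc n) = proj₁ (unbounded (boundAfter (words n)))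

    large : ∀ n → ∃[ x ] ∃[ y ]
      boundAfter (words n) < ∣ Quiver.b (mutablePart (mutateAlong Q (words (suc n)))) x y ∣
    large n = proj₂ (unbounded (boundAfter (words n)))

    increasing : ∀ n → boundAfter (words n) < boundAfter (words (suc n))
    increasing n with x , y , lt ← large n =
      ℕ.<-≤-trans lt (mutateAlong-tame (words (suc n)) tame .bounded _ _)

    monotone : ∀ {m n} → m ℕ.≤′ n → boundAfter (words m) ≤ boundAfter (words n)
    monotone (ℕ.≤′-reflexive refl) = ℕ.≤-refl
    monotone {n = suc n} (ℕ.≤′-step m≤n)       = ℕ.≤-trans (monotone m≤n) (ℕ.<⇒≤ (increasing n))

    distinct : ∀ {m n} → m < n → ∀ {P} →
      mutablePart (mutateAlong Q (words m)) ≅ P → ¬ mutablePart (mutateAlong Q (words n)) ≅ P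
    distinct {m} {suc n} (s≤s m≤n) {P} (f , f-arrows) (g , g-arrows)
      with x , y , lt ← large n = ℕ.<⇒≱ lt (ℕ.≤-trans (ℕ.≤-reflexive (cong ∣_∣ same))
        (ℕ.≤-trans (mutateAlong-tame (words m) tame .bounded _ _) (monotone (ℕ.≤⇒≤′ m≤n))))
      where
      module f = Inverse f
      module g = Inverse g
      same : Quiver.b (mutablePart (mutateAlong Q (words (suc n)))) x y
        ≡ Quiver.b (mutablePart (mutateAlong Q (words m))) (f.from (g.to x)) (f.from (g.to y))
      same = trans (sym (g-arrows x y))
        (trans (cong₂ (Quiver.b P) (sym (f.strictlyInverseˡ _)) (sym (f.strictlyInverseˡ _)))
               (f-arrows _ _))

  -- Otherwise two of the quivers reached by `words` are isomorphic to the
  -- same quiver, while one has an entry above the bound for the other.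
  unbounded⇒infinite : ¬ FiniteMutationType Q
  unbounded⇒infinite (Rs , reach)
    with i , j , i<j , same ← Fin.pigeonhole (ℕ.n<1+n (length Rs)) (λ i → Any.index (reach (words (toℕ i))))
    = distinct i<j {lookup Rs (Any.index (reach (words (toℕ i))))}
        (Any.lookup-index (reach (words (toℕ i))))
        (subst (λ k → mutablePart (mutateAlong Q (words (toℕ j))) ≅ lookup Rs k) (sym same)
          (Any.lookup-index (reach (words (toℕ j)))))

-- Growth by alternating mutation at two vertices

-- A triple with b x y = m ≥ 2 and b z x > b y z.  Mutation at x turns
-- (b z x , b y z) = (β , α) into (m β - α , β) for the triple (y , x , z),
-- and m β - α > β.
record GrowingTriple (Q : IceQuiver) : Set where
  field
    x y z : Mutable Q
    x≢y : x ≢ y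
    x≢z : x ≢ z
    y≢z : y ≢ z
    multiple : + 2 ℤ.≤ Quiver.b (mutablePart Q) x y
    positive : 1ℤ ℤ.≤ Quiver.b (mutablePart Q) z x
    larger   : Quiver.b (mutablePart Q) y z ℤ.< Quiver.b (mutablePart Q) z x

  strength : ℤ
  strength = Quiver.b (mutablePart Q) z x

module Growth {Q : IceQuiver} (tame : Tame Q) (t : GrowingTriple Q) where
  open GrowingTriple t

  private
    B = b Q
    X Y Z : Mutable Q ⊎ Frozen Q
    X = inj₁ x
    Y = inj₁ y
    Z = inj₁ z

    B′ = b (mutate Q x)
    _≟_ = IceQuiver._≟_ Q

    m β α : ℤ
    m = B X Y
    β = B Z X
    α = B Y Z

    0≤m : 0ℤ ℤ.≤ m
    0≤m = ℤ.≤-trans (ℤ.+≤+ z≤n) multiple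

    0≤β : 0ℤ ℤ.≤ β
    0≤β = ℤ.≤-trans (ℤ.+≤+ z≤n) positive

    yx : B′ Y X ≡ m
    yx = trans (mutate-column _≟_ X B Y) (sym (tame .skew Y X))

    xz : B′ X Z ≡ β
    xz = trans (mutate-row _≟_ X B Z) (sym (tame .skew X Z))

    expand : ∀ a u v w → v ℤ.≤ 0ℤ → 0ℤ ℤ.≤ u → 0ℤ ℤ.≤ w →
      a ℤ.+ (u ℤ.⊔ 0ℤ) ℤ.* (w ℤ.⊔ 0ℤ) ℤ.- (v ℤ.⊔ 0ℤ) ℤ.* ((ℤ.- u) ℤ.⊔ 0ℤ) ≡ a ℤ.+ u ℤ.* w
    expand a u v w v≤0 0≤u 0≤w
      rewrite ℤ.i≥j⇒i⊔j≡i 0≤u | ℤ.i≥j⇒i⊔j≡i 0≤w | ℤ.i≤j⇒i⊔j≡j v≤0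
      = ℤ.+-identityʳ _

    zy : B′ Z Y ≡ ℤ.- α ℤ.+ β ℤ.* m
    zy = trans (mutate-other _≟_ X B (x≢z ∘ sym ∘ Sum.inj₁-injective) (x≢y ∘ sym ∘ Sum.inj₁-injective))
      (trans
        (cong (λ u → B Z Y ℤ.+ (β ℤ.⊔ 0ℤ) ℤ.* (m ℤ.⊔ 0ℤ) ℤ.- (B Y X ℤ.⊔ 0ℤ) ℤ.* (u ℤ.⊔ 0ℤ))
          (tame .skew Z X))
        (trans (expand (B Z Y) β (B Y X) m
                 (ℤ.≤-trans (ℤ.≤-reflexive (tame .skew X Y)) (ℤ.neg-mono-≤ 0≤m)) 0≤β 0≤m)
               (cong (ℤ._+ β ℤ.* m) (tame .skew Y Z))))

    -- From m ≥ 2 and β ≥ 0 follows m β - α ≥ 2 β - α = β + (β - α), and β - α is positive by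
    -- `larger`.
    β<zy : β ℤ.< ℤ.- α ℤ.+ β ℤ.* m
    β<zy = ℤ.<-≤-trans
      (ℤ.≤-<-trans (ℤ.≤-reflexive (sym (ℤ.+-identityˡ β)))
        (ℤ.+-monoˡ-< β (subst (ℤ._< β ℤ.- α) (ℤ.+-inverseʳ α) (ℤ.+-monoˡ-< (ℤ.- α) larger))))
      (ℤ.≤-trans (ℤ.≤-reflexive (regroup β α))
        (ℤ.+-monoʳ-≤ (ℤ.- α) (ℤ.*-monoˡ-≤-nonNeg β {{ℤ.nonNegative 0≤β}} multiple)))
      where
      regroup : ∀ β α → β ℤ.- α ℤ.+ β ≡ ℤ.- α ℤ.+ β ℤ.* + 2
      regroup = ℤ-Solver.solve-∀

  larger-next : β ℤ.< b (mutate Q x) Z Y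
  larger-next = subst (β ℤ.<_) (sym zy) β<zy

  next-triple : GrowingTriple (mutate Q x)
  next-triple = record
    { x = y ; y = x ; z = z
    ; x≢y = x≢y ∘ sym ; x≢z = y≢z ; y≢z = x≢z
    ; multiple = subst (+ 2 ℤ.≤_) (sym yx) multiple
    ; positive = ℤ.≤-trans positive (ℤ.<⇒≤ larger-next)
    ; larger   = subst (ℤ._< B′ Z Y) (sym xz) larger-next
    }

-- Every mutation raises the strength by at least one. The two mutated vertices alternate because
-- `next-triple` exchanges x and y.
grow : ∀ {Q} → Tame Q → (t : GrowingTriple Q) → ∀ n → Σ[ vs ∈ List (Mutable Q) ]
  Σ[ t′ ∈ GrowingTriple (mutateAlong Q vs) ] + n ℤ.+ GrowingTriple.strength t ℤ.≤ GrowingTriple.strength t′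
grow tame t zero    = [] , t , ℤ.≤-reflexive (ℤ.+-identityˡ _)
grow tame t (suc n) =
  let vs , t′ , n≤ = grow (mutate-tame (x t) tame) (Growth.next-triple tame t) n
  in x t ∷ vs , t′ ,
     ℤ.≤-trans
       (ℤ.≤-trans (ℤ.≤-reflexive (regroup (+ n) (strength t)))
         (ℤ.+-monoʳ-≤ (+ n) (ℤ.i<j⇒suc[i]≤j (Growth.larger-next tame t))))
       n≤
  where
  open GrowingTriple
  regroup : ∀ n b → 1ℤ ℤ.+ n ℤ.+ b ≡ n ℤ.+ (1ℤ ℤ.+ b)
  regroup = ℤ-Solver.solve-∀

growth-unbounded : ∀ {Q} → Tame Q → GrowingTriple Q → UnboundedEntries Q
growth-unbounded {Q} tame t N =
  let vs , t′ , large = grow tame t N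
  in vs , z t′ , x t′ ,
     ℤ.drop‿+<+ (ℤ.<-≤-trans (N<N+ (strength t) (positive t)) (ℤ.≤-trans large (i≤∣i∣ _)))
  where
  open GrowingTriple
  i≤∣i∣ : ∀ i → i ℤ.≤ + ∣ i ∣
  i≤∣i∣ (+ n)    = ℤ.≤-refl
  i≤∣i∣ -[1+ n ] = ℤ.-≤+
  N<N+ : ∀ i → 1ℤ ℤ.≤ i → + N ℤ.< + N ℤ.+ i
  N<N+ i 1≤i = ℤ.<-≤-trans (ℤ.+<+ (ℕ.m<m+n N (s≤s z≤n))) (ℤ.+-monoʳ-≤ (+ N) 1≤i)

-- Explicit matrices and induced subquivers

Matrix : ℕ → Set
Matrix n = Vec (Vec ℤ n) n

entry : ∀ {n} → Matrix n → Fin n → Fin n → ℤ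
entry A x y = Vec.lookup (Vec.lookup A x) y

-- A mutated matrix is stored as data: a further mutation then reads its entries instead of
-- unfolding all earlier mutations, which matters since certificates are checked by evaluation.
matrix : ∀ {n} → (Fin n → Fin n → ℤ) → Matrix n
matrix B = Vec.tabulate λ x → Vec.tabulate (B x)

entry-matrix : ∀ {n} (B : Fin n → Fin n → ℤ) x y → entry (matrix B) x y ≡ B x y
entry-matrix B x y =
  trans (cong (λ row → Vec.lookup row y) (Vec.lookup∘tabulate (λ x → Vec.tabulate (B x)) x))
        (Vec.lookup∘tabulate (B x) y)

mutateAt : ∀ {n} → Matrix n → Fin n → Matrix n
mutateAt A v = matrix (mutateMatrix Fin._≟_ v (entry A))

mutateAllAt : ∀ {n} → Matrix n → List (Fin n) → Matrix n
mutateAllAt = List.foldl mutateAt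

-- The exchange formula reads only entries between x, y and v. Injectivity of `f` makes the case
-- distinctions of `mutateMatrix` agree on both sides.
mutateMatrix-restrict : ∀ {V W : Set} _≟_ _≟′_ {B : V → V → ℤ} {C : W → W → ℤ}
  (f : W → V) → Injective _≡_ _≡_ f → (∀ x y → B (f x) (f y) ≡ C x y) →
  ∀ v x y → mutateMatrix _≟_ (f v) B (f x) (f y) ≡ mutateMatrix _≟′_ v C x y
mutateMatrix-restrict _≟_ _≟′_ {B} f f-inj same v x y
  with f x ≟ f v | f y ≟ f v | x ≟′ v | y ≟′ v
... | yes p | _     | no q  | _     = contradiction (f-inj p) q
... | no p  | _     | yes q | _     = contradiction (cong f q) p
... | _     | yes p | _     | no q  = contradiction (f-inj p) q
... | _     | no p  | _     | yes q = contradiction (cong f q) p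
... | yes _ | _     | yes _ | _     = cong ℤ.-_ (same x y)
... | no _  | yes _ | no _  | yes _ = cong ℤ.-_ (same x y)
... | no _  | no _  | no _  | no _
  rewrite same x y | same x v | same v y | same y v | same v x = refl

-- The image consists of mutable vertices, so every mutation of the matrix can be carried out in the
-- quiver.
record _EmbedsIn_ {n} (A : Matrix n) (Q : IceQuiver) : Set where
  field
    embed           : Fin n → Mutable Q
    embed-injective : Injective _≡_ _≡_ embed
    embed-entries   : ∀ x y → b Q (inj₁ (embed x)) (inj₁ (embed y)) ≡ entry A x y

open _EmbedsIn_

embeds-mutate : ∀ {n} {A : Matrix n} {Q} (e : A EmbedsIn Q) v →
  mutateAt A v EmbedsIn mutate Q (e .embed v)
embeds-mutate e v .embed    = e .embed
embeds-mutate e v .embed-injective = e .embed-injective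
embeds-mutate {A = A} {Q} e v .embed-entries x y =
  trans (mutateMatrix-restrict (IceQuiver._≟_ Q) Fin._≟_ (inj₁ ∘ e .embed)
          (e .embed-injective ∘ Sum.inj₁-injective) (e .embed-entries) v x y)
        (sym (entry-matrix (mutateMatrix Fin._≟_ v (entry A)) x y))

embeds-mutateAll : ∀ {n} {A : Matrix n} {Q} → A EmbedsIn Q → ∀ vs →
  Σ[ ws ∈ List (Mutable Q) ] mutateAllAt A vs EmbedsIn mutateAlong Q ws
embeds-mutateAll e []       = [] , e
embeds-mutateAll e (v ∷ vs) =
  let ws , e′ = embeds-mutateAll (embeds-mutate e v) vs in e .embed v ∷ ws , e′

module _ {n : ℕ} (A : Matrix n) (x y z : Fin n) where

  Growing : Set
  Growing = x ≢ y × x ≢ z × y ≢ z ×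
    + 2 ℤ.≤ entry A x y × 1ℤ ℤ.≤ entry A z x × entry A y z ℤ.< entry A z x

  growing? : Dec Growing
  growing? = ¬? (x Fin.≟ y) ×-dec ¬? (x Fin.≟ z) ×-dec ¬? (y Fin.≟ z) ×-dec
    + 2 ℤ.≤? entry A x y ×-dec 1ℤ ℤ.≤? entry A z x ×-dec entry A y z ℤ.<? entry A z x

growing-infinite : ∀ {n} {A : Matrix n} {Q} → Tame Q → A EmbedsIn Q → ∀ vs x y z →
  Growing (mutateAllAt A vs) x y z → ¬ FiniteMutationType Q
growing-infinite {A = A} {Q} tame e vs x y z (x≢y , x≢z , y≢z , xy , zx , yz) =
  let ws , e′ = embeds-mutateAll e vs
      t = record
        { x = e′ .embed x ; y = e′ .embed y ; z = e′ .embed z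
        ; x≢y = x≢y ∘ e′ .embed-injective ; x≢z = x≢z ∘ e′ .embed-injective ; y≢z = y≢z ∘ e′
            .embed-injective
        ; multiple = subst (+ 2 ℤ.≤_) (sym (e′ .embed-entries x y)) xy
        ; positive = subst (1ℤ ℤ.≤_) (sym (e′ .embed-entries z x)) zx
        ; larger   = subst₂ ℤ._<_ (sym (e′ .embed-entries y z)) (sym (e′ .embed-entries z x)) yz
        }
  in unbounded⇒infinite tame (unbounded-after ws (growth-unbounded (mutateAlong-tame ws tame) t))

-- Finite mutation classes

matrixQuiver : ∀ {n} → Matrix n → Quiver
matrixQuiver {n} A = record { Vertex = Fin n ; b = entry A }

-- A permutation together with its inverse; with both given, bijectivity is a finite check.
Relabelling : ℕ → Set
Relabelling n = Vec (Fin n) n × Vec (Fin n) n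

module _ {n : ℕ} (C D : Matrix n) where

  MutatesTo : Fin n → Relabelling n → Set
  MutatesTo v (π , ρ) =
    (∀ x → Vec.lookup π (Vec.lookup ρ x) ≡ x) ×
    (∀ x → Vec.lookup ρ (Vec.lookup π x) ≡ x) ×
    (∀ x y → entry D (Vec.lookup π x) (Vec.lookup π y) ≡ entry (mutateAt C v) x y)

  mutatesTo? : ∀ v r → Dec (MutatesTo v r)
  mutatesTo? v (π , ρ) =
    Fin.all? (λ x → Vec.lookup π (Vec.lookup ρ x) Fin.≟ x) ×-dec
    Fin.all? (λ x → Vec.lookup ρ (Vec.lookup π x) Fin.≟ x) ×-dec
    Fin.all? (λ x → Fin.all? λ y →
      entry D (Vec.lookup π x) (Vec.lookup π y) ℤ.≟ entry (mutateAt C v) x y)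

module _ {n r : ℕ} (class : Vec (Matrix n) r)
  (closed : ∀ i v → ∃[ j ] ∃[ π ] MutatesTo (Vec.lookup class i) (Vec.lookup class j) v π) where

  private
    -- The inverse of the isomorphism is an injection into the vertices of Q, so
    -- `mutateMatrix-restrict` turns mutation of Q at v into mutation of the matrix at the image of
    -- v.
    stays : ∀ {Q} i → mutablePart Q ≅ matrixQuiver (Vec.lookup class i) → ∀ v →
      ∃[ j ] mutablePart (mutate Q v) ≅ matrixQuiver (Vec.lookup class j)
    stays {Q} i (f , f-arrows) v with closed i (Inverse.to f v)
    ... | j , (π , ρ) , πρ , ρπ , arrows = j , mk↔ₛ′ (Vec.lookup π) (Vec.lookup ρ) πρ ρπ ↔-∘ f , λ x y →
      trans (arrows (to x) (to y)) (trans
        (entry-matrix (mutateMatrix Fin._≟_ (to v) (entry (Vec.lookup class i))) (to x) (to y))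
        (trans (sym (mutateMatrix-restrict (IceQuiver._≟_ Q) Fin._≟_ (inj₁ ∘ from)
                 (from-injective ∘ Sum.inj₁-injective) from-arrows (to v) (to x) (to y)))
          (cong₃ (λ v x y → mutateMatrix (IceQuiver._≟_ Q) (inj₁ v) (b Q) (inj₁ x) (inj₁ y))
            (strictlyInverseʳ v) (strictlyInverseʳ x) (strictlyInverseʳ y))))
      where
      open Inverse f using (to; from; strictlyInverseˡ; strictlyInverseʳ)
      from-injective : Injective _≡_ _≡_ from
      from-injective {x} {y} eq =
        trans (sym (strictlyInverseˡ x)) (trans (cong to eq) (strictlyInverseˡ y))
      from-arrows : ∀ x y → b Q (inj₁ (from x)) (inj₁ (from y)) ≡ entry (Vec.lookup class i) x y
      from-arrows x y = trans (sym (f-arrows (from x) (from y)))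
        (cong₂ (entry (Vec.lookup class i)) (strictlyInverseˡ x) (strictlyInverseˡ y))
      cong₃ : ∀ {X Y : Set} (g : X → X → X → Y) {x x′ y y′ z z′} →
        x ≡ x′ → y ≡ y′ → z ≡ z′ → g x y z ≡ g x′ y′ z′
      cong₃ g refl refl refl = refl

    reaches : ∀ {Q} i → mutablePart Q ≅ matrixQuiver (Vec.lookup class i) → ∀ vs →
      ∃[ j ] mutablePart (mutateAlong Q vs) ≅ matrixQuiver (Vec.lookup class j)
    reaches {Q} i iso []       = i , iso
    reaches {Q} i iso (v ∷ vs) = let j , iso′ = stays {Q} i iso v in reaches {mutate Q v} j iso′ vs

  closedClass-finite : ∀ {Q} i → mutablePart Q ≅ matrixQuiver (Vec.lookup class i) → FiniteMutationType Q
  closedClass-finite {Q} i iso = List.tabulate (matrixQuiver ∘ Vec.lookup class) , λ vs →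
    let j , iso′ = reaches {Q} i iso vs in Any.tabulate⁺ {P = mutablePart (mutateAlong Q vs) ≅_} {f = matrixQuiver ∘ Vec.lookup class} j iso′

-- Counting arrows by sums of indicators

private variable
  A C : Set

∑ : List A → (A → ℕ) → ℕ
∑ []       f = 0
∑ (x ∷ xs) f = f x + ∑ xs f

∑-cong : ∀ (xs : List A) {f g : A → ℕ} → (∀ x → f x ≡ g x) → ∑ xs f ≡ ∑ xs g
∑-cong []       eq = refl
∑-cong (x ∷ xs) eq = cong₂ _+_ (eq x) (∑-cong xs eq)

∑-zero : ∀ (xs : List A) {f : A → ℕ} → (∀ x → f x ≡ 0) → ∑ xs f ≡ 0
∑-zero []       eq = refl
∑-zero (x ∷ xs) eq = cong₂ _+_ (eq x) (∑-zero xs eq)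

∑-++ : ∀ (xs ys : List A) (f : A → ℕ) → ∑ (xs ++ ys) f ≡ ∑ xs f + ∑ ys f
∑-++ []       ys f = refl
∑-++ (x ∷ xs) ys f = trans (cong (f x ℕ.+_) (∑-++ xs ys f)) (sym (ℕ.+-assoc (f x) _ _))

∑-concatMap : ∀ (g : A → List C) xs (f : C → ℕ) → ∑ (concatMap g xs) f ≡ ∑ xs (λ x → ∑ (g x) f)
∑-concatMap g []       f = refl
∑-concatMap g (x ∷ xs) f =
  trans (∑-++ (g x) (concatMap g xs) f) (cong (∑ (g x) f ℕ.+_) (∑-concatMap g xs f))

∑-map : ∀ (g : A → C) xs (f : C → ℕ) → ∑ (map g xs) f ≡ ∑ xs (f ∘ g)
∑-map g []       f = refl
∑-map g (x ∷ xs) f = cong (f (g x) ℕ.+_) (∑-map g xs f)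

∑-+ : ∀ (xs : List A) (f g : A → ℕ) → ∑ xs (λ x → f x + g x) ≡ ∑ xs f + ∑ xs g
∑-+ []       f g = refl
∑-+ (x ∷ xs) f g rewrite ∑-+ xs f g = interchange (f x) (g x) (∑ xs f) (∑ xs g)
  where
  interchange : ∀ a b c d → a + b + (c + d) ≡ a + c + (b + d)
  interchange = solve-∀

∑-swap : ∀ (xs : List A) (ys : List C) (f : A → C → ℕ) →
  ∑ xs (λ x → ∑ ys (f x)) ≡ ∑ ys (λ y → ∑ xs (λ x → f x y))
∑-swap []       ys f = sym (∑-zero ys λ _ → refl)
∑-swap (x ∷ xs) ys f =
  trans (cong (∑ ys (f x) ℕ.+_) (∑-swap xs ys f)) (sym (∑-+ ys (f x) (λ y → ∑ xs (λ x → f x y))))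

χ : {P : Set} → Dec P → ℕ
χ (yes _) = 1
χ (no _)  = 0

χ-cong : ∀ {P Q : Set} (P? : Dec P) (Q? : Dec Q) → (P → Q) → (Q → P) → χ P? ≡ χ Q?
χ-cong (yes _) (yes _) _   _   = refl
χ-cong (yes p) (no ¬q) p⇒q _   = contradiction (p⇒q p) ¬q
χ-cong (no ¬p) (yes q) _   q⇒p = contradiction (q⇒p q) ¬p
χ-cong (no _)  (no _)  _   _   = refl

χ-no : ∀ {P : Set} (P? : Dec P) → ¬ P → χ P? ≡ 0
χ-no (yes p) ¬p = contradiction p ¬p
χ-no (no _)  _  = refl

χ-× : ∀ {P Q P×Q : Set} (P? : Dec P) (Q? : Dec Q) (P×Q? : Dec P×Q) →
  (P → Q → P×Q) → (P×Q → P × Q) → χ P×Q? ≡ χ P? ℕ.* χ Q?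
χ-× (yes p) (yes q) P×Q? pair split = χ-cong P×Q? (yes p) (λ _ → p) (λ _ → pair p q)
χ-× (yes _) (no ¬q) P×Q? pair split = χ-no P×Q? (¬q ∘ proj₂ ∘ split)
χ-× (no ¬p) _       P×Q? pair split = χ-no P×Q? (¬p ∘ proj₁ ∘ split)

∑-single : ∀ {n} (i : Fin n) (f : Fin n → ℕ) → (∀ j → j ≢ i → f j ≡ 0) → ∑ (allFin n) f ≡ f i
∑-single {suc n} zero f off =
  trans (cong (f zero ℕ.+_) (trans (cong (λ xs → ∑ xs f) (sym (List.map-tabulate id suc)))
          (trans (∑-map suc (allFin n) f) (∑-zero (allFin n) λ j → off (suc j) λ ()))))
    (ℕ.+-identityʳ (f zero))
∑-single {suc n} (suc i) f off =
  trans (cong₂ _+_ (off zero λ ()) (trans (cong (λ xs → ∑ xs f) (sym (List.map-tabulate id suc)))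
          (∑-map suc (allFin n) f)))
    (∑-single i (f ∘ suc) λ j j≢i → off (suc j) (j≢i ∘ Fin.suc-injective))

-- Replace f j by the sum over i of f j times the indicator of j = τ i. Injectivity leaves at most
-- one term, and outside the image f vanishes anyway. Then exchange the two sums.
∑-support : ∀ {m n} (τ : Fin m → Fin n) → Injective _≡_ _≡_ τ → (f : Fin n → ℕ) →
  (∀ j → (∀ i → j ≢ τ i) → f j ≡ 0) → ∑ (allFin n) f ≡ ∑ (allFin m) (f ∘ τ)
∑-support {m} {n} τ τ-inj f off = begin
  ∑ (allFin n) f                                     ≡⟨ ∑-cong (allFin n) spread ⟩
  ∑ (allFin n) (λ j → ∑ (allFin m) (λ i → term i j)) ≡⟨ ∑-swap (allFin n) (allFin m) (λ j i → term i j) ⟩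
  ∑ (allFin m) (λ i → ∑ (allFin n) (term i))         ≡⟨ ∑-cong (allFin m) collect ⟩
  ∑ (allFin m) (f ∘ τ)                               ∎
  where
  open ≡-Reasoning
  term : Fin m → Fin n → ℕ
  term i j = χ (j Fin.≟ τ i) ℕ.* f j
  term-yes : ∀ i → term i (τ i) ≡ f (τ i)
  term-yes i with τ i Fin.≟ τ i
  ... | yes _ = ℕ.+-identityʳ _
  ... | no ¬p = contradiction refl ¬p
  term-no : ∀ i j → j ≢ τ i → term i j ≡ 0
  term-no i j j≢ = cong (ℕ._* f j) (χ-no (j Fin.≟ τ i) j≢)
  spread : ∀ j → f j ≡ ∑ (allFin m) (λ i → term i j)
  spread j with Fin.any? (λ i → j Fin.≟ τ i)
  ... | yes (i , refl) = sym (trans (∑-single i (λ i′ → term i′ j) λ i′ i′≢i → term-no i′ j λ eq →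
      i′≢i (sym (τ-inj eq)))
                                    (term-yes i))
  ... | no none = trans (off j λ i eq → none (i , eq))
                        (sym (∑-zero (allFin m) λ i → term-no i j λ eq → none (i , eq)))
  collect : ∀ i → ∑ (allFin n) (term i) ≡ f (τ i)
  collect i = trans (∑-single (τ i) (term i) λ j → term-no i j) (term-yes i)

module _ (_≟_ : DecidableEquality A) (x y : A) where

  isArrow? : (a : A × A) → Dec (a ≡ (x , y))
  isArrow? a = Product.≡-dec _≟_ _≟_ a (x , y)

  count≡∑ : ∀ arrows → count _≟_ x y arrows ≡ ∑ arrows (χ ∘ isArrow?)
  count≡∑ []             = refl
  count≡∑ (a ∷ arrows) with isArrow? a
  ... | yes _ = cong suc (count≡∑ arrows)
  ... | no _  = count≡∑ arrows

  count-concatMap : ∀ (g : C → List (A × A)) cs →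
    count _≟_ x y (concatMap g cs) ≡ ∑ cs (count _≟_ x y ∘ g)
  count-concatMap g cs =
    trans (count≡∑ (concatMap g cs)) (trans (∑-concatMap g cs _) (∑-cong cs (sym ∘ count≡∑ ∘ g)))

  count-mapArrows : ∀ (f : C → A) arrows →
    count _≟_ x y (mapArrows f arrows) ≡ ∑ arrows (λ { (u , v) → χ (isArrow? (f u , f v)) })
  count-mapArrows f arrows =
    trans (count≡∑ (mapArrows f arrows)) (trans (∑-map _ arrows _) (∑-cong arrows λ _ → refl))

module _ {A B C : Set} (_≟_ : DecidableEquality A) (_≟′_ : DecidableEquality B)
  {f : C → A} {g : C → B} {x y : A} {x′ y′ : B}
  (xs : ∀ u → (f u ≡ x → g u ≡ x′) × (g u ≡ x′ → f u ≡ x))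
  (ys : ∀ u → (f u ≡ y → g u ≡ y′) × (g u ≡ y′ → f u ≡ y)) where

  -- The same arrows are drawn by two maps, which need to correspond only in their fibres over the
  -- two given vertices. A local drawing that forgets most vertices can thus stand for the global
  -- one.
  count-cong : ∀ arrows → count _≟_ x y (mapArrows f arrows) ≡ count _≟′_ x′ y′ (mapArrows g arrows)
  count-cong arrows =
    trans (count-mapArrows _≟_ x y f arrows)
      (trans (∑-cong arrows λ { (u , v) → χ-cong (isArrow? _≟_ x y (f u , f v))
          (isArrow? _≟′_ x′ y′ (g u , g v))
          (λ eq → cong₂ _,_ (proj₁ (xs u) (cong proj₁ eq)) (proj₁ (ys v) (cong proj₂ eq)))
          (λ eq → cong₂ _,_ (proj₂ (xs u) (cong proj₁ eq)) (proj₂ (ys v) (cong proj₂ eq))) })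
        (sym (count-mapArrows _≟′_ x′ y′ g arrows)))

count-absent : ∀ {A C : Set} (_≟_ : DecidableEquality A) {f : C → A} {x y : A} →
  (∀ u → f u ≢ x) → ∀ arrows → count _≟_ x y (mapArrows f arrows) ≡ 0
count-absent _≟_ {f} {x} {y} absent arrows =
  trans (count-mapArrows _≟_ x y f arrows)
    (∑-zero arrows λ { (u , v) → χ-no (isArrow? _≟_ x y (f u , f v)) (absent u ∘ cong proj₁) })

lookup-unique : ∀ {xs : List A} → Unique xs → Injective _≡_ _≡_ (lookup xs)
lookup-unique (_ ∷ _)    {zero}  {zero}  _  = refl
lookup-unique (x∉ ∷ _)   {zero}  {suc j} eq = contradiction eq (All.lookup x∉ (∈-lookup j))
lookup-unique (x∉ ∷ _)   {suc i} {zero}  eq = contradiction (sym eq) (All.lookup x∉ (∈-lookup i))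
lookup-unique (_ ∷ uniq) {suc i} {suc j} eq = cong suc (lookup-unique uniq eq)

∑-filter : ∀ {P : A → Set} (P? : ∀ x → Dec (P x)) xs (f : A → ℕ) →
  ∑ (filter P? xs) f ≡ ∑ xs (λ x → χ (P? x) ℕ.* f x)
∑-filter P? []       f = refl
∑-filter P? (x ∷ xs) f with P? x
... | yes _ = cong₂ _+_ (sym (ℕ.+-identityʳ (f x))) (∑-filter P? xs f)
... | no _  = ∑-filter P? xs f

length≡∑ : (xs : List A) → length xs ≡ ∑ xs (λ _ → 1)
length≡∑ []       = refl
length≡∑ (_ ∷ xs) = cong suc (length≡∑ xs)

module _ {n : ℕ} where

  targets sources : Fin n → List (Fin n × Fin n) → List (Fin n)
  targets i as = map proj₂ (filter (λ a → proj₁ a Fin.≟ i) as)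
  sources i as = map proj₁ (filter (λ a → proj₂ a Fin.≟ i) as)

  occurrences : Fin n → List (Fin n) → ℕ
  occurrences i js = length (filter (Fin._≟ i) js)

  row : List (Fin n) → List (Fin n) → Vec ℤ n
  row outs ins = Vec.tabulate λ j → + occurrences j outs ℤ.- + occurrences j ins

  -- Row i only scans the arrows at i, which keeps the evaluation of the
  -- certificates cheap.
  arrowMatrix : List (Fin n × Fin n) → Matrix n
  arrowMatrix as = Vec.tabulate λ i → row (targets i as) (sources i as)

  multiplicity : Fin n → Fin n → List (Fin n × Fin n) → ℕ
  multiplicity i j as = ∑ as λ a → χ (proj₁ a Fin.≟ i) ℕ.* χ (proj₂ a Fin.≟ j)

  occurrences≡∑ : ∀ i js → occurrences i js ≡ ∑ js (λ j → χ (j Fin.≟ i))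
  occurrences≡∑ i js = trans (length≡∑ (filter (Fin._≟ i) js))
    (trans (∑-filter (Fin._≟ i) js (λ _ → 1)) (∑-cong js λ j → ℕ.*-identityʳ _))

  occurrences-targets : ∀ i j as → occurrences j (targets i as) ≡ multiplicity i j as
  occurrences-targets i j as = trans (occurrences≡∑ j (targets i as))
    (trans (∑-map proj₂ (filter (λ a → proj₁ a Fin.≟ i) as) (λ v → χ (v Fin.≟ j)))
      (∑-filter (λ a → proj₁ a Fin.≟ i) as (λ a → χ (proj₂ a Fin.≟ j))))

  occurrences-sources : ∀ i j as → occurrences j (sources i as) ≡ multiplicity j i as
  occurrences-sources i j as = trans (occurrences≡∑ j (sources i as))
    (trans (∑-map proj₁ (filter (λ a → proj₂ a Fin.≟ i) as) (λ v → χ (v Fin.≟ j)))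
      (trans (∑-filter (λ a → proj₂ a Fin.≟ i) as (λ a → χ (proj₁ a Fin.≟ j)))
        (∑-cong as λ a → ℕ.*-comm (χ (proj₂ a Fin.≟ i)) _)))

  entry-arrowMatrix : ∀ as i j →
    entry (arrowMatrix as) i j ≡ + multiplicity i j as ℤ.- + multiplicity j i as
  entry-arrowMatrix as i j = trans
    (cong (λ r → Vec.lookup r j) (Vec.lookup∘tabulate (λ i → row (targets i as) (sources i as)) i))
    (trans (Vec.lookup∘tabulate (λ j → + occurrences j (targets i as) ℤ.- + occurrences j (sources i as)) j)
      (cong₂ (λ p q → + p ℤ.- + q) (occurrences-targets i j as) (occurrences-sources i j as)))

-- The matrix of locally named arrows

module _ {L : Set} (_≟_ : DecidableEquality L) where

  -- `nothing` is the common label of all vertices outside the local model; both ends that are asked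
  -- for are `just`, so it never contributes.
  localCount : L → L → List (Maybe L × Maybe L) → ℕ
  localCount x y = count (Maybe.≡-dec _≟_) (just x) (just y)

  module _ (us : List L) where

    indexOf : L → Maybe (Fin (length us))
    indexOf v with Any.any? (v ≟_) us
    ... | yes v∈us = just (Any.index v∈us)
    ... | no _     = nothing

    end : Maybe L → Maybe (Fin (length us))
    end nothing  = nothing
    end (just v) = indexOf v

    -- Dropping the arrows with an end outside `us` is the passage to the induced subquiver.
    cons : Maybe (Fin (length us)) → Maybe (Fin (length us)) →
      List (Fin (length us) × Fin (length us)) → List (Fin (length us) × Fin (length us))
    cons (just i) (just j) as = (i , j) ∷ as
    cons _        _        as = as

    encode : List (Maybe L × Maybe L) → List (Fin (length us) × Fin (length us))
    encode []             = []
    encode ((u , v) ∷ as) = cons (end u) (end v) (encode as)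

    localMatrix : List (Maybe L × Maybe L) → Matrix (length us)
    localMatrix arrows = arrowMatrix (encode arrows)

    module _ (unique : Unique us) where

      end-lookup : ∀ u i → end u ≡ just i → u ≡ just (lookup us i)
      end-lookup (just u) i eq with Any.any? (u ≟_) us
      ... | yes u∈us with refl ← eq = cong just (Any.lookup-index u∈us)

      lookup-end : ∀ i → end (just (lookup us i)) ≡ just i
      lookup-end i with Any.any? (lookup us i ≟_) us
      ... | yes u∈us = cong just (lookup-unique unique (sym (Any.lookup-index u∈us)))
      ... | no u∉us  = contradiction (∈-lookup i) u∉us

      indicator : Fin (length us) → Maybe (Fin (length us)) → ℕ
      indicator i (just j) = χ (j Fin.≟ i)
      indicator i nothing  = 0

      indicator-end : ∀ i u → χ (Maybe.≡-dec _≟_ u (just (lookup us i))) ≡ indicator i (end u)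
      indicator-end i u with end u in eq
      ... | just j  = χ-cong (Maybe.≡-dec _≟_ u (just (lookup us i))) (j Fin.≟ i)
        (λ { refl → Maybe.just-injective (trans (sym eq) (lookup-end i)) }) (λ { refl → end-lookup u i eq })
      ... | nothing = χ-no (Maybe.≡-dec _≟_ u (just (lookup us i)))
        (λ { refl → contradiction (trans (sym (lookup-end i)) eq) λ () })

      ∑-cons : ∀ i j a b as → multiplicity i j (cons a b as) ≡ indicator i a ℕ.* indicator j b +
          multiplicity i j as
      ∑-cons i j (just _) (just _) as = refl
      ∑-cons i j (just a) nothing  as = cong (_+ multiplicity i j as)
          (sym (ℕ.*-zeroʳ (indicator i (just a))))
      ∑-cons i j nothing  b        as = refl

      localCount-encode : ∀ i j arrows →
        localCount (lookup us i) (lookup us j) arrows ≡ multiplicity i j (encode arrows)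
      localCount-encode i j arrows = trans (count≡∑ (Maybe.≡-dec _≟_) _ _ arrows) (go arrows)
        where
        product : ∀ u v → χ (isArrow? (Maybe.≡-dec _≟_) (just (lookup us i)) (just (lookup us j)) (u , v)) ≡
          χ (Maybe.≡-dec _≟_ u (just (lookup us i))) ℕ.* χ (Maybe.≡-dec _≟_ v (just (lookup us j)))
        product u v = χ-× (Maybe.≡-dec _≟_ u (just (lookup us i))) (Maybe.≡-dec _≟_ v (just (lookup us j)))
          (isArrow? (Maybe.≡-dec _≟_) _ _ (u , v)) (λ { refl refl → refl }) (λ { refl → refl , refl })
        go : ∀ arrows → ∑ arrows (χ ∘ isArrow? (Maybe.≡-dec _≟_) (just (lookup us i))
            (just (lookup us j))) ≡
          multiplicity i j (encode arrows)
        go []             = refl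
        go ((u , v) ∷ as) = trans
          (cong₂ _+_ (trans (product u v) (cong₂ ℕ._*_ (indicator-end i u) (indicator-end j v))) (go as))
          (sym (∑-cons i j (end u) (end v) (encode as)))

module _ {n m : ℕ} {Mutable Frozen L : Set}
  (_≟_ : DecidableEquality (Mutable ⊎ Frozen)) (_≟ᴸ_ : DecidableEquality L)
  (arrowsOf : Fin n → List ((Mutable ⊎ Frozen) × (Mutable ⊎ Frozen)))
  (localArrows : Fin m → List (Maybe L × Maybe L))
  (τ : Fin m → Fin n) (τ-inj : Injective _≡_ _≡_ τ)
  (us : List L) (unique : Unique us) (vertex : Fin (length us) → Mutable)
      (vertex-inj : Injective _≡_ _≡_ vertex)
  (inside : ∀ i j t →
     count _≟_ (inj₁ (vertex i)) (inj₁ (vertex j)) (arrowsOf (τ t)) ≡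
     localCount _≟ᴸ_ (lookup us i) (lookup us j) (localArrows t))
  (outside : ∀ i j δ → (∀ t → δ ≢ τ t) →
     count _≟_ (inj₁ (vertex i)) (inj₁ (vertex j)) (arrowsOf δ) ≡ 0) where

  -- Counts in the glued quiver are sums over triangles: by `outside` only triangles in the image of
  -- `τ` contribute, and by injectivity each contributes once. Differences are formed after summing,
  -- so arrows that cancel between neighbouring triangles cancel on both sides.
  localMatrix-embeds : localMatrix _≟ᴸ_ us (concatMap localArrows (allFin m)) EmbedsIn
    iceQuiver _≟_ (concatMap arrowsOf (allFin n))
  localMatrix-embeds = record
    { embed = vertex
    ; embed-injective = vertex-inj
    ; embed-entries = λ i j → trans (cong₂ (λ p q → + p ℤ.- + q) (counts i j) (counts j i))
        (sym (entry-arrowMatrix (encode _≟ᴸ_ us (concatMap localArrows (allFin m))) i j))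
    }
    where
    counts : ∀ i j →
      count _≟_ (inj₁ (vertex i)) (inj₁ (vertex j)) (concatMap arrowsOf (allFin n)) ≡
      multiplicity i j (encode _≟ᴸ_ us (concatMap localArrows (allFin m)))
    counts i j = trans (count-concatMap _≟_ _ _ arrowsOf (allFin n))
      (trans (∑-support τ τ-inj _ (outside i j))
        (trans (∑-cong (allFin m) (inside i j))
          (trans (sym (count-concatMap (Maybe.≡-dec _≟ᴸ_) _ _ localArrows (allFin m)))
            (localCount-encode _≟ᴸ_ us unique i j (concatMap localArrows (allFin m))))))

-- Euler's formula and once-punctured polygons

open MarkedSurface using (genus; punctures; boundary; boundaryMarked; notExcluded)

points↔ : ∀ bs → Fin (sum bs) ↔ (Σ[ c ∈ Fin (length bs) ] Fin (lookup bs c))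
points↔ []       = mk↔ₛ′ (λ ()) (λ ()) (λ ()) (λ ())
points↔ (n ∷ bs) = split ↔-∘ ((↔-id (Fin n) ⊎-↔ points↔ bs) ↔-∘ Fin.+↔⊎)
  where
  split : (Fin n ⊎ Σ[ c ∈ Fin (length bs) ] Fin (lookup bs c)) ↔
          (Σ[ c ∈ Fin (suc (length bs)) ] Fin (lookup (n ∷ bs) c))
  split = mk↔ₛ′ (λ { (inj₁ j) → zero , j ; (inj₂ (c , j)) → suc c , j })
                (λ { (zero , j) → inj₁ j ; (suc c , j) → inj₂ (c , j) })
                (λ { (zero , j) → refl ; (suc c , j) → refl })
                (λ { (inj₁ j) → refl ; (inj₂ (c , j)) → refl })

next³ : ∀ (i : Fin 3) → next (next (next i)) ≡ i
next³ 0F = refl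
next³ 1F = refl
next³ 2F = refl

cover : ∀ (i j : Fin 3) → j ≡ i ⊎ j ≡ next i ⊎ j ≡ next (next i)
cover 0F 0F = inj₁ refl
cover 0F 1F = inj₂ (inj₁ refl)
cover 0F 2F = inj₂ (inj₂ refl)
cover 1F 0F = inj₂ (inj₂ refl)
cover 1F 1F = inj₁ refl
cover 1F 2F = inj₂ (inj₁ refl)
cover 2F 0F = inj₂ (inj₁ refl)
cover 2F 1F = inj₂ (inj₂ refl)
cover 2F 2F = inj₁ refl

module _ {S : MarkedSurface} (T : Triangulation S) where
  open Triangulation T

  -- This is the cardinality of the bijection `sides`: an arc takes up two sides, a boundary
  -- interval one, and there are as many intervals as boundary points.
  sideCount : #triangles * 3 ≡ #arcs * 2 + sum (boundary S)
  sideCount = ↔⇒≡ (↔-sym Fin.+↔⊎ ↔-∘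
    ((↔-sym Fin.*↔× ⊎-↔ ↔-sym (points↔ (boundary S))) ↔-∘
    (edges ↔-∘ (sides ↔-∘ Fin.*↔×))))
    where
    edges : Edge ↔ ((Arc × Fin 2) ⊎ MarkedSurface.BoundaryPoint S)
    edges = mk↔ₛ′
      (λ { (arc e true) → inj₁ (e , 0F) ; (arc e false) → inj₁ (e , 1F) ; (interval p) → inj₂ p })
      (λ { (inj₁ (e , 0F)) → arc e true ; (inj₁ (e , 1F)) → arc e false ; (inj₂ p) → interval p })
      (λ { (inj₁ (e , 0F)) → refl ; (inj₁ (e , 1F)) → refl ; (inj₂ p) → refl })
      (λ { (arc e true) → refl ; (arc e false) → refl ; (interval p) → refl })

  0<sum⇒0<length : ∀ bs → 0 < sum bs → 0 < length bs
  0<sum⇒0<length (_ ∷ _) _ = s≤s z≤n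

  -- Supplies the hypothesis b ≥ 1 of `polygonNumbers`: a ≤ F and 3 F = 2 a + Σ give Σ ≥ F.
  fewArcs⇒boundary : ∀ {F a Σ} → 1 ≤ F → a ≤ F → F * 3 ≡ a * 2 + Σ → 1 ≤ Σ
  fewArcs⇒boundary {F} {a} {Σ} 1≤F a≤F count = ℕ.≤-trans 1≤F
    (ℕ.+-cancelˡ-≤ (a * 2) F Σ (ℕ.≤-trans
      (ℕ.+-monoˡ-≤ F (ℕ.*-monoˡ-≤ 2 a≤F)) (ℕ.≤-trans (ℕ.≤-reflexive (three F)) (ℕ.≤-reflexive count))))
    where
    three : ∀ F → F * 2 + F ≡ F * 3
    three = solve-∀

  -- Euler's formula becomes (p - 1) + (b - 1) + 2 g = a - F. The left side is a sum of nonnegative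
  -- terms and the right side is at most 0, so every term vanishes and a = F; then 3 F = 2 a + Σ
  -- yields Σ = F.
  polygonNumbers : ∀ {p F b} g a Σ → 1 ≤ p → 1 ≤ b → a ≤ F →
    F * 3 ≡ a * 2 + Σ → (p + Σ) + F + (2 * g + b) ≡ 2 + (a + Σ) →
    p ≡ 1 × b ≡ 1 × g ≡ 0 × a ≡ F × Σ ≡ F
  polygonNumbers {suc p} {F} {suc b} g a Σ _ _ a≤F count χ =
    cong suc (ℕ.m+n≡0⇒m≡0 p small) , cong suc (ℕ.m+n≡0⇒n≡0 (2 * g) small′) ,
    ℕ.m+n≡0⇒m≡0 g (ℕ.m+n≡0⇒m≡0 (2 * g) small′) , a≡F ,
    ℕ.+-cancelˡ-≡ (a * 2) Σ F (trans (sym count) (trans (three F) (cong (λ a → a * 2 + F) (sym a≡F))))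
    where
    three : ∀ F → F * 3 ≡ F * 2 + F
    three = solve-∀
    regroup : ∀ p Σ F g b → (suc p + Σ) + F + (2 * g + suc b) ≡ (2 + Σ) + (F + (p + (2 * g + b)))
    regroup = solve-∀
    regroup′ : ∀ a Σ → 2 + (a + Σ) ≡ (2 + Σ) + a
    regroup′ = solve-∀
    excess : F + (p + (2 * g + b)) ≡ a
    excess = ℕ.+-cancelˡ-≡ (2 + Σ) _ _ (trans (sym (regroup p Σ F g b)) (trans χ (regroup′ a Σ)))
    small : p + (2 * g + b) ≡ 0
    small = ℕ.n≤0⇒n≡0 (ℕ.+-cancelˡ-≤ F _ 0 (ℕ.≤-trans (ℕ.≤-reflexive excess)
      (ℕ.≤-trans a≤F (ℕ.≤-reflexive (sym (ℕ.+-identityʳ F))))))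
    small′ : 2 * g + b ≡ 0
    small′ = ℕ.m+n≡0⇒n≡0 p small
    a≡F : a ≡ F
    a≡F = trans (sym excess) (trans (cong (ℕ._+_ F) small) (ℕ.+-identityʳ F))

  module _ (1≤p : 1 ≤ punctures S) where

    0<#triangles : 0 < #triangles
    0<#triangles with cornersCover (inj₁ (Fin.fromℕ< 1≤p))
    ... | δ , _ = ℕ.≤-<-trans z≤n (Fin.toℕ<n δ)

    fewArcs⇒polygon : #arcs ≤ #triangles → IsOncePuncturedPolygon #triangles S
    fewArcs⇒polygon few
      with p≡1 , b≡1 , g≡0 , _ , Σ≡F ← polygonNumbers (genus S) #arcs (sum (boundary S))
             1≤p (0<sum⇒0<length (boundary S) (fewArcs⇒boundary 0<#triangles few sideCount)) few
                 sideCount euler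
      = g≡0 , p≡1 , singleton (boundary S) b≡1 Σ≡F
      where
      singleton : ∀ bs {n} → length bs ≡ 1 → sum bs ≡ n → bs ≡ n ∷ []
      singleton (m ∷ []) _ eq = cong (_∷ []) (trans (sym (ℕ.+-identityʳ m)) eq)

  polygon-#triangles : ∀ {n} → IsOncePuncturedPolygon n S → #triangles ≡ n × #arcs ≡ n
  polygon-#triangles {n} (g≡0 , p≡1 , b≡n) = numbers #triangles #arcs count′ χ′
    where
    count′ : #triangles * 3 ≡ #arcs * 2 + n
    count′ = trans sideCount (cong (#arcs * 2 ℕ.+_) (trans (cong sum b≡n) (ℕ.+-identityʳ n)))
    χ′ : #triangles + (2 + n) ≡ #arcs + (2 + n)
    χ′ = trans (sym (regroup n #triangles)) (trans
           (trans (sym (cong₂ _+_ (cong₂ (λ p b → p + sum b + #triangles) p≡1 b≡n)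
               (cong₂ (λ g b → 2 * g + length b) g≡0 b≡n)))
                  (trans euler (cong (λ b → 2 + (#arcs + sum b)) b≡n)))
           (regroup′ n #arcs))
      where
      regroup : ∀ n F → (1 + (n + 0)) + F + 1 ≡ F + (2 + n)
      regroup = solve-∀
      regroup′ : ∀ n a → 2 + (a + (n + 0)) ≡ a + (2 + n)
      regroup′ = solve-∀
    numbers : ∀ F a → F * 3 ≡ a * 2 + n → F + (2 + n) ≡ a + (2 + n) → F ≡ n × a ≡ n
    numbers F a count χ with refl ← ℕ.+-cancelʳ-≡ (2 + n) F a χ =
      F≡n , F≡n
      where
      F≡n = ℕ.+-cancelˡ-≡ (F * 2) F n (trans (three F) count)
        where
        three : ∀ F → F * 2 + F ≡ F * 3
        three = solve-∀

  -- Glued sides and the absence of self-gluing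

  side-injective : ∀ {s t} → Inverse.to sides s ≡ Inverse.to sides t → s ≡ t
  side-injective {s} {t} eq =
    trans (sym (Inverse.strictlyInverseʳ sides s))
      (trans (cong (Inverse.from sides) eq) (Inverse.strictlyInverseʳ sides t))

  arc-injective : ∀ {e f c d} → arc {S} {#arcs} e c ≡ arc f d → e ≡ f
  arc-injective refl = refl

  not-not : ∀ d → not (not d) ≡ d
  not-not true  = refl
  not-not false = refl

  Glued-sym : ∀ {s t} → Glued s t → Glued t s
  Glued-sym (e , d , p , q) = e , not d , q , trans p (cong (arc e) (sym (not-not d)))

  Glued-unique : ∀ {s t u} → Glued s t → Glued s u → t ≡ u
  Glued-unique (e , d , p , q) (e′ , d′ , p′ , q′) with trans (sym p) p′
  ... | refl = side-injective (trans q (sym q′))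

  Glued-noninterval : ∀ {s t} → Glued s t → ¬ IsInterval (Inverse.to sides s)
  Glued-noninterval (_ , _ , p , _) (_ , q) with trans (sym p) q
  ... | ()

  partner : ∀ s → IsInterval (Inverse.to sides s) ⊎ (Σ[ t ∈ Triangle × Fin 3 ] Glued s t)
  partner s with Inverse.to sides s in eq
  ... | interval p = inj₁ (p , refl)
  ... | arc e d    = inj₂ (Inverse.from sides (arc e (not d)) , e , d , eq ,
      Inverse.strictlyInverseˡ sides _)

  -- Glued sides run in opposite directions, so one starts where the other ends.
  Glued-corner : ∀ {δ i ε j} → Glued (δ , i) (ε , j) → corner δ i ≡ corner ε (next j)
  Glued-corner {δ} {i} {ε} {j} (e , true , p , q) =
    trans (cong source p) (trans (cong target (sym q)) (sidesMeet ε j))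
  Glued-corner {δ} {i} {ε} {j} (e , false , p , q) =
    trans (cong source p) (trans (cong target (sym q)) (sidesMeet ε j))

  spread : ∀ {P : Triangle → Set} → (∀ {δ ε} → P δ → Adjacent δ ε → P ε) → ∀ {δ} → P δ → ∀ ε → P ε
  spread {P} step {δ} Pδ δ′ = go (connected δ δ′) Pδ
    where
    go : ∀ {δ δ′} → EqClosure Adjacent δ δ′ → P δ → P δ′
    go done Pδ = Pδ
    go (fwd adj ◅ path) Pδ = go path (step Pδ adj)
    go (bwd (i , j , glued) ◅ path) Pδ = go path (step Pδ (j , i , Glued-sym glued))

  module _ (1≤p : 1 ≤ punctures S) (regular : Regular) where

    -- If the third side is an arc, it encloses a single puncture, against regularity. If it is a
    -- boundary interval, the triangle has no neighbour but itself and is the whole surface, with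
    -- the single arc `f`; Euler's formula makes this the once-punctured monogon, which is excluded.
    noFold : ∀ δ i → ¬ Glued (δ , i) (δ , next i)
    noFold δ i glued@(f , d , p , q) with side δ (next (next i)) in third
    ... | arc e c = regular e (δ , next (next i) , c , f , d , not d , third ,
                      trans (cong (side δ) (next³ i)) p ,
                      trans (cong (side δ ∘ next) (next³ i)) q)
    ... | interval b = excluded (fewArcs⇒polygon 1≤p
                         -- All arcs equal `f`, so even a constant map is injective; it shows that
                         -- there are at most as many arcs as triangles.
                         (Fin.injective⇒≤ {f = λ (_ : Arc) → δ} λ {e} {e′} _ →
                             trans (only e) (sym (only e′))))
      where
      alone : ∀ {δ′ ε} → δ ≡ δ′ → Adjacent δ′ ε → δ ≡ ε
      alone refl (j , j′ , glued′) with cover i j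
      ... | inj₁ refl = cong proj₁ (Glued-unique glued glued′)
      ... | inj₂ (inj₁ refl) = cong proj₁ (Glued-unique (Glued-sym glued) glued′)
      ... | inj₂ (inj₂ refl) = contradiction (b , third) (Glued-noninterval glued′)
      all : ∀ ε → δ ≡ ε
      all = spread alone refl
      only : ∀ e → e ≡ f
      only e with Inverse.from sides (arc e true) | Inverse.strictlyInverseˡ sides (arc e true)
      ... | ε , j | eq with all ε
      ...   | refl with cover i j
      ...     | inj₁ refl        = arc-injective (trans (sym eq) p)
      ...     | inj₂ (inj₁ refl) = arc-injective (trans (sym eq) q)
      ...     | inj₂ (inj₂ refl) with trans (sym eq) third
      ...       | ()
      one : #triangles ≡ 1
      one = single (λ δ′ → trans (sym (all δ′)) refl)
        where
        single : ∀ {n} {δ : Fin n} → (∀ δ′ → δ′ ≡ δ) → n ≡ 1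
        single {suc zero} _ = refl
        single {suc (suc n)} same with trans (same 0F) (sym (same 1F))
        ... | ()
      excluded : ¬ IsOncePuncturedPolygon #triangles S
      excluded (g , p , bs) = notExcluded S (subst₃ (sym g) (sym p) (sym (trans bs (cong (_∷ []) one))))
        where
        subst₃ : ∀ {g p bs} → 0 ≡ g → 1 ≡ p → 1 ∷ [] ≡ bs → Excluded g p bs
        subst₃ refl refl refl = puncturedMonogon

    -- Two different sides of a triangle are consecutive in one of the two orders, which is
    -- `noFold`. A side glued to itself would traverse its arc in both directions.
    noSelfGluing : ∀ {δ i j} → ¬ Glued (δ , i) (δ , j)
    noSelfGluing {δ} {i} {j} glued with cover i j
    ... | inj₂ (inj₁ refl) = noFold δ i glued
    ... | inj₂ (inj₂ refl) = noFold δ (next (next i)) (subst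
        (λ k → Glued (δ , next (next i)) (δ , k)) (sym (next³ i)) (Glued-sym glued))
    ... | inj₁ refl with glued
    ...   | e , true  , p , q with trans (sym p) q
    ...     | ()
    noSelfGluing {δ} {i} {j} glued | inj₁ refl | e , false , p , q with trans (sym p) q
    ...     | ()

-- Patches and their exploration

Side : ℕ → Set
Side m = Fin m × Fin 3

_≟ˢ_ : ∀ {m} → DecidableEquality (Side m)
_≟ˢ_ = Product.≡-dec Fin._≟_ Fin._≟_

-- For `𝒜` every triangle carries Q_k, so the kind can stay `unknown` while boundary sides are
-- discovered one by one. For `𝒜′` it selects the quiver: Q_k for `inner`, and Q_k^1 with bottom
-- side i for `based i`.
data Kind : Set where
  unknown inner : Kind
  based         : Fin 3 → Kind

_≟ᵏ_ : DecidableEquality Kind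
unknown  ≟ᵏ unknown  = yes refl
unknown  ≟ᵏ inner    = no λ ()
unknown  ≟ᵏ based _ = no λ ()
inner    ≟ᵏ unknown  = no λ ()
inner    ≟ᵏ inner    = yes refl
inner    ≟ᵏ based _ = no λ ()
based _ ≟ᵏ unknown  = no λ ()
based _ ≟ᵏ inner    = no λ ()
based i ≟ᵏ based j = map′ (cong based) (λ { refl → refl }) (i Fin.≟ j)

-- The information about some triangles of a triangulation that has been
-- collected during an exploration: the pairs of sides known to be glued and
-- the sides known to be boundary intervals.
record Patch : Set where
  constructor patch
  field
    {size}    : ℕ
    kinds     : Vec Kind size
    glue      : List (Side size × Side size)
    intervals : List (Side size)

  kind : Fin size → Kind
  kind = Vec.lookup kinds

open Patch

Apart : ∀ {m} → Side m → Side m × Side m → Set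
Apart s (a , b) = s ≢ a × s ≢ b

Free : (P : Patch) → Side (size P) → Set
Free P s = All (Apart s) (glue P) × All (s ≢_) (intervals P) × kind P (proj₁ s) ≢ based (proj₂ s)

free? : ∀ P s → Dec (Free P s)
free? P s = All.all? (λ (a , b) → ¬? (s ≟ˢ a) ×-dec ¬? (s ≟ˢ b)) (glue P)
  ×-dec All.all? (λ a → ¬? (s ≟ˢ a)) (intervals P)
  ×-dec ¬? (kind P (proj₁ s) ≟ᵏ based (proj₂ s))

allSides : ∀ m → List (Side m)
allSides m = cartesianProduct (allFin m) (allFin 3)

freeSides : ∀ P → List (Side (size P))
freeSides P = filter (free? P) (allSides (size P))

shift : ∀ {m} → Side m → Side (suc m)
shift (t , i) = suc t , i

addInterval : ∀ P → Side (size P) → Patch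
addInterval P s = patch (kinds P) (glue P) (s ∷ intervals P)

addGluing : ∀ P → Side (size P) → Side (size P) → Patch
addGluing P s s′ = patch (kinds P) ((s , s′) ∷ glue P) (intervals P)

-- The new triangle has index 0, and its side 0 is the glued one.
addTriangle : ∀ P → Side (size P) → Kind → Patch
addTriangle P s κ = patch (κ ∷ kinds P)
  ((shift s , (zero , zero)) ∷ map (Product.map shift shift) (glue P))
  (map shift (intervals P))

-- The kinds `inner` and `based` already determine all boundary sides of a triangle, so no further
-- one can be found.
intervalChildren : ∀ P → Side (size P) → List Patch
intervalChildren P s with kind P (proj₁ s)
... | unknown = addInterval P s ∷ []
... | _       = []

otherTriangle? : ∀ {m} (s s′ : Side m) → Dec (proj₁ s′ ≢ proj₁ s)
otherTriangle? s s′ = ¬? (proj₁ s′ Fin.≟ proj₁ s)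

module Exploration (newKinds : List Kind) where

  -- The question is always about the first free side, so its partner in the patch is among the
  -- later ones, and on a different triangle because no triangle is glued to itself.
  childrenAt : ∀ P → List (Side (size P)) → List Patch
  childrenAt P []         = []
  childrenAt P (s ∷ rest) =
    intervalChildren P s
      ++ map (addGluing P s) (filter (otherTriangle? s) rest)
      ++ map (addTriangle P s) newKinds

  children : Patch → List Patch
  children P = childrenAt P (freeSides P)

turn : {X : Set} → (X → X) → Fin 3 → X → X
turn f 0F = id
turn f 1F = f
turn f 2F = f ∘ f

rotate unrotate : Fin 3 → Fin 3 → Fin 3
rotate = turn next
unrotate = turn (next ∘ next)

rotate-unrotate : ∀ r i → rotate r (unrotate r i) ≡ i
rotate-unrotate 0F i  = refl
rotate-unrotate 1F 0F = refl
rotate-unrotate 1F 1F = refl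
rotate-unrotate 1F 2F = refl
rotate-unrotate 2F 0F = refl
rotate-unrotate 2F 1F = refl
rotate-unrotate 2F 2F = refl

unrotate-rotate : ∀ r i → unrotate r (rotate r i) ≡ i
unrotate-rotate 0F i  = refl
unrotate-rotate 1F 0F = refl
unrotate-rotate 1F 1F = refl
unrotate-rotate 1F 2F = refl
unrotate-rotate 2F 0F = refl
unrotate-rotate 2F 1F = refl
unrotate-rotate 2F 2F = refl

rotate-injective : ∀ r {i j} → rotate r i ≡ rotate r j → i ≡ j
rotate-injective r {i} {j} eq =
  trans (sym (unrotate-rotate r i)) (trans (cong (unrotate r) eq) (unrotate-rotate r j))

rotate-0 : ∀ r → rotate r 0F ≡ r
rotate-0 0F = refl
rotate-0 1F = refl
rotate-0 2F = refl

rotate-next : ∀ r i → rotate r (next i) ≡ next (rotate r i)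
rotate-next 0F i = refl
rotate-next 1F i = refl
rotate-next 2F i = refl

-- Realizations of a patch in a triangulation

module Realizations {S : MarkedSurface} (T : Triangulation S) where
  open Triangulation T

  -- The rotation r translates sides of the patch triangle into sides of δ. The uniqueness in the
  -- last clause comes from tautness; it excludes further intervals and identifies the side that
  -- `hasBoundarySide?` returns.
  KindOf : Triangle → Fin 3 → Kind → Set
  KindOf δ r unknown    = ⊤
  KindOf δ r inner      = ¬ HasBoundarySide δ
  KindOf δ r (based i) = IsInterval (side δ (rotate r i)) ×
                          (∀ j → IsInterval (side δ j) → j ≡ rotate r i)

  record Realization (P : Patch) : Set where
    field
      τ : Fin (size P) → Triangle
      ρ : Fin (size P) → Fin 3
      τ-injective : Injective _≡_ _≡_ τ
      kinds-ok    : ∀ t → KindOf (τ t) (ρ t) (kind P t)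

    ⟦_⟧ : Side (size P) → Triangle × Fin 3
    ⟦ t , i ⟧ = τ t , rotate (ρ t) i

    field
      glued     : All (λ (s , s′) → Glued ⟦ s ⟧ ⟦ s′ ⟧) (glue P)
      isolated  : All (λ s → IsInterval (Inverse.to sides ⟦ s ⟧)) (intervals P)
      -- Recorded pairs share no side, so a search through `glue` finds the same pair for a side in
      -- whatever order the pairs are listed.
      separated : AllPairs (λ (a , b) g → Apart a g × Apart b g) (glue P)

    ⟦⟧-injective : ∀ {s t} → ⟦ s ⟧ ≡ ⟦ t ⟧ → s ≡ t
    ⟦⟧-injective {t , i} {t′ , j} eq with refl ← τ-injective (cong proj₁ eq) =
      cong (t ,_) (rotate-injective (ρ t) (cong proj₂ eq))

    preimage : ∀ t j → ⟦ t , unrotate (ρ t) j ⟧ ≡ (τ t , j)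
    preimage t j = cong (τ t ,_) (rotate-unrotate (ρ t) j)

  module _ {P : Patch} (ℛ : Realization P) where
    open Realization ℛ

    bottom-interval : ∀ s → kind P (proj₁ s) ≡ based (proj₂ s) → IsInterval (Inverse.to sides ⟦ s ⟧)
    bottom-interval (t , i) eq = proj₁ (subst (KindOf (τ t) (ρ t)) eq (kinds-ok t))

    -- A side has only one partner: had s′ been recorded as glued, it would have been to s, which is
    -- free. Nor is s′ an interval, since it lies on an arc.
    glued-free : ∀ {s s′} → Glued ⟦ s ⟧ ⟦ s′ ⟧ → Free P s → Free P s′
    glued-free {s} {s′} g (apart , _ , _) =
      All.map notGlued (All.zip (glued , apart)) ,
      All.map (λ where int refl → Glued-noninterval T (Glued-sym T g) int) isolated ,
      (λ eq → Glued-noninterval T (Glued-sym T g) (bottom-interval s′ eq))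
      where
      notGlued : ∀ {h} → Glued ⟦ proj₁ h ⟧ ⟦ proj₂ h ⟧ × Apart s h → Apart s′ h
      notGlued (h , s≢a , s≢b) =
        (λ where refl → s≢b (⟦⟧-injective (Glued-unique T (Glued-sym T g) h))) ,
        (λ where refl → s≢a (⟦⟧-injective (Glued-unique T (Glued-sym T g) (Glued-sym T h))))

    addInterval-realized : ∀ {s} → IsInterval (Inverse.to sides ⟦ s ⟧) → Realization (addInterval P s)
    addInterval-realized int = record
      { τ = τ ; ρ = ρ ; τ-injective = τ-injective ; kinds-ok = kinds-ok
      ; glued = glued ; isolated = int ∷ isolated ; separated = separated }

    addGluing-realized : ∀ {s s′} → Free P s → Free P s′ → Glued ⟦ s ⟧ ⟦ s′ ⟧ →
      Realization (addGluing P s s′)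
    addGluing-realized (s-apart , _) (s′-apart , _) g = record
      { τ = τ ; ρ = ρ ; τ-injective = τ-injective ; kinds-ok = kinds-ok
      ; glued = g ∷ glued ; isolated = isolated
      ; separated = All.zip (s-apart , s′-apart) ∷ separated }

    addTriangle-realized : ∀ {s ε j κ} → Free P s → Glued ⟦ s ⟧ (ε , j) → (∀ t → τ t ≢ ε) →
      KindOf ε j κ → Realization (addTriangle P s κ)
    addTriangle-realized {s} {ε} {j} {κ} (s-apart , _) g new κ-ok = record
      { τ = τ′ ; ρ = ρ′ ; τ-injective = injective
      ; kinds-ok = λ { zero → κ-ok ; (suc t) → kinds-ok t }
      ; glued = subst (λ i → Glued ⟦ s ⟧ (ε , i)) (sym (rotate-0 j)) g ∷ All.map⁺ glued
      ; isolated = All.map⁺ isolated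
      ; separated =
          All.map⁺ (All.map (λ (s≢a , s≢b) →
            ((s≢a ∘ shift-injective) , (s≢b ∘ shift-injective)) , ((λ ()) , (λ ()))) s-apart)
          ∷ AllPairs.map⁺ (AllPairs.map (λ ((p , q) , (p′ , q′)) →
              ((p ∘ shift-injective) , (q ∘ shift-injective)) ,
              ((p′ ∘ shift-injective) , (q′ ∘ shift-injective))) separated)
      }
      where
      τ′ : Fin (suc (size P)) → Triangle
      τ′ zero    = ε
      τ′ (suc t) = τ t
      ρ′ : Fin (suc (size P)) → Fin 3
      ρ′ zero    = j
      ρ′ (suc t) = ρ t
      shift-injective : ∀ {m} {s t : Side m} → shift s ≡ shift t → s ≡ t
      shift-injective refl = refl
      injective : Injective _≡_ _≡_ τ′
      injective {zero}  {zero}  _  = refl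
      injective {zero}  {suc t} eq = contradiction (sym eq) (new t)
      injective {suc t} {zero}  eq = contradiction eq (new t)
      injective {suc t} {suc u} eq = cong suc (τ-injective eq)

  module Step (newKinds : List Kind)
    (classify : ∀ δ r → ¬ IsInterval (side δ r) → Any (KindOf δ r) newKinds)
    (noSelfGlue : ∀ {δ i j} → ¬ Glued (δ , i) (δ , j)) where
    open Exploration newKinds

    -- `partner` tells what lies across s. If it is a known triangle, the partner side is itself
    -- free and on another triangle, hence occurs in `rest`.
    step : ∀ {P s rest} → Realization P → freeSides P ≡ s ∷ rest → Any Realization (children P)
    step {P} {s@(t , i)} {rest} ℛ eq rewrite eq = go (partner T ⟦ s ⟧)
      where
      open Realization ℛ
      s-free : Free P s
      s-free = proj₂ (∈-filter⁻ (free? P) {xs = allSides (size P)} (subst (s ∈_) (sym eq) (here refl)))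

      intervalCase : IsInterval (Inverse.to sides ⟦ s ⟧) → Any Realization (intervalChildren P s)
      intervalCase int with kind P t in κ | kinds-ok t
      ... | unknown  | _            = here (addInterval-realized ℛ int)
      ... | inner    | none         = contradiction (_ , int) none
      ... | based j | _ , only     =
        contradiction (trans κ (cong based (sym (rotate-injective (ρ t) (only _ int)))))
            (proj₂ (proj₂ s-free))

      go : IsInterval (Inverse.to sides ⟦ s ⟧) ⊎ (Σ[ s′ ∈ Triangle × Fin 3 ] Glued ⟦ s ⟧ s′) →
        Any Realization (childrenAt P (s ∷ rest))
      go (inj₁ int) = Any.++⁺ˡ (intervalCase int)
      go (inj₂ ((ε , j) , g)) with Fin.any? (λ t′ → τ t′ Fin.≟ ε)
      ... | no new = Any.++⁺ʳ (intervalChildren P s) (Any.++⁺ʳ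
          (map (addGluing P s) (filter (otherTriangle? s) rest))
              (Any.map⁺ (Any.map (addTriangle-realized ℛ s-free g (λ t eq → new (t , eq)))
                (classify ε j (Glued-noninterval T (Glued-sym T g))))))
      ... | yes (t′ , refl) = Any.++⁺ʳ (intervalChildren P s) (Any.++⁺ˡ
              (Any.map⁺ (lose s′∈ (addGluing-realized ℛ s-free s′-free g′))))
        where
        s′ : Side (size P)
        s′ = t′ , unrotate (ρ t′) j
        g′ : Glued ⟦ s ⟧ ⟦ s′ ⟧
        g′ = subst (Glued ⟦ s ⟧) (sym (preimage t′ j)) g
        s′-free : Free P s′
        s′-free = glued-free ℛ g′ s-free
        other : t′ ≢ t
        other refl = noSelfGlue g
        s′∈rest : s′ ∈ rest
        s′∈rest with subst (s′ ∈_) eq (∈-filter⁺ (free? P) (∈-cartesianProduct⁺ (∈-allFin t′) (∈-allFin _)) s′-free)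
        ... | here refl = contradiction refl other
        ... | there s′∈ = s′∈
        s′∈ : s′ ∈ filter (otherTriangle? s) rest
        s′∈ = ∈-filter⁺ (otherTriangle? s) s′∈rest other

  -- By connectedness, a patch without free sides is the whole triangulation.
  module Closed {P : Patch} (ℛ : Realization P) (closed : freeSides P ≡ []) where
    open Realization ℛ

    glue-or-interval : ∀ s → (Σ[ g ∈ Side (size P) × Side (size P) ] g ∈ glue P ×
        (s ≡ proj₁ g ⊎ s ≡ proj₂ g))
      ⊎ IsInterval (Inverse.to sides ⟦ s ⟧)
    glue-or-interval s@(t , i) with Any.any? (λ g → s ≟ˢ proj₁ g) (glue P) | Any.any? (λ g → s ≟ˢ proj₂ g) (glue P)
    ... | yes p | _     = let g , g∈ , eq = find p in inj₁ (g , g∈ , inj₁ eq)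
    ... | no _  | yes p = let g , g∈ , eq = find p in inj₁ (g , g∈ , inj₂ eq)
    ... | no p  | no q  with Any.any? (λ a → s ≟ˢ a) (intervals P)
    ...   | yes r = inj₂ (All.lookupWith (λ { int refl → int }) isolated r)
    ...   | no r with kind P t ≟ᵏ based i
    ...     | yes κ = inj₂ (bottom-interval ℛ s κ)
    ...     | no κ with subst (s ∈_) closed (∈-filter⁺ (free? P) (∈-cartesianProduct⁺ (∈-allFin t) (∈-allFin i))
                          (All.zip (All.¬Any⇒All¬ _ p , All.¬Any⇒All¬ _ q) , All.¬Any⇒All¬ _ r , κ))
    ...       | ()

    glued-partner : ∀ s {s′} → Glued ⟦ s ⟧ s′ →
      Σ[ g ∈ Side (size P) × Side (size P) ] g ∈ glue P ×
          (s ≡ proj₁ g × s′ ≡ ⟦ proj₂ g ⟧ ⊎ s ≡ proj₂ g × s′ ≡ ⟦ proj₁ g ⟧)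
    glued-partner s h with glue-or-interval s
    ... | inj₂ int = contradiction int (Glued-noninterval T h)
    ... | inj₁ (g , g∈ , inj₁ refl) = g , g∈ , inj₁ (refl , Glued-unique T h (All.lookup glued g∈))
    ... | inj₁ (g , g∈ , inj₂ refl) = g , g∈ , inj₂ (refl , Glued-unique T h
        (Glued-sym T (All.lookup glued g∈)))

    Covered : Triangle → Set
    Covered δ = ∃[ t ] δ ≡ τ t

    covered-side : ∀ {δ} → Covered δ → ∀ i → ∃[ s ] (δ , i) ≡ ⟦ s ⟧
    covered-side (t , refl) i = (t , unrotate (ρ t) i) , sym (preimage t i)

    covered-step : ∀ {δ ε} → Covered δ → Adjacent δ ε → Covered ε
    covered-step {δ} {ε} c (i , j , h) with s , refl ← covered-side c i with glued-partner s h
    ... | (_ , t , _) , _ , inj₁ (_ , eq) = t , cong proj₁ eq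
    ... | ((t , _) , _) , _ , inj₂ (_ , eq) = t , cong proj₁ eq

    module _ (t₀ : Fin (size P)) where

      covered : ∀ δ → Covered δ
      covered = spread T covered-step (t₀ , refl)

      #triangles≡size : #triangles ≡ size P
      #triangles≡size = ℕ.≤-antisym (Fin.injective⇒≤ index-injective) (Fin.injective⇒≤ τ-injective)
        where
        index-injective : Injective _≡_ _≡_ (λ δ → proj₁ (covered δ))
        index-injective {δ} {ε} eq =
          trans (proj₂ (covered δ)) (trans (cong τ eq) (sym (proj₂ (covered ε))))

      -- The two directions of an arc occupy two covered sides that are glued to each other, hence a
      -- recorded pair. The direction is kept because it fixes the positions of the vertices on the
      -- arc.
      arc-in-glue : ∀ e → Σ[ g ∈ Side (size P) × Side (size P) ] g ∈ glue P ×
        (Inverse.to sides ⟦ proj₁ g ⟧ ≡ arc e true × Inverse.to sides ⟦ proj₂ g ⟧ ≡ arc e false ⊎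
         Inverse.to sides ⟦ proj₁ g ⟧ ≡ arc e false × Inverse.to sides ⟦ proj₂ g ⟧ ≡ arc e true)
      arc-in-glue e
        with s , eq ← covered-side (covered (proj₁ (Inverse.from sides (arc e true)))) (proj₂ (Inverse.from sides (arc e true)))
        with g , g∈ , which ← glued-partner s (subst (λ s → Glued s (Inverse.from sides (arc e false))) eq
               (e , true , Inverse.strictlyInverseˡ sides _ , Inverse.strictlyInverseˡ sides _))
        with which
      ... | inj₁ (refl , eq′) = g , g∈ , inj₁
              (trans (cong (Inverse.to sides) (sym eq)) (Inverse.strictlyInverseˡ sides _) ,
               trans (cong (Inverse.to sides) (sym eq′)) (Inverse.strictlyInverseˡ sides _))
      ... | inj₂ (refl , eq′) = g , g∈ , inj₂
              (trans (cong (Inverse.to sides) (sym eq′)) (Inverse.strictlyInverseˡ sides _) ,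
               trans (cong (Inverse.to sides) (sym eq)) (Inverse.strictlyInverseˡ sides _))

      #arcs≤#glue : #arcs ≤ length (glue P)
      #arcs≤#glue = Fin.injective⇒≤ index-injective
        where
        index : Arc → Fin (length (glue P))
        index e = Any.index (proj₁ (proj₂ (arc-in-glue e)))
        index-injective : Injective _≡_ _≡_ index
        index-injective {e} {f} eq
          with g , g∈ , eSide ← arc-in-glue e | h , h∈ , fSide ← arc-in-glue f
          with refl ← trans (Any.lookup-index g∈) (trans (cong (lookup (glue P)) eq) (sym (Any.lookup-index h∈)))
          with eSide | fSide
        ... | inj₁ (p , _) | inj₁ (q , _) = arc-injective T (trans (sym p) q)
        ... | inj₁ (p , _) | inj₂ (q , _) = arc-injective T (trans (sym p) q)
        ... | inj₂ (p , _) | inj₁ (q , _) = arc-injective T (trans (sym p) q)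
        ... | inj₂ (p , _) | inj₂ (q , _) = arc-injective T (trans (sym p) q)

-- Rotation of Q_k

module _ {k : ℕ} where

  rotateNode : Node k → Node k
  rotateNode (node a b c t a<k b<k c<k) = node c a b (trans (total a b c) t) c<k a<k b<k
    where
    total : ∀ a b c → c + a + b ≡ a + b + c
    total = solve-∀

  rotateInner : InnerNode k → InnerNode k
  rotateInner (inner a b c t) = inner c a b (trans (total a b c) t)
    where
    total : ∀ a b c → suc c + suc a + suc b ≡ suc a + suc b + suc c
    total = solve-∀

  rotateLocation : Location k → Location k
  rotateLocation (onSide i s) = onSide (next i) s
  rotateLocation (inside y)   = inside (rotateInner y)

  private
    notCorner : ∀ {n a} → n ≡ a → n ≡ k → a < k → ⊥
    notCorner refl refl = ℕ.<-irrefl refl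

  -- The absurd cases are the three corners, where two sides meet and a node would have two
  -- locations.
  locate-rotate : ∀ u → locate k (rotateNode u) ≡ rotateLocation (locate k u)
  locate-rotate (node zero    b       zero    t a<k b<k c<k) = ⊥-elim-irr
      (notCorner (ℕ.+-identityʳ b) t b<k)
  locate-rotate (node (suc a) zero    zero    t a<k b<k c<k) =
    ⊥-elim-irr (notCorner (trans (ℕ.+-identityʳ _) (ℕ.+-identityʳ (suc a))) t a<k)
  locate-rotate (node (suc a) (suc b) zero    t a<k b<k c<k) = refl
  locate-rotate (node zero    zero    (suc c) t a<k b<k c<k) = ⊥-elim-irr (notCorner {n = suc c} refl t c<k)
  locate-rotate (node zero    (suc b) (suc c) t a<k b<k c<k) = refl
  locate-rotate (node (suc a) zero    (suc c) t a<k b<k c<k) = refl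
  locate-rotate (node (suc a) (suc b) (suc c) t a<k b<k c<k) = refl

  -- A rotation permutes the three arrows of a small triangle cyclically, so the lists of arrows
  -- agree only up to order. Comparing sums of weights takes care of this.
  data Cyclic {A : Set} (f g : A → ℕ) : List A → List A → Set where
    cyclic : ∀ {a b c a′ b′ c′} → f a ≡ g a′ → f b ≡ g b′ → f c ≡ g c′ →
      Cyclic f g (a ∷ b ∷ c ∷ []) (b′ ∷ c′ ∷ a′ ∷ [])

  ∑-cyclic : ∀ {A : Set} {f g : A → ℕ} xs ys → Cyclic f g xs ys → ∑ xs f ≡ ∑ ys g
  ∑-cyclic {f = f} _ _ (cyclic {a} {b} {c} p q r) rewrite sym p | sym q | sym r = cycled (f a) (f b) (f c)
    where
    cycled : ∀ x y z → x + (y + (z + 0)) ≡ y + (z + (x + 0))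
    cycled = solve-∀

  ∑-rotateAt : ∀ (w : Node k × Node k → ℕ) i j l →
    ∑ (arrowsAt? k i j l) (λ (u , v) → w (rotateNode u , rotateNode v)) ≡ ∑ (arrowsAt? k l i j) w
  ∑-rotateAt w i j l with 2 + (i + j + l) ℕ.≟ k | 2 + (l + i + j) ℕ.≟ k
  ... | yes p | yes q = ∑-cyclic {f = λ (u , v) → w (rotateNode u , rotateNode v)} {w}
                          (arrowsAt k i j l p) (arrowsAt k l i j q) (cyclic refl refl refl)
  ... | yes p | no ¬q = contradiction (trans (cong (ℕ._+_ 2) (total i j l)) p) ¬q
    where
    total : ∀ i j l → l + i + j ≡ i + j + l
    total = solve-∀
  ... | no ¬p | yes q = contradiction (trans (cong (ℕ._+_ 2) (total i j l)) q) ¬p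
    where
    total : ∀ i j l → i + j + l ≡ l + i + j
    total = solve-∀
  ... | no _  | no _  = refl

  ∑-arrowsQ : ∀ (w : Node k × Node k → ℕ) →
    ∑ (arrowsQ k) w ≡ ∑ (upTo k) λ i → ∑ (upTo k) λ j → ∑ (upTo k) λ l → ∑ (arrowsAt? k i j l) w
  ∑-arrowsQ w = trans (∑-concatMap _ (upTo k) w) (∑-cong (upTo k) λ i →
    trans (∑-concatMap _ (upTo k) w) (∑-cong (upTo k) λ j → ∑-concatMap _ (upTo k) w))

  -- The small triangle (i , j , l) is carried to (l , i , j), so only the order of the three
  -- summations changes.
  ∑-rotate : ∀ (w : Node k × Node k → ℕ) →
    ∑ (arrowsQ k) (λ (u , v) → w (rotateNode u , rotateNode v)) ≡ ∑ (arrowsQ k) w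
  ∑-rotate w = begin
    ∑ (arrowsQ k) (λ (u , v) → w (rotateNode u , rotateNode v))
      ≡⟨ ∑-arrowsQ (λ (u , v) → w (rotateNode u , rotateNode v)) ⟩
    (∑ (upTo k) λ i → ∑ (upTo k) λ j → ∑ (upTo k) λ l → ∑ (arrowsAt? k i j l)
        (λ (u , v) → w (rotateNode u , rotateNode v)))
      ≡⟨ ∑-cong (upTo k) (λ i → ∑-cong (upTo k) λ j → ∑-cong (upTo k) λ l → ∑-rotateAt w i j l) ⟩
    (∑ (upTo k) λ i → ∑ (upTo k) λ j → ∑ (upTo k) λ l → ∑ (arrowsAt? k l i j) w)
      ≡⟨ ∑-cong (upTo k) (λ i → ∑-swap (upTo k) (upTo k) _) ⟩
    (∑ (upTo k) λ i → ∑ (upTo k) λ l → ∑ (upTo k) λ j → ∑ (arrowsAt? k l i j) w)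
      ≡⟨ ∑-swap (upTo k) (upTo k) _ ⟩
    (∑ (upTo k) λ l → ∑ (upTo k) λ i → ∑ (upTo k) λ j → ∑ (arrowsAt? k l i j) w)
      ≡⟨ ∑-arrowsQ w ⟨
    ∑ (arrowsQ k) w ∎
    where open ≡-Reasoning

  count-rotate : ∀ {A : Set} (_≟_ : DecidableEquality A) {x y} (f : Node k → A) →
    count _≟_ x y (mapArrows (f ∘ rotateNode) (arrowsQ k)) ≡ count _≟_ x y (mapArrows f (arrowsQ k))
  count-rotate _≟_ {x} {y} f =
    trans (count-mapArrows _≟_ x y (f ∘ rotateNode) (arrowsQ k))
      (trans (∑-rotate (λ (u , v) → χ (isArrow? _≟_ x y (f u , f v))))
        (sym (count-mapArrows _≟_ x y f (arrowsQ k))))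

  count-turn : ∀ {A : Set} (_≟_ : DecidableEquality A) {x y} r (f : Node k → A) →
    count _≟_ x y (mapArrows (f ∘ turn rotateNode r) (arrowsQ k)) ≡ count _≟_ x y (mapArrows f (arrowsQ k))
  count-turn _≟_ 0F f = refl
  count-turn _≟_ 1F f = count-rotate _≟_ f
  count-turn _≟_ 2F f = trans (count-rotate _≟_ (f ∘ rotateNode)) (count-rotate _≟_ f)

  locate-turn : ∀ r u → locate k (turn rotateNode r u) ≡ turn rotateLocation r (locate k u)
  locate-turn 0F u = refl
  locate-turn 1F u = locate-rotate u
  locate-turn 2F u = trans (locate-rotate (rotateNode u)) (cong rotateLocation (locate-rotate u))

  turn-onSide : ∀ r i s → turn rotateLocation r (onSide i s) ≡ onSide (rotate r i) s
  turn-onSide 0F i s = refl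
  turn-onSide 1F i s = refl
  turn-onSide 2F i s = refl

  turn-inside : ∀ r y → turn rotateLocation r (inside y) ≡ inside (turn rotateInner r y)
  turn-inside 0F y = refl
  turn-inside 1F y = refl
  turn-inside 2F y = refl

  unturnInner : Fin 3 → InnerNode k → InnerNode k
  unturnInner = turn (rotateInner ∘ rotateInner)

  turn-unturn : ∀ r y → turn rotateInner r (unturnInner r y) ≡ y
  turn-unturn 0F y = refl
  turn-unturn 1F y = refl
  turn-unturn 2F y = refl

  turnInner-injective : ∀ r {y y′} → turn rotateInner r y ≡ turn rotateInner r y′ → y ≡ y′
  turnInner-injective 0F eq = eq
  turnInner-injective 1F eq = cong (rotateInner ∘ rotateInner) eq
  turnInner-injective 2F eq = cong rotateInner eq

-- The quiver of a patch

module Local (k : ℕ) (P : Patch) where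

  LocalVertex : Set
  LocalVertex = (Side (size P) × SidePosition k) ⊎ (Fin (size P) × InnerNode k)

  _≟ˡ_ : DecidableEquality LocalVertex
  _≟ˡ_ = Sum.≡-dec (Product.≡-dec _≟ˢ_ Fin._≟_) (Product.≡-dec Fin._≟_ (_≟ⁱ_ k))

  -- The vertices on a glued pair of sides are named after its first side.
  sideVertexIn : List (Side (size P) × Side (size P)) → Side (size P) → SidePosition k → Maybe LocalVertex
  sideVertexIn []             s p = nothing
  sideVertexIn ((a , b) ∷ gs) s p with s ≟ˢ a | s ≟ˢ b
  ... | yes _ | _     = just (inj₁ (a , p))
  ... | no _  | yes _ = just (inj₁ (a , opposite p))
  ... | no _  | no _  = sideVertexIn gs s p

  sideVertex : Side (size P) → SidePosition k → Maybe LocalVertex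
  sideVertex = sideVertexIn (glue P)

  placeLocallyAt : Fin (size P) → Location k → Maybe LocalVertex
  placeLocallyAt t (onSide i s) = sideVertex (t , i) s
  placeLocallyAt t (inside y)   = just (inj₂ (t , y))

  placeLocally : Fin (size P) → Node k → Maybe LocalVertex
  placeLocally t u = placeLocallyAt t (locate k u)

  placeLocally¹ : Fin (size P) → Fin 3 → Node¹ k → Maybe LocalVertex
  placeLocally¹ t i (L s) = sideVertex (t , next i) s
  placeLocally¹ t i (R s) = sideVertex (t , next (next i)) (opposite s)
  -- M is frozen and therefore belongs to no local matrix.
  placeLocally¹ t i M     = nothing

  -- Selects the names that denote actual mutable vertices: those on the first side of a glued pair,
  -- and inner nodes of triangles that carry Q_k.
  Usable : (Fin (size P) → Set) → LocalVertex → Set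
  Usable IsInner (inj₁ (a , _)) = Any (λ g → a ≡ proj₁ g) (glue P)
  Usable IsInner (inj₂ (t , _)) = IsInner t

  usable? : ∀ {IsInner} → (∀ t → Dec (IsInner t)) → ∀ x → Dec (Usable IsInner x)
  usable? inner? (inj₁ (a , _)) = Any.any? (λ g → a ≟ˢ proj₁ g) (glue P)
  usable? inner? (inj₂ (t , _)) = inner? t

  Arrows : Set
  Arrows = List (Maybe LocalVertex × Maybe LocalVertex)

  patchMatrix : (Fin (size P) → Arrows) → (us : List LocalVertex) → Matrix (length us)
  patchMatrix arrows us = localMatrix _≟ˡ_ us (concatMap arrows (allFin (size P)))

  Separated : List (Side (size P) × Side (size P)) → Set
  Separated = AllPairs (λ (a , b) g → Apart a g × Apart b g)

  sideVertex-first : ∀ {gs a b} → Separated gs → (a , b) ∈ gs → ∀ p → sideVertexIn gs a p ≡ just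
      (inj₁ (a , p))
  sideVertex-first {(a , b) ∷ gs} sep (here refl) p with a ≟ˢ a | a ≟ˢ b
  ... | yes _ | _ = refl
  ... | no ¬p | _ = contradiction refl ¬p
  sideVertex-first {(c , d) ∷ gs} {a} (apart ∷ sep) (there g∈) p with a ≟ˢ c | a ≟ˢ d
  ... | yes refl | _        = contradiction refl (proj₁ (proj₁ (All.lookup apart g∈)))
  ... | no _     | yes refl = contradiction refl (proj₁ (proj₂ (All.lookup apart g∈)))
  ... | no _     | no _     = sideVertex-first sep g∈ p

  sideVertex-second : ∀ {gs a b} → Separated gs → (a , b) ∈ gs → a ≢ b → ∀ p →
    sideVertexIn gs b p ≡ just (inj₁ (a , opposite p))
  sideVertex-second {(a , b) ∷ gs} sep (here refl) a≢b p with b ≟ˢ a | b ≟ˢ b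
  ... | yes q | _     = contradiction (sym q) a≢b
  ... | no _  | yes _ = refl
  ... | no _  | no ¬p = contradiction refl ¬p
  sideVertex-second {(c , d) ∷ gs} {a} {b} (apart ∷ sep) (there g∈) a≢b p with b ≟ˢ c | b ≟ˢ d
  ... | yes refl | _        = contradiction refl (proj₂ (proj₁ (All.lookup apart g∈)))
  ... | no _     | yes refl = contradiction refl (proj₂ (proj₂ (All.lookup apart g∈)))
  ... | no _     | no _     = sideVertex-second sep g∈ a≢b p

  sideVertex-inverse : ∀ gs s p {x} → sideVertexIn gs s p ≡ just x → Σ[ g ∈ Side (size P) × Side
      (size P) ] g ∈ gs ×
    (s ≡ proj₁ g × x ≡ inj₁ (proj₁ g , p) ⊎ s ≡ proj₂ g × x ≡ inj₁ (proj₁ g , opposite p))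
  sideVertex-inverse ((a , b) ∷ gs) s p eq with s ≟ˢ a | s ≟ˢ b
  ... | yes q | _     = (a , b) , here refl , inj₁ (q , sym (Maybe.just-injective eq))
  ... | no _  | yes q = (a , b) , here refl , inj₂ (q , sym (Maybe.just-injective eq))
  ... | no _  | no _  = let g , g∈ , r = sideVertex-inverse gs s p eq in g , there g∈ , r

-- Comparison of local and global vertices, for both cluster algebras

module LocalRealization (k : ℕ) {S : MarkedSurface} {T : Triangulation S} {P : Patch}
  (ℛ : Realizations.Realization T P)
  (noSelfGlue : ∀ {δ i j} → ¬ Triangulation.Glued T (δ , i) (δ , j))
  {Inner Frozen : Set}
  (edgeVertex : Triangulation.Edge T → SidePosition k → (Triangulation.Arc T × SidePosition k ⊎
      Inner) ⊎ Frozen)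
  (edgeVertex-arc : ∀ e d p → edgeVertex (arc e d) p ≡ inj₁ (inj₁ (arcVertex k e d p)))
  (edgeVertex-interval : ∀ b p v → edgeVertex (interval b) p ≢ inj₁ v)
  (IsInner : Fin (size P) → Set)
  (innerAt : ∀ t → IsInner t → InnerNode k → Inner)
  (innerAt-irrelevant : ∀ t p p′ y → innerAt t p y ≡ innerAt t p′ y)
  (innerAt-injective : ∀ {t t′ p p′ y y′} → innerAt t p y ≡ innerAt t′ p′ y′ → (t , y) ≡ (t′ , y′))
  where
  open Triangulation T
  open Realizations.Realization ℛ
  open Local k P

  Valid : LocalVertex → Set
  Valid = Usable IsInner

  vertexOf : ∀ x → Valid x → Arc × SidePosition k ⊎ Inner
  vertexOf (inj₁ (a , q)) v =
    let _ , g∈ , _ = find v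
        e , d , _ = All.lookup glued g∈
    in inj₁ (arcVertex k e d q)
  vertexOf (inj₂ (t , y)) v = inj₂ (innerAt t v y)

  vertexOf-edge : ∀ a q v → inj₁ (vertexOf (inj₁ (a , q)) v) ≡ edgeVertex (Inverse.to sides ⟦ a ⟧) q
  vertexOf-edge a q v with _ , g∈ , refl ← find v =
    let e , d , p , _ = All.lookup glued g∈
    in sym (trans (cong (λ E → edgeVertex E q) p) (edgeVertex-arc e d q))

  glued-vertices : ∀ {s t} → Glued s t → ∀ p →
    edgeVertex (Inverse.to sides t) p ≡ edgeVertex (Inverse.to sides s) (opposite p)
  glued-vertices {s} {t} (e , d , p≡ , q≡) p =
    trans (cong (λ E → edgeVertex E p) q≡) (trans (edgeVertex-arc e (not d) p)
      (trans (cong (inj₁ ∘ inj₁) (flip d))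
        (sym (trans (cong (λ E → edgeVertex E (opposite p)) p≡) (edgeVertex-arc e d (opposite p))))))
    where
    flip : ∀ d → arcVertex k e (not d) p ≡ arcVertex k e d (opposite p)
    flip true  = refl
    flip false = cong (e ,_) (sym (Fin.opposite-involutive p))

  arcVertex-match : ∀ {e e′ : Arc} {d p d′ q} → arcVertex k e d p ≡ arcVertex k e′ d′ q →
    (arc {S} e d ≡ arc e′ d′ × p ≡ q) ⊎ (arc {S} e d ≡ arc e′ (not d′) × opposite p ≡ q)
  arcVertex-match {d = true}  {d′ = true}  refl = inj₁ (refl , refl)
  arcVertex-match {d = true}  {p} {d′ = false} {q} eq with refl ← cong proj₁ eq =
    inj₂ (refl , trans (cong opposite (cong proj₂ eq)) (Fin.opposite-involutive q))
  arcVertex-match {d = false} {d′ = true}  refl = inj₂ (refl , refl)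
  arcVertex-match {d = false} {p} {d′ = false} {q} eq with refl ← cong proj₁ eq =
    inj₁ (refl , trans (sym (Fin.opposite-involutive p))
        (trans (cong opposite (cong proj₂ eq)) (Fin.opposite-involutive q)))

  edge-match : ∀ E p {e d q} → edgeVertex E p ≡ inj₁ (inj₁ (arcVertex k e d q)) →
    (E ≡ arc e d × p ≡ q) ⊎ (E ≡ arc e (not d) × opposite p ≡ q)
  edge-match (interval b) p eq = contradiction eq (edgeVertex-interval b p _)
  edge-match (arc e d)    p eq =
    arcVertex-match (Sum.inj₁-injective (Sum.inj₁-injective (trans (sym (edgeVertex-arc e d p)) eq)))

  edge-inner : ∀ E p {y} → edgeVertex E p ≢ inj₁ (inj₂ y)
  edge-inner (interval b) p eq = edgeVertex-interval b p _ eq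
  edge-inner (arc e d)    p eq with trans (sym (edgeVertex-arc e d p)) eq
  ... | ()

  locateEdge : ∀ s p {a q} (v : Valid (inj₁ (a , q))) →
    edgeVertex (Inverse.to sides s) p ≡ inj₁ (vertexOf (inj₁ (a , q)) v) →
    Σ[ g ∈ Side (size P) × Side (size P) ] g ∈ glue P × a ≡ proj₁ g ×
      (s ≡ ⟦ proj₁ g ⟧ × p ≡ q ⊎ s ≡ ⟦ proj₂ g ⟧ × opposite p ≡ q)
  locateEdge s p v eq with g , g∈ , refl ← find v with e , d , p≡ , q≡ ← All.lookup glued g∈
    with edge-match (Inverse.to sides s) p eq
  ... | inj₁ (E , p≡q) = g , g∈ , refl , inj₁ (side-injective T (trans E (sym p≡)) , p≡q)
  ... | inj₂ (E , p≡q) = g , g∈ , refl , inj₂ (side-injective T (trans E (sym q≡)) , p≡q)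

  -- An arc lies on exactly two sides, so a side containing a vertex of a glued pair is one of that
  -- pair. The two are distinct by `noSelfGlue`, hence the second is correctly read with `opposite`.
  side-complete : ∀ s p x v → edgeVertex (Inverse.to sides ⟦ s ⟧) p ≡ inj₁ (vertexOf x v) →
    sideVertex s p ≡ just x
  side-complete s p (inj₂ _)       v eq = contradiction eq (edge-inner (Inverse.to sides ⟦ s ⟧) p)
  side-complete s p (inj₁ (a , q)) v eq with locateEdge ⟦ s ⟧ p v eq
  ... | (a , b) , g∈ , refl , inj₁ (s≡ , refl) with refl ← ⟦⟧-injective s≡ =
    sideVertex-first separated g∈ p
  ... | (a , b) , g∈ , refl , inj₂ (s≡ , refl) with refl ← ⟦⟧-injective s≡ =
    sideVertex-second separated g∈ (λ { refl → noSelfGlue (All.lookup glued g∈) }) p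

  side-sound : ∀ s p x v → sideVertex s p ≡ just x →
    edgeVertex (Inverse.to sides ⟦ s ⟧) p ≡ inj₁ (vertexOf x v)
  side-sound s p x v eq with sideVertex-inverse (glue P) s p eq
  ... | (a , b) , g∈ , inj₁ (refl , refl) = sym (vertexOf-edge a p v)
  ... | (a , b) , g∈ , inj₂ (refl , refl) =
    trans (glued-vertices (All.lookup glued g∈) p) (sym (vertexOf-edge a (opposite p) v))

  placeGloballyAt : ∀ t → IsInner t → Location k → (Arc × SidePosition k ⊎ Inner) ⊎ Frozen
  placeGloballyAt t v (onSide i s) = edgeVertex (Inverse.to sides ⟦ t , i ⟧) s
  placeGloballyAt t v (inside y)   = inj₁ (inj₂ (innerAt t v y))

  -- The correspondence of fibres over a usable vertex that `count-cong` asks for.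
  place-match : ∀ t i x v ℓ →
    (placeGloballyAt t i ℓ ≡ inj₁ (vertexOf x v) → placeLocallyAt t ℓ ≡ just x) ×
    (placeLocallyAt t ℓ ≡ just x → placeGloballyAt t i ℓ ≡ inj₁ (vertexOf x v))
  place-match t i x v (onSide j p) = side-complete (t , j) p x v , side-sound (t , j) p x v
  place-match t i (inj₁ _) v (inside y) = (λ ()) , (λ ())
  place-match t i (inj₂ (t′ , y′)) v (inside y) =
    (λ eq → cong (just ∘ inj₂) (innerAt-injective (Sum.inj₂-injective (Sum.inj₁-injective eq)))) ,
    (λ eq → inner-cong (Sum.inj₂-injective (Maybe.just-injective eq)))
    where
    inner-cong : (t , y) ≡ (t′ , y′) → inj₁ (inj₂ (innerAt t i y)) ≡ inj₁ (inj₂ (innerAt t′ v y′))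
    inner-cong refl = cong (inj₁ ∘ inj₂) (innerAt-irrelevant t i v y)

  side-valid : ∀ a q → Valid (inj₁ (a , q)) → sideVertex a q ≡ just (inj₁ (a , q))
  side-valid a q v with _ , g∈ , refl ← find v = sideVertex-first separated g∈ q

  vertexOf-injective : ∀ x y v w → vertexOf x v ≡ vertexOf y w → x ≡ y
  vertexOf-injective (inj₁ (a , q)) y v w eq = Maybe.just-injective (trans (sym (side-valid a q v))
    (side-complete a q y w (trans (sym (vertexOf-edge a q v)) (cong inj₁ eq))))
  vertexOf-injective (inj₂ (t , y)) (inj₂ (t′ , y′)) v w eq = cong inj₂
      (innerAt-injective (Sum.inj₂-injective eq))

  -- Both sides of an arc with a usable vertex lie in the patch, so no other triangle reaches it.
  edge-outside : ∀ {δ} → (∀ t → δ ≢ τ t) → ∀ i p x v → edgeVertex (side δ i) p ≢ inj₁ (vertexOf x v)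
  edge-outside {δ} out i p (inj₂ _) v eq = edge-inner (side δ i) p eq
  edge-outside {δ} out i p (inj₁ (a , q)) v eq with locateEdge (δ , i) p v eq
  ... | ((t , _) , _) , _ , _ , inj₁ (s≡ , _) = out t (cong proj₁ s≡)
  ... | (_ , (t , _)) , _ , _ , inj₂ (s≡ , _) = out t (cong proj₁ s≡)

  vertexOf-cong : ∀ {x y} v w → x ≡ y → vertexOf x v ≡ vertexOf y w
  vertexOf-cong {inj₁ (a , q)} v w refl =
    Sum.inj₁-injective (trans (vertexOf-edge a q v) (sym (vertexOf-edge a q w)))
  vertexOf-cong {inj₂ (t , y)} v w refl = cong inj₂ (innerAt-irrelevant t v w y)

  -- For surjectivity in the finite cases: the first side of a glued pair sees all positions of its
  -- arc, in reverse if it runs against the arc.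
  edge-onto : ∀ {g e d} → g ∈ glue P → Inverse.to sides ⟦ proj₁ g ⟧ ≡ arc e d → ∀ p →
    Σ[ q ∈ SidePosition k ] Σ[ v ∈ Valid (inj₁ (proj₁ g , q)) ] vertexOf (inj₁ (proj₁ g , q)) v
        ≡ inj₁ (e , p)
  edge-onto {g} {e} {d} g∈ eq p = q d , lose g∈ refl , Sum.inj₁-injective
    (trans (vertexOf-edge (proj₁ g) (q d) (lose g∈ refl))
      (trans (cong (λ E → edgeVertex E (q d)) eq)
        (trans (edgeVertex-arc e d (q d)) (cong (inj₁ ∘ inj₁) (at d)))))
    where
    q : Bool → SidePosition k
    q true  = p
    q false = opposite p
    at : ∀ d → arcVertex k e d (q d) ≡ (e , p)
    at true  = refl
    at false = cong (e ,_) (Fin.opposite-involutive p)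

  module Embedding
    (_≟_ : DecidableEquality ((Arc × SidePosition k ⊎ Inner) ⊎ Frozen))
    (arrowsOf : Triangle → List (((Arc × SidePosition k ⊎ Inner) ⊎ Frozen) ×
        ((Arc × SidePosition k ⊎ Inner) ⊎ Frozen)))
    (localArrows : ∀ k → Fin (size P) → Local.Arrows k P)
    (inside : ∀ x v y w t → count _≟_ (inj₁ (vertexOf x v)) (inj₁ (vertexOf y w)) (arrowsOf (τ t)) ≡
      localCount _≟ˡ_ x y (localArrows k t))
    (outside : ∀ x v y w δ → (∀ t → δ ≢ τ t) →
      count _≟_ (inj₁ (vertexOf x v)) (inj₁ (vertexOf y w)) (arrowsOf δ) ≡ 0) where

    Q : IceQuiver
    Q = iceQuiver _≟_ (concatMap arrowsOf (allFin #triangles))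

    patchMatrixOf : ∀ k → (us : List (Local.LocalVertex k P)) → Matrix (length us)
    patchMatrixOf k us = Local.patchMatrix k P (localArrows k) us

    module _ {k₀ : ℕ} (widen : Local.LocalVertex k₀ P → LocalVertex)
      (widen-injective : Injective _≡_ _≡_ widen)
      (widen-usable : ∀ x → Local.Usable k₀ P IsInner x → Valid (widen x))
      (widen-count : ∀ x y → Local.Usable k₀ P IsInner x → Local.Usable k₀ P IsInner y → ∀ t →
        localCount _≟ˡ_ (widen x) (widen y) (localArrows k t) ≡
        localCount (Local._≟ˡ_ k₀ P) x y (localArrows k₀ t)) where

      -- The matrix is computed for k₀ but embedded in the quiver for k; in this way one fixed
      -- certificate serves infinitely many k.
      embedsVia : ∀ us → All (Local.Usable k₀ P IsInner) us → Unique us → patchMatrixOf k₀ us EmbedsIn Q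
      embedsVia us usable unique =
        localMatrix-embeds _≟_ (Local._≟ˡ_ k₀ P) arrowsOf (localArrows k₀) τ τ-injective us unique
            vertex vertex-injective
          (λ i j t → trans (inside (widen (lookup us i)) _ (widen (lookup us j)) _ t)
            (widen-count (lookup us i) (lookup us j) (usableAt i) (usableAt j) t))
          (λ i j → outside (widen (lookup us i)) _ (widen (lookup us j)) _)
        where
        usableAt : ∀ i → Local.Usable k₀ P IsInner (lookup us i)
        usableAt i = All.lookup usable (∈-lookup i)
        vertex : Fin (length us) → Arc × SidePosition k ⊎ Inner
        vertex i = vertexOf (widen (lookup us i)) (widen-usable _ (usableAt i))
        vertex-injective : Injective _≡_ _≡_ vertex
        vertex-injective {i} {j} eq = lookup-unique unique (widen-injective
          (vertexOf-injective (widen (lookup us i)) (widen (lookup us j)) _ _ eq))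

    embeds : ∀ us → All Valid us → Unique us → patchMatrixOf k us EmbedsIn Q
    embeds = embedsVia id id (λ _ → id) (λ _ _ _ _ _ → refl)

module _ (k : ℕ) (P : Patch) where
  open Local k P

  arrows𝒜 : Fin (size P) → Arrows
  arrows𝒜 t = mapArrows (placeLocally t) (arrowsQ k)

  -- The value at `unknown` is a placeholder: `classified` rejects such patches before the matrix is
  -- used.
  arrowsOfKind : Fin (size P) → Kind → Arrows
  arrowsOfKind t unknown   = []
  arrowsOfKind t inner     = mapArrows (placeLocally t) (arrowsQ k)
  arrowsOfKind t (based i) = mapArrows (placeLocally¹ t i) (arrowsQ¹ k)

  arrows𝒜′ : Fin (size P) → Arrows
  arrows𝒜′ t = arrowsOfKind t (kind P t)

module _ (k : ℕ) {S : MarkedSurface} (T : Triangulation S)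
  (noSelfGlue : ∀ {δ i j} → ¬ Triangulation.Glued T (δ , i) (δ , j))
  {P : Patch} (ℛ : Realizations.Realization T P) where
  open Triangulation T
  open Realizations T
  open Realization ℛ

  inner-injective : ∀ t t′ {y y′ : InnerNode k} → τ t ≡ τ t′ →
    turn rotateInner (ρ t) y ≡ turn rotateInner (ρ t′) y′ → (t , y) ≡ (t′ , y′)
  inner-injective t t′ τ≡ y≡ with refl ← τ-injective {t} {t′} τ≡ = cong (t ,_) (turnInner-injective (ρ t) y≡)

  module Model𝒜 where
    open 𝒜 k T
    open LocalRealization k ℛ noSelfGlue edgeVertex (λ _ _ _ → refl) (λ _ _ _ ())
      (λ _ → ⊤) (λ t _ y → τ t , turn rotateInner (ρ t) y) (λ _ _ _ _ → refl)
      (λ {t} {t′} eq → inner-injective t t′ (cong proj₁ eq) (cong proj₂ eq)) public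
    open Local k P

    placeAt-turn : ∀ t ℓ → placeAt (τ t) (turn rotateLocation (ρ t) ℓ) ≡ placeGloballyAt t tt ℓ
    placeAt-turn t (onSide i s) = cong (placeAt (τ t)) (turn-onSide (ρ t) i s)
    placeAt-turn t (inside y)   = cong (placeAt (τ t)) (turn-inside (ρ t) y)

    place-turn : ∀ t u → place (τ t) (turn rotateNode (ρ t) u) ≡ placeGloballyAt t tt (locate k u)
    place-turn t u = trans (cong (placeAt (τ t)) (locate-turn (ρ t) u)) (placeAt-turn t (locate k u))

    match : ∀ t x v u →
      (place (τ t) (turn rotateNode (ρ t) u) ≡ inj₁ (vertexOf x v) → placeLocally t u ≡ just x) ×
      (placeLocally t u ≡ just x → place (τ t) (turn rotateNode (ρ t) u) ≡ inj₁ (vertexOf x v))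
    match t x v u =
      let to , from = place-match t tt x v (locate k u)
      in (λ eq → to (trans (sym (place-turn t u)) eq)) , (λ eq → trans (place-turn t u) (from eq))

    inside𝒜 : ∀ x v y w t → count _≟_ (inj₁ (vertexOf x v)) (inj₁ (vertexOf y w))
        (mapArrows (place (τ t)) (arrowsQ k))
      ≡ localCount _≟ˡ_ x y (arrows𝒜 k P t)
    -- Turning by `ρ t` brings the global triangle into the position of the patch triangle and only
    -- permutes the arrows of Q_k.
    inside𝒜 x v y w t = trans (sym (count-turn _≟_ (ρ t) (place (τ t))))
      (count-cong _≟_ (Maybe.≡-dec _≟ˡ_) (match t x v) (match t y w) (arrowsQ k))

    placeAt-outside : ∀ {δ} → (∀ t → δ ≢ τ t) → ∀ x v ℓ → placeAt δ ℓ ≢ inj₁ (vertexOf x v)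
    placeAt-outside out x v (onSide i s) eq = edge-outside out i s x v eq
    placeAt-outside out (inj₂ (t , _)) v (inside y) eq = out t
        (cong proj₁ (Sum.inj₂-injective (Sum.inj₁-injective eq)))

    open Embedding _≟_ (λ δ → mapArrows (place δ) (arrowsQ k)) (λ k → arrows𝒜 k P) inside𝒜
      (λ x v y w δ out → count-absent _≟_ (placeAt-outside out x v ∘ locate k) (arrowsQ k)) public
      using (embedsVia; embeds)

  module Model𝒜′ (classified : ∀ t → kind P t ≢ unknown) where
    open 𝒜′ k T

    notBoundary : ∀ {t} → kind P t ≡ inner → ¬ HasBoundarySide (τ t)
    notBoundary {t} eq = subst (KindOf (τ t) (ρ t)) eq (kinds-ok t)

    open LocalRealization k ℛ noSelfGlue edgeVertex (λ _ _ _ → refl) (λ _ _ _ ())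
      (λ t → kind P t ≡ inner) (λ t eq y → innerTriangle (τ t) (notBoundary eq) , turn rotateInner
          (ρ t) y) (λ _ _ _ _ → refl)
      (λ {t} {t′} eq → inner-injective t t′ (cong (InnerTriangle.triangle ∘ proj₁) eq)
          (cong proj₂ eq)) public
    open Local k P

    module _ (t : Fin (size P)) (κ : kind P t ≡ inner) where

      δ : InnerTriangle
      δ = innerTriangle (τ t) (notBoundary κ)

      placeAt-turn : ∀ ℓ → placeAt δ (turn rotateLocation (ρ t) ℓ) ≡ placeGloballyAt t κ ℓ
      placeAt-turn (onSide i s) = cong (placeAt δ) (turn-onSide (ρ t) i s)
      placeAt-turn (inside y)   = cong (placeAt δ) (turn-inside (ρ t) y)

      place-turn : ∀ u → place δ (turn rotateNode (ρ t) u) ≡ placeGloballyAt t κ (locate k u)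
      place-turn u = trans (cong (placeAt δ) (locate-turn (ρ t) u)) (placeAt-turn (locate k u))

      match : ∀ x v u →
        (place δ (turn rotateNode (ρ t) u) ≡ inj₁ (vertexOf x v) → placeLocally t u ≡ just x) ×
        (placeLocally t u ≡ just x → place δ (turn rotateNode (ρ t) u) ≡ inj₁ (vertexOf x v))
      match x v u =
        let to , from = place-match t κ x v (locate k u)
        in (λ eq → to (trans (sym (place-turn u)) eq)) , (λ eq → trans (place-turn u) (from eq))

    module _ (t : Fin (size P)) (i : Fin 3) (p : MarkedSurface.BoundaryPoint S) where

      match¹ : ∀ x v u →
        (place¹ (τ t) (rotate (ρ t) i) p u ≡ inj₁ (vertexOf x v) → placeLocally¹ t i u ≡ just x) ×
        (placeLocally¹ t i u ≡ just x → place¹ (τ t) (rotate (ρ t) i) p u ≡ inj₁ (vertexOf x v))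
      match¹ x v (L s) rewrite sym (rotate-next (ρ t) i) =
        side-complete (t , next i) s x v , side-sound (t , next i) s x v
      match¹ x v (R s) rewrite sym (rotate-next (ρ t) i) | sym (rotate-next (ρ t) (next i)) =
        side-complete (t , next (next i)) (opposite s) x v , side-sound (t , next (next i)) (opposite s) x v
      match¹ x v M     = (λ ()) , (λ ())

    inside𝒜′ : ∀ x v y w t → count _≟_ (inj₁ (vertexOf x v)) (inj₁ (vertexOf y w))
        (arrowsIn (τ t) (hasBoundarySide? (τ t)))
      ≡ localCount _≟ˡ_ x y (arrows𝒜′ k P t)
    inside𝒜′ x v y w t with kind P t in κ | kinds-ok t
    ... | unknown | _    = contradiction κ (classified t)
    ... | inner   | none with hasBoundarySide? (τ t)
    ...   | yes some = contradiction some none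
    ...   | no _     = trans (sym (count-turn _≟_ (ρ t) (place (δ t κ))))
      (count-cong _≟_ (Maybe.≡-dec _≟ˡ_) (match t κ x v) (match t κ y w) (arrowsQ k))
    inside𝒜′ x v y w t | based i | int , only with hasBoundarySide? (τ t)
    ...   | no none = contradiction (_ , int) none
    -- The boundary side returned by the search must be the bottom side of the patch triangle, being
    -- the only one.
    ...   | yes (j , p , eq) with refl ← only j (p , eq) =
      count-cong _≟_ (Maybe.≡-dec _≟ˡ_) (match¹ t i p x v) (match¹ t i p y w) (arrowsQ¹ k)

    placeAt-outside : ∀ {ε} → (∀ t → InnerTriangle.triangle ε ≢ τ t) → ∀ x v ℓ → placeAt ε ℓ ≢ inj₁
        (vertexOf x v)
    placeAt-outside out x v (onSide i s) eq = edge-outside out i s x v eq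
    placeAt-outside out (inj₂ (t , _)) v (inside y) eq =
      out t (cong (InnerTriangle.triangle ∘ proj₁) (Sum.inj₂-injective (Sum.inj₁-injective eq)))

    place¹-outside : ∀ {ε} → (∀ t → ε ≢ τ t) → ∀ x v i p u → place¹ ε i p u ≢ inj₁ (vertexOf x v)
    place¹-outside out x v i p (L s) eq = edge-outside out _ _ x v eq
    place¹-outside out x v i p (R s) eq = edge-outside out _ _ x v eq
    place¹-outside out x v i p M     ()

    outside𝒜′ : ∀ x v y w ε → (∀ t → ε ≢ τ t) →
      count _≟_ (inj₁ (vertexOf x v)) (inj₁ (vertexOf y w)) (arrowsIn ε (hasBoundarySide? ε)) ≡ 0
    outside𝒜′ x v y w ε out with hasBoundarySide? ε
    ... | yes (i , p , _) = count-absent _≟_ (place¹-outside out x v i p) (arrowsQ¹ k)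
    ... | no none         = count-absent _≟_ (placeAt-outside out x v ∘ locate k) (arrowsQ k)

    open Embedding _≟_ (λ δ → arrowsIn δ (hasBoundarySide? δ)) (λ k → arrows𝒜′ k P) inside𝒜′
        outside𝒜′ public
      using (embedsVia; embeds)

-- Certificates of infinite type

T-∧⁻ : ∀ x {y} → T (x ∧ y) → T x × T y
T-∧⁻ true ok = tt , ok

-- A certificate is a list of positions in a list of vertices, counted from 1
-- and stored in base 100 with the least significant digit first.  The first
-- three are the vertices of the growing triple, the others the vertices of
-- the mutations.
digits : ℕ → ℕ → List ℕ
digits zero       c = []
digits (suc fuel) 0 = []
digits (suc fuel) c@(suc _) = c % 100 ∷ digits fuel (c / 100)

module _ (k : ℕ) where

  innerNodeAt : ∀ a b c → List (InnerNode k)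
  innerNodeAt a b c with suc a + suc b + suc c ℕ.≟ k
  ... | yes total = inner a b c total ∷ []
  ... | no _      = []

  innerNodes : List (InnerNode k)
  innerNodes = concatMap (λ a → concatMap (λ b → concatMap (λ c → innerNodeAt a b c)
    (upTo k)) (upTo k)) (upTo k)

module Certificate (k : ℕ)
  (arrows : ∀ P → Fin (size P) → Local.Arrows k P)
  (IsInner : ∀ P → Fin (size P) → Set) (inner? : ∀ P t → Dec (IsInner P t)) where

  module _ (P : Patch) where
    open Local k P

    vertices : List LocalVertex
    vertices =
      concatMap (λ (a , _) → map (λ s → inj₁ (a , s)) (allFin (k ∸ 1))) (glue P) ++
      concatMap (λ t → map (λ y → inj₂ (t , y)) (innerNodes k)) (filter (inner? P) (allFin (size P)))

    grows : ∀ {n} → Matrix n → List (Fin n) → Bool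
    grows A (x ∷ y ∷ z ∷ vs) = isYes (growing? (mutateAllAt A vs) x y z)
    grows A _                = false

    allUsable : List LocalVertex → Bool
    allUsable us = isYes (All.all? (usable? (inner? P)) us)

    growsOn : List LocalVertex → List LocalVertex → Bool
    growsOn us vs = allUsable us ∧
      grows (patchMatrix (arrows P) us) (mapMaybe (indexOf _≟ˡ_ us) vs)

    -- The matrix is spanned by the vertices named in the certificate alone. This induced subquiver
    -- already shows the growth, and its small size keeps the evaluation short.
    certifiedBy : List LocalVertex → Bool
    certifiedBy vs = growsOn (deduplicate _≟ˡ_ vs) vs

    select : List LocalVertex → List ℕ → List LocalVertex
    select vs = mapMaybe λ i → head (drop (i ∸ 1) vs)

    certified : ℕ → Bool
    certified c = certifiedBy (select vertices (digits 50 c))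

    certified-infinite : ∀ {Q} → Tame Q →
      (∀ us → All (Usable (IsInner P)) us → Unique us → patchMatrix (arrows P) us EmbedsIn Q) →
      ∀ c → T (certified c) → ¬ FiniteMutationType Q
    certified-infinite tame embeds c ok = by (mapMaybe (indexOf _≟ˡ_ us) vs)
        (proj₂ (T-∧⁻ (allUsable us) ok))
      where
      vs us : List LocalVertex
      vs = select vertices (digits 50 c)
      us = deduplicate _≟ˡ_ vs
      by : ∀ path → T (grows (patchMatrix (arrows P) us) path) → ¬ FiniteMutationType _
      by (x ∷ y ∷ z ∷ path) grow =
        growing-infinite tame (embeds us (toWitness (proj₁ (T-∧⁻ (allUsable us) ok)))
            (Unique.deduplicate-! _≟ˡ_ vs))
          path x y z (toWitness grow)

-- Exploration trees and their soundness

data Tree : Set where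
  leaf   : ℕ → Tree
  branch : List Tree → Tree

module Search (newKinds : List Kind) (leafOK : Patch → ℕ → Bool) where
  open Exploration newKinds

  check    : Patch → Tree → Bool
  checkAll : List Patch → List Tree → Bool
  check P (leaf c)    = leafOK P c
  -- A patch without free sides has no children, so a branch there would be accepted vacuously;
  -- hence the test.
  check P (branch ts) = not (null (freeSides P)) ∧ checkAll (children P) ts
  checkAll []       _        = true
  checkAll (P ∷ Ps) (t ∷ ts) = check P t ∧ checkAll Ps ts
  checkAll (P ∷ Ps) []       = false

  module _ {S : MarkedSurface} (T′ : Triangulation S) where
    open Triangulation T′
    open Realizations T′

    module _
      (classify : ∀ δ r → ¬ IsInterval (side δ r) → Any (KindOf δ r) newKinds)
      (noSelfGlue : ∀ {δ i j} → ¬ Glued (δ , i) (δ , j))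
      {ℓ} {C : Set ℓ} (leaf-sound : ∀ P c → Realization P → T (leafOK P c) → C) where

      -- A realized patch with a free side has a realized child; following such children leads to a
      -- leaf. `C` may live at any level because it is also instantiated with `FiniteMutationType`.
      check-sound    : ∀ P t → Realization P → T (check P t) → C
      checkAll-sound : ∀ Ps ts → Any Realization Ps → T (checkAll Ps ts) → C
      check-sound P (leaf c)    ℛ ok = leaf-sound P c ℛ ok
      check-sound P (branch ts) ℛ ok with freeSides P in eq
      ... | []    = contradiction ok λ ()
      ... | _ ∷ _ = checkAll-sound _ ts
        (subst (Any Realization) (cong (childrenAt P) eq) (Step.step newKinds classify noSelfGlue ℛ eq)) ok
      checkAll-sound (P ∷ Ps) (t ∷ ts) (here ℛ)   ok = check-sound P t ℛ (proj₁ (T-∧⁻ (check P t) ok))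
      checkAll-sound (P ∷ Ps) (t ∷ ts) (there ℛs) ok = checkAll-sound Ps ts ℛs (proj₂ (T-∧⁻ (check P t) ok))

-- By Euler's formula, a closed patch with at most as many arcs as triangles is
-- a once-punctured polygon, and then the two numbers agree.
polygonOK : (ℕ → Bool) → Patch → Bool
polygonOK good P = null (freeSides P) ∧ (1 ≤ᵇ size P) ∧
  ((length (glue P) <ᵇ size P) ∨ ((length (glue P) ≤ᵇ size P) ∧ good (size P)))

module _ {S : MarkedSurface} (T′ : Triangulation S) (1≤p : 1 ≤ MarkedSurface.punctures S) where
  open Triangulation T′
  open Realizations T′

  polygon-sound : ∀ good P → Realization P → T (polygonOK good P) →
    T (good (size P)) × IsOncePuncturedPolygon (size P) S
  polygon-sound good P ℛ ok with freeSides P in closed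
  ... | _ ∷ _ = contradiction ok λ ()
  ... | [] with 1≤size , ok′ ← T-∧⁻ (1 ≤ᵇ size P) ok = conclude (Equivalence.to T-∨ ok′)
    where
    t₀ : Fin (size P)
    t₀ = Fin.fromℕ< (ℕ.≤ᵇ⇒≤ 1 (size P) 1≤size)
    open Closed ℛ closed
    F≡ : #triangles ≡ size P
    F≡ = #triangles≡size t₀
    polygon : length (glue P) ≤ size P → IsOncePuncturedPolygon #triangles S
    polygon le = fewArcs⇒polygon T′ 1≤p
      (ℕ.≤-trans (#arcs≤#glue t₀) (ℕ.≤-trans le (ℕ.≤-reflexive (sym F≡))))
    conclude : T (length (glue P) <ᵇ size P) ⊎ T ((length (glue P) ≤ᵇ size P) ∧ good (size P)) →
      T (good (size P)) × IsOncePuncturedPolygon (size P) S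
    -- With fewer pairs than triangles the surface would be a polygon, which has as many arcs as
    -- triangles; but every arc is one of the pairs.
    conclude (inj₁ lt) = contradiction
      (ℕ.≤-trans (ℕ.≤-reflexive (sym (trans (proj₂ (polygon-#triangles T′ (polygon (ℕ.<⇒≤ lt′))))
          F≡))) (#arcs≤#glue t₀))
      (ℕ.<⇒≱ lt′)
      where
      lt′ = ℕ.<ᵇ⇒< (length (glue P)) (size P) lt
    conclude (inj₂ both) =
      let le , ok = T-∧⁻ (length (glue P) ≤ᵇ size P) both
      in ok , subst (λ n → IsOncePuncturedPolygon n S) F≡ (polygon (ℕ.≤ᵇ⇒≤ _ (size P) le))

-- The second argument is a number of triangles. A triangulated once-punctured n-gon has n of them,
-- so 2 means the bigon and 3 the triangle.
goodTriangles𝒜 goodTriangles𝒜′ : ℕ → ℕ → Bool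
goodTriangles𝒜 3 2 = true
goodTriangles𝒜 _ _ = false
goodTriangles𝒜′ 3 2 = true
goodTriangles𝒜′ 3 3 = true
goodTriangles𝒜′ 4 2 = true
goodTriangles𝒜′ _ _ = false

-- A new triangle is reached through its side 0, which is thus an arc; this rules out `based 0F`.
kinds𝒜 kinds𝒜′ : List Kind
kinds𝒜  = unknown ∷ []
kinds𝒜′ = inner ∷ based 1F ∷ based 2F ∷ []

module _ (k : ℕ) where

  module C𝒜 = Certificate k (arrows𝒜 k) (λ _ _ → ⊤) (λ _ _ → yes tt)
  module C𝒜′ = Certificate k (arrows𝒜′ k) (λ P t → kind P t ≡ inner) (λ P t → kind P t ≟ᵏ inner)

  classified : Patch → Bool
  classified P = isYes (Fin.all? λ t → classified? (kind P t))
    where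
    classified? : (κ : Kind) → Dec (κ ≢ unknown)
    classified? unknown   = no λ ¬p → ¬p refl
    classified? inner     = yes λ ()
    classified? (based _) = yes λ ()

  -- A leaf labelled 0 is a polygon, the label of any other leaf is a certificate.
  leaf𝒜 leaf𝒜′ : Patch → ℕ → Bool
  leaf𝒜 P 0 = polygonOK (goodTriangles𝒜 k) P
  leaf𝒜 P c = C𝒜.certified P c
  leaf𝒜′ P 0 = polygonOK (goodTriangles𝒜′ k) P
  leaf𝒜′ P c = classified P ∧ C𝒜′.certified P c

  module S𝒜 = Search kinds𝒜 leaf𝒜
  module S𝒜′ = Search kinds𝒜′ leaf𝒜′

-- Exploration from an arbitrary triangle

triangle : Kind → Patch
triangle κ = patch (κ ∷ []) [] []

module _ {S : MarkedSurface} (T′ : Triangulation S) (1≤p : 1 ≤ MarkedSurface.punctures S) (k : ℕ) where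
  open Triangulation T′
  open Realizations T′

  someTriangle : Triangle
  someTriangle = proj₁ (cornersCover (inj₁ (Fin.fromℕ< 1≤p)))

  triangle-realized : ∀ {δ r κ} → KindOf δ r κ → Realization (triangle κ)
  triangle-realized {δ} {r} κ-ok = record
    { τ = λ _ → δ ; ρ = λ _ → r ; τ-injective = λ { {0F} {0F} _ → refl }
    ; kinds-ok = λ { 0F → κ-ok } ; glued = [] ; isolated = [] ; separated = [] }

  tame𝒜 : Tame (𝒜.quiver k T′)
  tame𝒜 = iceQuiver-tame (𝒜._≟_ k T′)
    (concatMap (λ δ → mapArrows (𝒜.place k T′ δ) (arrowsQ k)) (allFin #triangles))

  tame𝒜′ : Tame (𝒜′.quiver k T′)
  tame𝒜′ = iceQuiver-tame (𝒜′._≟_ k T′)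
    (concatMap (λ δ → 𝒜′.arrowsIn k T′ δ (hasBoundarySide? δ)) (allFin #triangles))

  explore𝒜 : ∀ t → S𝒜.check k (triangle unknown) t ≡ true → Regular → FiniteMutationType (𝒜.quiver k T′) →
    ∃[ n ] T (goodTriangles𝒜 k n) × IsOncePuncturedPolygon n S
  explore𝒜 t ok regular finite =
    S𝒜.check-sound k T′ (λ _ _ _ → here tt) noSelfGlue leaf-sound (triangle unknown) t
      (triangle-realized {someTriangle} {0F} tt) (subst T (sym ok) tt)
    where
    noSelfGlue : ∀ {δ i j} → ¬ Glued (δ , i) (δ , j)
    noSelfGlue = noSelfGluing T′ 1≤p regular
    leaf-sound : ∀ P c → Realization P → T (leaf𝒜 k P c) → ∃[ n ] T (goodTriangles𝒜 k n)
        × IsOncePuncturedPolygon n S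
    leaf-sound P zero      ℛ ok = size P , polygon-sound T′ 1≤p (goodTriangles𝒜 k) P ℛ ok
    leaf-sound P c@(suc _) ℛ ok = contradiction finite
      (C𝒜.certified-infinite k P tame𝒜 (Model𝒜.embeds k T′ noSelfGlue ℛ) c ok)

  module _ (taut : Taut) where

    private
      noSelfGlue : ∀ {δ i j} → ¬ Glued (δ , i) (δ , j)
      noSelfGlue = noSelfGluing T′ 1≤p (proj₁ taut)

    based-kind : ∀ {δ} r i → IsInterval (side δ (rotate r i)) → KindOf δ r (based i)
    based-kind {δ} r i int = int , λ j int′ → proj₂ taut δ j (rotate r i) int′ int

    -- A triangle of a taut triangulation has at most one boundary side, and this is not the side r
    -- through which it is reached.
    classify : ∀ δ r → ¬ IsInterval (side δ r) → Any (KindOf δ r) kinds𝒜′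
    classify δ r noInterval with hasBoundarySide? δ
    ... | no none = here none
    ... | yes (j , int) with unrotate r j | rotate-unrotate r j
    ...   | 0F | eq = contradiction (subst (IsInterval ∘ side δ) (trans (sym eq) (rotate-0 r)) int)
        noInterval
    ...   | 1F | eq = there (here (based-kind r 1F (subst (IsInterval ∘ side δ) (sym eq) int)))
    ...   | 2F | eq = there (there (here (based-kind r 2F (subst (IsInterval ∘ side δ) (sym eq) int))))

    leaf-sound : FiniteMutationType (𝒜′.quiver k T′) →
      ∀ P c → Realization P → T (leaf𝒜′ k P c) → ∃[ n ] T (goodTriangles𝒜′ k n) × IsOncePuncturedPolygon n S
    leaf-sound finite P zero      ℛ ok = size P , polygon-sound T′ 1≤p (goodTriangles𝒜′ k) P ℛ ok
    leaf-sound finite P c@(suc _) ℛ ok = contradiction finite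
      (C𝒜′.certified-infinite k P tame𝒜′
        (Model𝒜′.embeds k T′ noSelfGlue ℛ (toWitness (proj₁ (T-∧⁻ (classified k P) ok)))) c
            (proj₂ (T-∧⁻ (classified k P) ok)))

    explore𝒜′ : ∀ t₁ t₂ → S𝒜′.check k (triangle inner) t₁ ≡ true →
        S𝒜′.check k (triangle (based 0F)) t₂ ≡ true →
      FiniteMutationType (𝒜′.quiver k T′) →
      ∃[ n ] T (goodTriangles𝒜′ k n) × IsOncePuncturedPolygon n S
    explore𝒜′ t₁ t₂ ok₁ ok₂ finite with hasBoundarySide? someTriangle
    ... | no none       = S𝒜′.check-sound k T′ classify noSelfGlue (leaf-sound finite) (triangle inner) t₁
                            (triangle-realized {someTriangle} {0F} none) (subst T (sym ok₁) tt)
    ... | yes (i , int) = S𝒜′.check-sound k T′ classify noSelfGlue (leaf-sound finite)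
        (triangle (based 0F)) t₂
                            (triangle-realized {someTriangle} {i}
                              (based-kind i 0F (subst (IsInterval ∘ side someTriangle)
                                  (sym (rotate-0 i)) int)))
                            (subst T (sym ok₂) tt)

-- Infinite type for all k from 7 on

∑-applyUpTo-+ : ∀ a b (g : ℕ → A) f →
  ∑ (applyUpTo g (a + b)) f ≡ ∑ (applyUpTo g a) f + ∑ (applyUpTo (λ i → g (a + i)) b) f
∑-applyUpTo-+ zero    b g f = refl
∑-applyUpTo-+ (suc a) b g f =
  trans (cong (ℕ._+_ (f (g 0))) (∑-applyUpTo-+ a b (g ∘ suc) f)) (sym (ℕ.+-assoc (f (g 0)) _ _))

∑-applyUpTo : ∀ n (g : ℕ → A) f → ∑ (applyUpTo g n) f ≡ ∑ (upTo n) (f ∘ g)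
∑-applyUpTo n g f = trans (cong (λ xs → ∑ xs f) (sym (List.map-upTo g n))) (∑-map g (upTo n) f)

∑-upTo-+ : ∀ a b f → ∑ (upTo (a + b)) f ≡ ∑ (upTo a) f + ∑ (upTo b) (λ i → f (a + i))
∑-upTo-+ a b f = trans (∑-applyUpTo-+ a b id f)
  (cong (ℕ._+_ (∑ (upTo a) f)) (∑-applyUpTo b (ℕ._+_ a) f))

∑-upTo-zero : ∀ n {f} → (∀ {i} → i < n → f i ≡ 0) → ∑ (upTo n) f ≡ 0
∑-upTo-zero zero    off = refl
∑-upTo-zero (suc n) {f} off = cong₂ _+_ (off (s≤s z≤n))
  (trans (∑-applyUpTo n suc f) (∑-upTo-zero n (off ∘ s≤s)))

∑-allFin-+ : ∀ m n (f : Fin (m + n) → ℕ) →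
  ∑ (allFin (m + n)) f ≡ ∑ (allFin m) (f ∘ (_↑ˡ n)) + ∑ (allFin n) (f ∘ (m ↑ʳ_))
∑-allFin-+ m n f = trans (∑-tabulate-+ m id) (cong₂ _+_ (∑-tabulate m (_↑ˡ n)) (∑-tabulate n (m ↑ʳ_)))
  where
  ∑-tabulate-+ : ∀ m (g : Fin (m + n) → _) →
    ∑ (tabulate g) f ≡ ∑ (tabulate (g ∘ (_↑ˡ n))) f + ∑ (tabulate (g ∘ (m ↑ʳ_))) f
  ∑-tabulate-+ zero    g = refl
  ∑-tabulate-+ (suc m) g =
    trans (cong (ℕ._+_ (f (g zero))) (∑-tabulate-+ m (g ∘ suc))) (sym (ℕ.+-assoc (f (g zero)) _ _))
  ∑-tabulate : ∀ k (g : Fin k → _) → ∑ (tabulate g) f ≡ ∑ (allFin k) (f ∘ g)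
  ∑-tabulate k g = trans (cong (λ xs → ∑ xs f) (sym (List.map-tabulate id g))) (∑-map g (allFin k) f)

-- The part of Q_(m + n) with first coordinate above n is a copy of the part
-- of Q_m with positive first coordinate.

module _ {m n : ℕ} where

  stretch : Node m → Node (m + n)
  stretch (node a b c t a<m b<m c<m) =
    node (a + n) b c (trans (total a b c n) (cong (ℕ._+ n) t))
      (ℕ.+-monoˡ-< n a<m) (ℕ.<-≤-trans b<m (ℕ.m≤m+n m n)) (ℕ.<-≤-trans c<m (ℕ.m≤m+n m n))
    where
    total : ∀ a b c n → a + n + b + c ≡ a + b + c + n
    total = solve-∀

  stretchInner : InnerNode m → InnerNode (m + n)
  stretchInner (inner a b c t) = inner (a + n) b c (trans (total a b c n) (cong (ℕ._+ n) t))
    where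
    total : ∀ a b c n → suc (a + n) + suc b + suc c ≡ suc a + suc b + suc c + n
    total = solve-∀

  stretchInner-injective : Injective _≡_ _≡_ stretchInner
  stretchInner-injective {inner a b c _} {inner a′ b′ c′ _} eq
    with refl ← ℕ.+-cancelʳ-≡ n a a′ (cong InnerNode.a eq)
       | refl ← cong InnerNode.b eq | refl ← cong InnerNode.c eq = refl

  module _ (w : Node (m + n) × Node (m + n) → ℕ)
    (low : ∀ u v → Node.a u ≤ n → w (u , v) ≡ 0) where

    private
      at : ℕ → ℕ → ℕ → ℕ
      at i j l = ∑ (arrowsAt? (m + n) i j l) w

      at-low : ∀ {i} j l → i < n → at i j l ≡ 0
      at-low {i} j l i<n with 2 + (i + j + l) ℕ.≟ m + n
      ... | yes _ = cong₂ _+_ (low _ _ i<n) (cong₂ _+_ (low _ _ i<n) (cong (ℕ._+ 0) (low _ _ (ℕ.<⇒≤ i<n))))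
      ... | no _  = refl

      at-high : ∀ i {j l} → m ≤ j + l → at (i + n) j l ≡ 0
      at-high i {j} {l} m≤ with 2 + (i + n + j + l) ℕ.≟ m + n
      ... | no _   = refl
      ... | yes eq = contradiction (ℕ.≤-reflexive eq) (ℕ.<⇒≱ (s≤s (ℕ.≤-trans
        (ℕ.+-monoˡ-≤ n m≤) (ℕ.≤-trans (ℕ.m≤n+m (j + l + n) (suc i)) (ℕ.≤-reflexive (regroup i n j l))))))
        where
        regroup : ∀ i n j l → suc i + (j + l + n) ≡ suc (i + n + j + l)
        regroup = solve-∀

      at-stretch : ∀ i j l → at (i + n) j l ≡ ∑ (arrowsAt? m i j l) (λ (u , v) → w (stretch u , stretch v))
      at-stretch i j l with 2 + (i + n + j + l) ℕ.≟ m + n | 2 + (i + j + l) ℕ.≟ m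
      ... | yes _ | yes _ = refl
      ... | no _  | no _  = refl
      ... | yes p | no ¬q = contradiction (ℕ.+-cancelʳ-≡ n (2 + (i + j + l)) m
          (trans (regroup i n j l) p)) ¬q
        where
        regroup : ∀ i n j l → 2 + (i + j + l) + n ≡ 2 + (i + n + j + l)
        regroup = solve-∀
      ... | no ¬p | yes q = contradiction (trans (regroup i n j l) (cong (ℕ._+ n) q)) ¬p
        where
        regroup : ∀ i n j l → 2 + (i + n + j + l) ≡ 2 + (i + j + l) + n
        regroup = solve-∀

      initial : ∀ (f : ℕ → ℕ) → (∀ i → m ≤ i → f i ≡ 0) → ∑ (upTo (m + n)) f ≡ ∑ (upTo m) f
      initial f off = trans (∑-upTo-+ m n f)
        (trans (cong (ℕ._+_ (∑ (upTo m) f)) (∑-zero (upTo n) λ i → off (m + i) (ℕ.m≤m+n m i)))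
            (ℕ.+-identityʳ _))

      final : ∀ (f : ℕ → ℕ) → (∀ {i} → i < n → f i ≡ 0) → ∑ (upTo (m + n)) f ≡ ∑ (upTo m) (λ i → f (i + n))
      final f off = trans (cong (λ k → ∑ (upTo k) f) (ℕ.+-comm m n))
        (trans (∑-upTo-+ n m f) (trans (cong (ℕ._+ ∑ (upTo m) (λ i → f (n + i))) (∑-upTo-zero n off))
          (∑-cong (upTo m) λ i → cong f (ℕ.+-comm n i))))

    -- The index i is the least first coordinate in its small triangle. For i < n all three arrows
    -- start at first coordinate at most n and have weight 0. For i ≥ n they are shifted arrows of
    -- Q_m, whose total leaves no room for j or l to reach m.
    ∑-stretch : ∑ (arrowsQ (m + n)) w ≡ ∑ (arrowsQ m) (λ (u , v) → w (stretch u , stretch v))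
    ∑-stretch = begin
      ∑ (arrowsQ (m + n)) w
        ≡⟨ ∑-arrowsQ w ⟩
      (∑ (upTo (m + n)) λ i → ∑ (upTo (m + n)) λ j → ∑ (upTo (m + n)) λ l → at i j l)
        ≡⟨ final _ (λ i<n → ∑-zero (upTo (m + n)) λ j → ∑-zero (upTo (m + n)) λ l → at-low j l i<n) ⟩
      (∑ (upTo m) λ i → ∑ (upTo (m + n)) λ j → ∑ (upTo (m + n)) λ l → at (i + n) j l)
        ≡⟨ ∑-cong (upTo m) (λ i → initial _ λ j m≤j → ∑-zero (upTo (m + n)) λ l →
            at-high i (ℕ.m≤n⇒m≤n+o l m≤j)) ⟩
      (∑ (upTo m) λ i → ∑ (upTo m) λ j → ∑ (upTo (m + n)) λ l → at (i + n) j l)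
        ≡⟨ ∑-cong (upTo m) (λ i → ∑-cong (upTo m) λ j → initial _ λ l m≤l → at-high i (ℕ.m≤n⇒m≤o+n j m≤l)) ⟩
      (∑ (upTo m) λ i → ∑ (upTo m) λ j → ∑ (upTo m) λ l → at (i + n) j l)
        ≡⟨ ∑-cong (upTo m) (λ i → ∑-cong (upTo m) λ j → ∑-cong (upTo m) λ l → at-stretch i j l) ⟩
      (∑ (upTo m) λ i → ∑ (upTo m) λ j → ∑ (upTo m) λ l → ∑ (arrowsAt? m i j l)
          (λ (u , v) → w (stretch u , stretch v)))
        ≡⟨ ∑-arrowsQ (λ (u , v) → w (stretch u , stretch v)) ⟨
      ∑ (arrowsQ m) (λ (u , v) → w (stretch u , stretch v)) ∎
      where open ≡-Reasoning

  count-stretch : ∀ {A B : Set} (_≟_ : DecidableEquality A) (_≟′_ : DecidableEquality B)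
    {f : Node (m + n) → A} {g : Node m → B} {x y x′ y′} →
    (∀ u → (f (stretch u) ≡ x → g u ≡ x′) × (g u ≡ x′ → f (stretch u) ≡ x)) →
    (∀ u → (f (stretch u) ≡ y → g u ≡ y′) × (g u ≡ y′ → f (stretch u) ≡ y)) →
    (∀ u → Node.a u ≤ n → f u ≢ x) →
    count _≟_ x y (mapArrows f (arrowsQ (m + n))) ≡ count _≟′_ x′ y′ (mapArrows g (arrowsQ m))
  count-stretch _≟_ _≟′_ {f} {g} {x} {y} xs ys low =
    trans (count-mapArrows _≟_ x y f (arrowsQ (m + n)))
      (trans (∑-stretch (λ (u , v) → χ (isArrow? _≟_ x y (f u , f v)))
               (λ u v a≤n → χ-no (isArrow? _≟_ x y (f u , f v)) (low u a≤n ∘ cong proj₁)))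
        (trans (sym (count-mapArrows _≟_ x y (f ∘ stretch) (arrowsQ m)))
          (count-cong _≟_ _≟′_ xs ys (arrowsQ m))))

-- The part of Q_(1 + m + n)^1 with the first m indices is a copy of the
-- mutable part of Q_(1 + m)^1.

module _ {m n : ℕ} where

  stretch¹ : Node¹ (suc m) → Node¹ (suc (m + n))
  stretch¹ (L s) = L (s ↑ˡ n)
  stretch¹ (R s) = R (s ↑ˡ n)
  stretch¹ M     = M

  Far : Node¹ (suc (m + n)) → Set
  Far u = ∃[ s ] (u ≡ L (m ↑ʳ s) ⊎ u ≡ R (m ↑ʳ s))

  module _ (w : Node¹ (suc (m + n)) × Node¹ (suc (m + n)) → ℕ)
    (far₁ : ∀ u v → Far u → w (u , v) ≡ 0) (far₂ : ∀ u v → Far v → w (u , v) ≡ 0) where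

    private
      k : ℕ
      k = suc (m + n)

      slant : Fin (m + n) → Fin (m + n) → ℕ
      slant s t = ∑ (slanted k s t) w

      block : Fin (m + n) → ℕ
      block t = w (R t , L t) + (∑ (bottom k t) w + ∑ (allFin (m + n)) (λ s → slant s t))

      w′ : Node¹ (suc m) × Node¹ (suc m) → ℕ
      w′ (u , v) = w (stretch¹ u , stretch¹ v)

      ∑-block : ∀ k (w : Node¹ k × Node¹ k → ℕ) → ∑ (arrowsQ¹ k) w ≡ ∑ (allFin (k ∸ 1)) λ t →
        w (R t , L t) + (∑ (bottom k t) w + ∑ (allFin (k ∸ 1)) (λ s → ∑ (slanted k s t) w))
      ∑-block k w = trans (∑-concatMap _ (allFin (k ∸ 1)) w) (∑-cong (allFin (k ∸ 1)) λ t →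
        cong (ℕ._+_ (w (R t , L t))) (trans (∑-++ (bottom k t) _ w)
          (cong (ℕ._+_ (∑ (bottom k t) w)) (∑-concatMap (λ s → slanted k s t) (allFin (k ∸ 1)) w))))

      slant-far₁ : ∀ s t → slant (m ↑ʳ s) t ≡ 0
      slant-far₁ s t with suc (toℕ (m ↑ʳ s)) ℕ.≟ toℕ t
      ... | yes _ = cong₂ _+_ (far₂ _ _ (s , inj₂ refl)) (cong (ℕ._+ 0) (far₁ _ _ (s , inj₂ refl)))
      ... | no _  = refl

      slant-far₂ : ∀ s t → slant s (m ↑ʳ t) ≡ 0
      slant-far₂ s t with suc (toℕ s) ℕ.≟ toℕ (m ↑ʳ t)
      ... | yes _ = cong₂ _+_ (far₁ _ _ (t , inj₁ refl)) (cong (ℕ._+ 0) (far₂ _ _ (t , inj₂ refl)))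
      ... | no _  = refl

      bottom-far : ∀ t → ∑ (bottom k (m ↑ʳ t)) w ≡ 0
      bottom-far t with toℕ (m ↑ʳ t) ℕ.≟ 0
      ... | yes _ = cong₂ _+_ (far₁ _ _ (t , inj₁ refl)) (cong (ℕ._+ 0) (far₂ _ _ (t , inj₂ refl)))
      ... | no _  = refl

      block-far : ∀ t → block (m ↑ʳ t) ≡ 0
      block-far t = cong₂ _+_ (far₁ _ _ (t , inj₂ refl))
        (cong₂ _+_ (bottom-far t) (∑-zero (allFin (m + n)) λ s → slant-far₂ s t))

      slant-near : ∀ s t → slant (s ↑ˡ n) (t ↑ˡ n) ≡ ∑ (slanted (suc m) s t) w′
      slant-near s t with suc (toℕ (s ↑ˡ n)) ℕ.≟ toℕ (t ↑ˡ n) | suc (toℕ s) ℕ.≟ toℕ t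
      ... | yes _ | yes _ = refl
      ... | no _  | no _  = refl
      ... | yes p | no ¬q = contradiction
        (trans (cong suc (sym (Fin.toℕ-↑ˡ s n))) (trans p (Fin.toℕ-↑ˡ t n))) ¬q
      ... | no ¬p | yes q = contradiction
        (trans (cong suc (Fin.toℕ-↑ˡ s n)) (trans q (sym (Fin.toℕ-↑ˡ t n)))) ¬p

      bottom-near : ∀ t → ∑ (bottom k (t ↑ˡ n)) w ≡ ∑ (bottom (suc m) t) w′
      bottom-near t with toℕ (t ↑ˡ n) ℕ.≟ 0 | toℕ t ℕ.≟ 0
      ... | yes _ | yes _ = refl
      ... | no _  | no _  = refl
      ... | yes p | no ¬q = contradiction (trans (sym (Fin.toℕ-↑ˡ t n)) p) ¬q
      ... | no ¬p | yes q = contradiction (trans (Fin.toℕ-↑ˡ t n) q) ¬p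

      block-near : ∀ t → block (t ↑ˡ n) ≡
        w′ (R t , L t) + (∑ (bottom (suc m) t) w′ + ∑ (allFin m) (λ s → ∑ (slanted (suc m) s t) w′))
      block-near t = cong (ℕ._+_ (w (R (t ↑ˡ n) , L (t ↑ˡ n)))) (cong₂ _+_ (bottom-near t)
        (trans (∑-allFin-+ m n (λ s → slant s (t ↑ˡ n)))
          (trans (cong₂ _+_ (∑-cong (allFin m) λ s → slant-near s t)
                            (∑-zero (allFin n) λ s → slant-far₁ s (t ↑ˡ n)))
            (ℕ.+-identityʳ _))))

    -- All sums over indices are split after the first m. Arrows with an end beyond that have weight
    -- 0, and the others, including those at M, are those of the smaller quiver.
    ∑-stretch¹ : ∑ (arrowsQ¹ (suc (m + n))) w ≡ ∑ (arrowsQ¹ (suc m))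
        (λ (u , v) → w (stretch¹ u , stretch¹ v))
    ∑-stretch¹ = trans (∑-block k w) (trans (∑-allFin-+ m n block)
      (trans (cong₂ _+_ (∑-cong (allFin m) block-near) (∑-zero (allFin n) block-far))
        (trans (ℕ.+-identityʳ _) (sym (∑-block (suc m) w′)))))

  count-stretch¹ : ∀ {A B : Set} (_≟_ : DecidableEquality A) (_≟′_ : DecidableEquality B)
    {f : Node¹ (suc (m + n)) → A} {g : Node¹ (suc m) → B} {x y x′ y′} →
    (∀ u → (f (stretch¹ u) ≡ x → g u ≡ x′) × (g u ≡ x′ → f (stretch¹ u) ≡ x)) →
    (∀ u → (f (stretch¹ u) ≡ y → g u ≡ y′) × (g u ≡ y′ → f (stretch¹ u) ≡ y)) →
    (∀ u → Far u → f u ≢ x) → (∀ u → Far u → f u ≢ y) →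
    count _≟_ x y (mapArrows f (arrowsQ¹ (suc (m + n)))) ≡ count _≟′_ x′ y′ (mapArrows g (arrowsQ¹ (suc m)))
  count-stretch¹ _≟_ _≟′_ {f} {g} {x} {y} xs ys far₁ far₂ =
    trans (count-mapArrows _≟_ x y f (arrowsQ¹ (suc (m + n))))
      (trans (∑-stretch¹ (λ (u , v) → χ (isArrow? _≟_ x y (f u , f v)))
               (λ u v far → χ-no (isArrow? _≟_ x y (f u , f v)) (far₁ u far ∘ cong proj₁))
               (λ u v far → χ-no (isArrow? _≟_ x y (f u , f v)) (far₂ v far ∘ cong proj₂)))
        (trans (sym (count-mapArrows _≟_ x y (f ∘ stretch¹) (arrowsQ¹ (suc m))))
          (count-cong _≟_ _≟′_ xs ys (arrowsQ¹ (suc m)))))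

-- Triangles with copies of Q_k^1 whose top corners coincide: the first one
-- has neighbours across its left and its right side.
fan₂ fan₃ : Patch
fan₂ = patch (based 0F ∷ based 0F ∷ [])
  (((0F , 1F) , (1F , 2F)) ∷ ((0F , 2F) , (1F , 1F)) ∷ []) []
fan₃ = patch (based 0F ∷ based 0F ∷ based 0F ∷ [])
  (((0F , 1F) , (1F , 2F)) ∷ ((0F , 2F) , (2F , 1F)) ∷ []) []

-- The positions refer to the 15 inner nodes of Q_7 for the single triangle, and to the six vertices
-- on each of the two recorded arcs for the fans.
triangleCode fan₂Code fan₃Code : ℕ
triangleCode = 8030614021011071102
fan₂Code     = 110212090203
fan₃Code     = 6040810120504071112120803

unknown-certified : C𝒜.certified 7 (triangle unknown) triangleCode ≡ true
unknown-certified = refl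

inner-certified : C𝒜′.certified 7 (triangle inner) triangleCode ≡ true
inner-certified = refl

fan₂-certified : C𝒜′.certified 7 fan₂ fan₂Code ≡ true
fan₂-certified = refl

fan₃-certified : C𝒜′.certified 7 fan₃ fan₃Code ≡ true
fan₃-certified = refl

module Widening (n : ℕ) where

  -- Indices of Q_k^1 are counted from the boundary. With bottom side 0 this agrees with the
  -- direction of the left side 1 and is opposite to that of the right side 2, where the window
  -- therefore sits at the end.
  widenPosition : Fin 3 → SidePosition 7 → SidePosition (7 + n)
  widenPosition 2F s = opposite (opposite s ↑ˡ n)
  widenPosition _  s = s ↑ˡ n

  widenPosition-injective : ∀ i → Injective _≡_ _≡_ (widenPosition i)
  widenPosition-injective 0F eq = Fin.↑ˡ-injective n _ _ eq
  widenPosition-injective 1F eq = Fin.↑ˡ-injective n _ _ eq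
  widenPosition-injective 2F {s} {t} eq = opposite-injective
    (Fin.↑ˡ-injective n (opposite s) (opposite t) (opposite-injective eq))
    where
    opposite-injective : ∀ {k} {s t : Fin k} → opposite s ≡ opposite t → s ≡ t
    opposite-injective {_} {s} {t} eq =
      trans (sym (Fin.opposite-involutive s)) (trans (cong opposite eq) (Fin.opposite-involutive t))

  module _ (P : Patch) where

    widen : Local.LocalVertex 7 P → Local.LocalVertex (7 + n) P
    widen (inj₁ ((t , i) , s)) = inj₁ ((t , i) , widenPosition i s)
    widen (inj₂ (t , y))       = inj₂ (t , stretchInner y)

    widen-injective : Injective _≡_ _≡_ widen
    widen-injective {inj₁ ((t , i) , s)} {inj₁ ((t′ , i′) , s′)} eq with refl ← cong proj₁ (Sum.inj₁-injective eq) =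
      cong (λ s → inj₁ ((t , i) , s)) (widenPosition-injective i (cong proj₂ (Sum.inj₁-injective eq)))
    widen-injective {inj₂ (t , y)} {inj₂ (t′ , y′)} eq =
      cong inj₂ (cong₂ _,_ (cong proj₁ (Sum.inj₂-injective eq))
          (stretchInner-injective (cong proj₂ (Sum.inj₂-injective eq))))

    widen-usable : ∀ {IsInner} x → Local.Usable 7 P IsInner x → Local.Usable (7 + n) P IsInner (widen x)
    widen-usable (inj₁ _) u = u
    widen-usable (inj₂ _) u = u

  open Local using (LocalVertex; placeLocally; placeLocally¹; _≟ˡ_)

  module _ (κ : Kind) where

    private
      P = triangle κ

    -- No side is glued, so usable vertices are inner nodes, and widening keeps their first
    -- coordinate above n. A node of Q_7 with a = 0 may become inner, but it lands at first
    -- coordinate n and is not mistaken for one of them.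
    triangle-count : ∀ {IsInner} x y → Local.Usable 7 P IsInner x → Local.Usable 7 P IsInner y → ∀ t →
      localCount (_≟ˡ_ (7 + n) P) (widen P x) (widen P y)
          (mapArrows (placeLocally (7 + n) P t) (arrowsQ (7 + n))) ≡
      localCount (_≟ˡ_ 7 P) x y (mapArrows (placeLocally 7 P t) (arrowsQ 7))
    triangle-count (inj₂ x) (inj₂ y) _ _ 0F =
      count-stretch (Maybe.≡-dec (_≟ˡ_ (7 + n) P)) (Maybe.≡-dec (_≟ˡ_ 7 P)) (match x) (match y) (low x)
      where
      depth : Maybe (LocalVertex (7 + n) P) → ℕ
      depth (just (inj₂ (_ , y))) = InnerNode.a y
      depth _                     = 0
      low : ∀ x u → Node.a u ≤ n → placeLocally (7 + n) P 0F u ≢ just (widen P (inj₂ x))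
      low x (node zero    b       (suc c) _ _ _ _) le ()
      low (_ , y) (node (suc a) (suc b) (suc c) _ _ _ _) le eq =
        ℕ.<⇒≱ le (ℕ.≤-trans (ℕ.m≤n+m n (InnerNode.a y)) (ℕ.≤-reflexive (sym (cong depth eq))))
      match : ∀ x u →
        (placeLocally (7 + n) P 0F (stretch u) ≡ just (widen P (inj₂ x)) → placeLocally 7 P 0F u
            ≡ just (inj₂ x)) ×
        (placeLocally 7 P 0F u ≡ just (inj₂ x) → placeLocally (7 + n) P 0F (stretch u) ≡ just
            (widen P (inj₂ x)))
      match x (node zero    b       zero    _ _ _ _) = (λ ()) , (λ ())
      match x u@(node zero  b       (suc c) _ _ _ _) =
        (λ eq → contradiction eq (low x (stretch u) ℕ.≤-refl)) , (λ ())
      match x (node (suc a) b       zero    _ _ _ _) = (λ ()) , (λ ())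
      match x (node (suc a) zero    (suc c) _ _ _ _) = (λ ()) , (λ ())
      match x (node (suc a) (suc b) (suc c) _ _ _ _) =
        (λ eq → cong just (widen-injective P (Maybe.just-injective eq))) , (λ { refl → refl })

  near≢far : ∀ {s : Fin 6} {t : Fin n} → 6 ↑ʳ t ≢ s ↑ˡ n
  near≢far {s} {t} eq with trans (sym (Fin.splitAt-↑ʳ 6 n t)) (trans (cong (Fin.splitAt 6) eq) (Fin.splitAt-↑ˡ 6 s n))
  ... | ()

  -- Around a common top corner, index s on a left side meets index s on the neighbour's right side:
  -- one `opposite` comes from the direction of the right side and another from the gluing. Hence
  -- the windows fit together.
  record Windows (P : Patch) : Set where
    field
      near : ∀ t u → placeLocally¹ (7 + n) P t 0F (stretch¹ u) ≡ Maybe.map (widen P)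
          (placeLocally¹ 7 P t 0F u)
      far  : ∀ t x v → Far {6} {n} v → placeLocally¹ (7 + n) P t 0F v ≢ just (widen P x)

  left-far : ∀ {P} {a : Fin (size P)} {s} t x → _≡_ {A = Maybe (LocalVertex (7 + n) P)}
      (just (inj₁ ((a , 1F) , s))) (just (widen P x)) → s ≢ 6 ↑ʳ t
  left-far t (inj₁ ((_ , 1F) , s)) refl eq = near≢far (sym eq)

  right-far : ∀ {P} {a : Fin (size P)} {s} t x → _≡_ {A = Maybe (LocalVertex (7 + n) P)}
      (just (inj₁ ((a , 2F) , s))) (just (widen P x)) → s ≢ opposite (6 ↑ʳ t)
  right-far t (inj₁ ((_ , 2F) , s)) refl eq =
    near≢far (trans (sym (Fin.opposite-involutive (6 ↑ʳ t)))
        (trans (cong opposite (sym eq)) (Fin.opposite-involutive (opposite s ↑ˡ n))))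

  windows₂ : Windows fan₂
  windows₂ = record { near = near ; far = far }
    where
    near : ∀ t u → placeLocally¹ (7 + n) fan₂ t 0F (stretch¹ u) ≡ Maybe.map (widen fan₂)
        (placeLocally¹ 7 fan₂ t 0F u)
    near 0F (L s) = refl
    near 0F (R s) = cong (λ s → just (inj₁ ((0F , 2F) , opposite (s ↑ˡ n))))
        (sym (Fin.opposite-involutive s))
    near 0F M     = refl
    near 1F (L s) = cong (λ s → just (inj₁ ((0F , 2F) , opposite (s ↑ˡ n))))
        (sym (Fin.opposite-involutive s))
    near 1F (R s) = cong (λ s → just (inj₁ ((0F , 1F) , s)))
        (trans (Fin.opposite-involutive (s ↑ˡ n)) (cong (_↑ˡ n) (sym (Fin.opposite-involutive s))))
    near 1F M     = refl
    far : ∀ t x v → Far {6} {n} v → placeLocally¹ (7 + n) fan₂ t 0F v ≢ just (widen fan₂ x)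
    far 0F x _ (s , inj₁ refl) eq = left-far {fan₂} s x eq refl
    far 0F x _ (s , inj₂ refl) eq = right-far {fan₂} s x eq refl
    far 1F x _ (s , inj₁ refl) eq = right-far {fan₂} s x eq refl
    far 1F x _ (s , inj₂ refl) eq = left-far {fan₂} s x eq (Fin.opposite-involutive _)

  windows₃ : Windows fan₃
  windows₃ = record { near = near ; far = far }
    where
    near : ∀ t u → placeLocally¹ (7 + n) fan₃ t 0F (stretch¹ u) ≡ Maybe.map (widen fan₃)
        (placeLocally¹ 7 fan₃ t 0F u)
    near 0F (L s) = refl
    near 0F (R s) = cong (λ s → just (inj₁ ((0F , 2F) , opposite (s ↑ˡ n))))
        (sym (Fin.opposite-involutive s))
    near 0F M     = refl
    near 1F (L s) = refl
    near 1F (R s) = cong (λ s → just (inj₁ ((0F , 1F) , s)))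
        (trans (Fin.opposite-involutive (s ↑ˡ n)) (cong (_↑ˡ n) (sym (Fin.opposite-involutive s))))
    near 1F M     = refl
    near 2F (L s) = cong (λ s → just (inj₁ ((0F , 2F) , opposite (s ↑ˡ n))))
        (sym (Fin.opposite-involutive s))
    near 2F (R s) = refl
    near 2F M     = refl
    far : ∀ t x v → Far {6} {n} v → placeLocally¹ (7 + n) fan₃ t 0F v ≢ just (widen fan₃ x)
    far 0F x _ (s , inj₁ refl) eq = left-far {fan₃} s x eq refl
    far 0F x _ (s , inj₂ refl) eq = right-far {fan₃} s x eq refl
    far 1F x _ (s , inj₁ refl) ()
    far 1F x _ (s , inj₂ refl) eq = left-far {fan₃} s x eq (Fin.opposite-involutive _)
    far 2F x _ (s , inj₁ refl) eq = right-far {fan₃} s x eq refl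
    far 2F x _ (s , inj₂ refl) ()

  fan-count : ∀ {P} → Windows P → ∀ x y t →
    localCount (_≟ˡ_ (7 + n) P) (widen P x) (widen P y) (mapArrows (placeLocally¹ (7 + n) P t 0F)
        (arrowsQ¹ (7 + n))) ≡
    localCount (_≟ˡ_ 7 P) x y (mapArrows (placeLocally¹ 7 P t 0F) (arrowsQ¹ 7))
  fan-count {P} windows x y t =
    count-stretch¹ (Maybe.≡-dec (_≟ˡ_ (7 + n) P)) (Maybe.≡-dec (_≟ˡ_ 7 P)) (match x) (match y)
        (far t x) (far t y)
    where
    open Windows windows
    match : ∀ x u →
      (placeLocally¹ (7 + n) P t 0F (stretch¹ u) ≡ just (widen P x) → placeLocally¹ 7 P t 0F u ≡ just x) ×
      (placeLocally¹ 7 P t 0F u ≡ just x → placeLocally¹ (7 + n) P t 0F (stretch¹ u) ≡ just (widen P x))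
    match x u =
      (λ eq → Maybe.map-injective (widen-injective P) (trans (sym (near t u)) eq)) ,
      (λ eq → trans (near t u) (cong (Maybe.map (widen P)) eq))

module _ {S : MarkedSurface} (T′ : Triangulation S) (1≤p : 1 ≤ MarkedSurface.punctures S) (n : ℕ) where
  open Triangulation T′
  open Realizations T′
  open Widening n

  large𝒜 : Regular → ¬ FiniteMutationType (𝒜.quiver (7 + n) T′)
  large𝒜 regular = C𝒜.certified-infinite 7 P (tame𝒜 T′ 1≤p (7 + n))
    (Model𝒜.embedsVia (7 + n) T′ (noSelfGluing T′ 1≤p regular)
        (triangle-realized T′ 1≤p (7 + n) {someTriangle T′ 1≤p 7} {0F} tt)
      (widen P) (widen-injective P) (λ x → widen-usable P {λ _ → ⊤} x)
      (λ x y u v t → triangle-count unknown {λ _ → ⊤} x y u v t))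
    triangleCode (subst T (sym unknown-certified) tt)
    where
    P = triangle unknown

  module _ (taut : Taut) where

    private
      noSelfGlue : ∀ {δ i j} → ¬ Glued (δ , i) (δ , j)
      noSelfGlue = noSelfGluing T′ 1≤p (proj₁ taut)

      Q : IceQuiver
      Q = 𝒜′.quiver (7 + n) T′

      tame : Tame Q
      tame = tame𝒜′ T′ 1≤p (7 + n)

    innerTriangle-infinite : ∀ {δ} → ¬ HasBoundarySide δ → ¬ FiniteMutationType Q
    innerTriangle-infinite {δ} none = C𝒜′.certified-infinite 7 P tame
      (Model𝒜′.embedsVia (7 + n) T′ noSelfGlue (triangle-realized T′ 1≤p (7 + n) {δ} {0F} none)
          (λ { 0F () })
        (widen P) (widen-injective P) (λ x → widen-usable P {λ t → kind P t ≡ inner} x) counts)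
      triangleCode (subst T (sym inner-certified) tt)
      where
      P = triangle inner
      counts : ∀ x y → Local.Usable 7 P (λ t → kind P t ≡ inner) x → Local.Usable 7 P
          (λ t → kind P t ≡ inner) y → ∀ t → _
      counts x y u v 0F = triangle-count inner {λ t → kind P t ≡ inner} x y u v 0F

    fan-infinite : ∀ P → (∀ t → kind P t ≡ based 0F) → Windows P → Realization P →
      ∀ c → C𝒜′.certified 7 P c ≡ true → ¬ FiniteMutationType Q
    fan-infinite P based-at-0 windows ℛ c ok = C𝒜′.certified-infinite 7 P tame
      (Model𝒜′.embedsVia (7 + n) T′ noSelfGlue ℛ
        (λ t eq → case (trans (sym (based-at-0 t)) eq) of λ ())
        (widen P) (widen-injective P) (λ x → widen-usable P {λ t → kind P t ≡ inner} x) counts)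
      c (subst T (sym ok) tt)
      where
      counts : ∀ x y → Local.Usable 7 P (λ t → kind P t ≡ inner) x → Local.Usable 7 P
          (λ t → kind P t ≡ inner) y → ∀ t →
        localCount (Local._≟ˡ_ (7 + n) P) (widen P x) (widen P y) (arrows𝒜′ (7 + n) P t) ≡
        localCount (Local._≟ˡ_ 7 P) x y (arrows𝒜′ 7 P t)
      counts x y u v t rewrite based-at-0 t = fan-count windows x y t

    -- Both ends of a boundary interval are boundary points, which leaves only the corner opposite
    -- to it.
    puncture-top : ∀ {δ i j q} → IsInterval (side δ i) → corner δ j ≡ inj₁ q → j ≡ next (next i)
    puncture-top {δ} {i} {j} (b , eq) at-j with cover i j
    ... | inj₁ refl = case trans (sym (cong source eq)) at-j of λ ()
    ... | inj₂ (inj₁ refl) = case trans (sym (cong target eq)) (trans (sidesMeet δ i) at-j) of λ ()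
    ... | inj₂ (inj₂ eq′) = eq′

    module _ (boundary : ∀ δ → HasBoundarySide δ) where

      base : Triangle → Fin 3
      base δ = proj₁ (boundary δ)

      base-kind : ∀ δ → KindOf δ (base δ) (based 0F)
      base-kind δ = based-kind T′ 1≤p (7 + n) taut (base δ) 0F
        (subst (IsInterval ∘ side δ) (sym (rotate-0 (base δ))) (proj₂ (boundary δ)))

      arcSide : ∀ δ {i} → i ≢ base δ → Σ[ s ∈ Triangle × Fin 3 ] Glued (δ , i) s
      arcSide δ {i} i≢ with partner T′ (δ , i)
      ... | inj₁ int = contradiction (proj₂ taut δ i (base δ) int (proj₂ (boundary δ))) i≢
      ... | inj₂ s   = s

      next≢ : ∀ (i : Fin 3) → next i ≢ i
      next≢ 0F ()
      next≢ 1F ()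
      next≢ 2F ()

      next²≢ : ∀ (i : Fin 3) → next (next i) ≢ i
      next²≢ 0F ()
      next²≢ 1F ()
      next²≢ 2F ()

      rotate-1 : ∀ r → next r ≡ rotate r 1F
      rotate-1 r = trans (cong next (sym (rotate-0 r))) (sym (rotate-next r 0F))

      rotate-2 : ∀ r → next (next r) ≡ rotate r 2F
      rotate-2 r = trans (cong next (rotate-1 r)) (sym (rotate-next r 1F))

      next-injective : ∀ {i j : Fin 3} → next i ≡ next j → i ≡ j
      next-injective {i} {j} eq = trans (sym (next³ i)) (trans (cong (next ∘ next) eq) (next³ j))

      -- At a puncture every triangle has its top corner, so the left side of one triangle is glued
      -- to the right side of the next. A triangle there and its two neighbours form `fan₃`, or
      -- `fan₂` if the neighbours coincide.
      boundary-infinite : ¬ FiniteMutationType Q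
      boundary-infinite
        with δ , j , at-j ← cornersCover (inj₁ (Fin.fromℕ< 1≤p))
        with refl ← puncture-top (proj₂ (boundary δ)) at-j
        with (ε , l) , g ← arcSide δ (next≢ (base δ)) | (ζ , r) , h ← arcSide δ (next²≢ (base δ))
        with refl ← puncture-top {j = l} (proj₂ (boundary ε)) (trans (Glued-corner T′ (Glued-sym T′ g)) at-j)
           | top ← puncture-top {j = next r} (proj₂ (boundary ζ)) (trans (sym (Glued-corner T′ h)) at-j)
        with refl ← next-injective {r} {next (base ζ)} top
        = go (ε Fin.≟ ζ)
        where
        go : Dec (ε ≡ ζ) → ¬ FiniteMutationType Q
        go (yes refl) = fan-infinite fan₂ (λ { 0F → refl ; 1F → refl }) windows₂ (record
          { τ = τ ; ρ = base ∘ τ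
          ; τ-injective = λ
              { {0F} {0F} _ → refl ; {0F} {1F} eq → contradiction (sym eq) apart
              ; {1F} {0F} eq → contradiction eq apart ; {1F} {1F} _ → refl }
          ; kinds-ok = λ { 0F → base-kind δ ; 1F → base-kind ε }
          ; glued = g′ ∷ h′ ∷ []
          ; isolated = []
          ; separated = ((((λ ()) , (λ ())) , ((λ ()) , (λ ()))) ∷ []) ∷ [] ∷ []
          }) fan₂Code fan₂-certified
          where
          τ : Fin 2 → Triangle
          τ 0F = δ
          τ 1F = ε
          apart : ε ≢ δ
          apart refl = noSelfGlue g
          g′ : Glued (δ , rotate (base δ) 1F) (ε , rotate (base ε) 2F)
          g′ = subst₂ (λ i j → Glued (δ , i) (ε , j)) (rotate-1 (base δ)) (rotate-2 (base ε)) g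
          h′ : Glued (δ , rotate (base δ) 2F) (ε , rotate (base ε) 1F)
          h′ = subst₂ (λ i j → Glued (δ , i) (ε , j)) (rotate-2 (base δ)) (rotate-1 (base ε)) h
        go (no ε≢ζ) = fan-infinite fan₃ (λ { 0F → refl ; 1F → refl ; 2F → refl }) windows₃ (record
          { τ = τ ; ρ = base ∘ τ
          ; τ-injective = λ
              { {0F} {0F} _ → refl ; {0F} {1F} eq → contradiction (sym eq) apart
              ; {0F} {2F} eq → contradiction (sym eq) apart′
              ; {1F} {0F} eq → contradiction eq apart ; {1F} {1F} _ → refl
              ; {1F} {2F} eq → contradiction eq ε≢ζ
              ; {2F} {0F} eq → contradiction eq apart′ ; {2F} {1F} eq → contradiction (sym eq) ε≢ζ
              ; {2F} {2F} _ → refl }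
          ; kinds-ok = λ { 0F → base-kind δ ; 1F → base-kind ε ; 2F → base-kind ζ }
          ; glued = g′ ∷ h′ ∷ []
          ; isolated = []
          ; separated = ((((λ ()) , (λ ())) , ((λ ()) , (λ ()))) ∷ []) ∷ [] ∷ []
          }) fan₃Code fan₃-certified
          where
          τ : Fin 3 → Triangle
          τ 0F = δ
          τ 1F = ε
          τ 2F = ζ
          apart : ε ≢ δ
          apart refl = noSelfGlue g
          apart′ : ζ ≢ δ
          apart′ refl = noSelfGlue h
          g′ : Glued (δ , rotate (base δ) 1F) (ε , rotate (base ε) 2F)
          g′ = subst₂ (λ i j → Glued (δ , i) (ε , j)) (rotate-1 (base δ)) (rotate-2 (base ε)) g
          h′ : Glued (δ , rotate (base δ) 2F) (ζ , rotate (base ζ) 1F)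
          h′ = subst₂ (λ i j → Glued (δ , i) (ζ , j)) (rotate-2 (base δ)) (rotate-1 (base ζ)) h

    large𝒜′ : ¬ FiniteMutationType Q
    large𝒜′ with Fin.any? (λ δ → ¬? (hasBoundarySide? δ))
    ... | yes (δ , none) = innerTriangle-infinite none
    ... | no all         = boundary-infinite (λ δ → decidable-stable (hasBoundarySide? δ)
        (λ none → all (δ , none)))

-- Certificates of finite type

embeds-onto : ∀ {n} {A : Matrix n} {Q} (e : A EmbedsIn Q) →
  (∀ z → ∃[ i ] e .embed i ≡ z) → mutablePart Q ≅ matrixQuiver A
embeds-onto {A = A} {Q} e onto =
  mk↔ₛ′ (proj₁ ∘ onto) (e .embed) (λ i → e .embed-injective (proj₂ (onto (e .embed i))))
      (proj₂ ∘ onto) , λ x y →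
  trans (sym (e .embed-entries (proj₁ (onto x)) (proj₁ (onto y))))
    (cong₂ (λ x y → b Q (inj₁ x) (inj₁ y)) (proj₂ (onto x)) (proj₂ (onto y)))

-- The class consists of the given matrix and its mutations along the words;
-- a move gives the index in the class of a mutated matrix and the images of
-- the vertices under an isomorphism, counted from 1 and stored in base 100.
record ClassCertificate : Set where
  constructor certificate
  field
    words : List (List ℕ)
    moves : List (List (ℕ × ℕ))

module _ (c : ClassCertificate) where
  open ClassCertificate c

  nth : {A : Set} → A → List A → ℕ → A
  nth default xs i = fromMaybe default (head (drop i xs))

  -- The vertices in `words` are counted from 0, unlike the images in `moves`.
  class : ∀ {n} → Matrix n → Vec (Matrix n) (suc (length words))
  class {n} A = A ∷ Vec.map (λ word → mutateAllAt A (mapMaybe (λ v → head (drop v (allFin n)))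
      word)) (Vec.fromList words)

  move : ℕ → ℕ → ℕ × ℕ
  move i v = nth (0 , 0) (nth [] moves i) v

  target : ∀ {n} → Fin (suc (length words)) → Fin n → Fin (suc (length words))
  target i v = nth i (allFin _) (proj₁ (move (toℕ i) (toℕ v)))

  forwards : ∀ {n} → List ℕ → Vec (Fin n) n
  forwards images = Vec.tabulate λ x → nth x (allFin _) (nth 0 images (toℕ x) ∸ 1)

  -- The inverse is found by search. If a value has no preimage the default is wrong, and the check
  -- of `MutatesTo` fails.
  backwards : ∀ {n} → Vec (Fin n) n → Vec (Fin n) n
  backwards π = Vec.tabulate λ y → fromMaybe y (head (filter (λ x → Vec.lookup π x Fin.≟ y) (allFin _)))

  relabelling : ∀ {n} → Fin (suc (length words)) → Fin n → Relabelling n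
  relabelling i v = π , backwards π
    where π = forwards (digits 50 (proj₂ (move (toℕ i) (toℕ v))))

  IsClass : ∀ {n} → Vec (Matrix n) (suc (length words)) → Set
  IsClass As = ∀ i v → MutatesTo (Vec.lookup As i) (Vec.lookup As (target i v)) v (relabelling i v)

  isClass? : ∀ {n} (As : Vec (Matrix n) (suc (length words))) → Dec (IsClass As)
  isClass? As = Fin.all? λ i → Fin.all? λ v →
    mutatesTo? (Vec.lookup As i) (Vec.lookup As (target i v)) v (relabelling i v)

  isClass-finite : ∀ {n} (A : Matrix n) {Q} → IsClass (class A) →
    mutablePart Q ≅ matrixQuiver A → FiniteMutationType Q
  isClass-finite A {Q} closed iso = closedClass-finite (class A)
    (λ i v → target i v , relabelling i v , closed i v) {Q} zero iso

-- Patches in a once-punctured polygon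

partnerIn : ∀ {m} → List (Side m × Side m) → Side m → Maybe (Side m)
partnerIn []             s = nothing
partnerIn ((a , b) ∷ gs) s with s ≟ˢ a | s ≟ˢ b
... | yes _ | _     = just b
... | no _  | yes _ = just a
... | no _  | no _  = partnerIn gs s

isInterval : ∀ P → Side (size P) → Bool
isInterval P s = isYes (Any.any? (s ≟ˢ_) (intervals P)) ∨ isYes (kind P (proj₁ s) ≟ᵏ based (proj₂ s))

-- Turning around a boundary point ends at a boundary interval.
meetsBoundary : ℕ → ∀ P → Side (size P) → Bool
meetsBoundaryAfter : ℕ → ∀ P → Maybe (Side (size P)) → Bool
meetsBoundary zero       P s = false
meetsBoundary (suc fuel) P s = isInterval P s ∨ meetsBoundaryAfter fuel P (partnerIn (glue P) s)
meetsBoundaryAfter fuel P nothing        = false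
meetsBoundaryAfter fuel P (just (t , i)) = meetsBoundary fuel P (t , next i)

AllPairs-lookup : ∀ {A : Set} {_∼_ : A → A → Set} {xs} → AllPairs _∼_ xs → ∀ {i j} → i Fin.< j →
  lookup xs i ∼ lookup xs j
AllPairs-lookup (x∼ ∷ _) {zero}  {suc j} _       = All.lookup x∼ (∈-lookup j)
AllPairs-lookup (_ ∷ ps) {suc i} {suc j} (s≤s i<j) = AllPairs-lookup ps i<j

module _ {S : MarkedSurface} {T′ : Triangulation S} {P : Patch} (ℛ : Realizations.Realization T′ P) where
  open Triangulation T′
  open Realizations T′
  open Realization ℛ

  partnerIn-glued : ∀ {gs} → All (λ (s , s′) → Glued ⟦ s ⟧ ⟦ s′ ⟧) gs → ∀ s {s′} →
    partnerIn gs s ≡ just s′ → Glued ⟦ s ⟧ ⟦ s′ ⟧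
  partnerIn-glued {(a , b) ∷ gs} (g ∷ gs-glued) s eq with s ≟ˢ a | s ≟ˢ b | eq
  ... | yes refl | _        | refl = g
  ... | no _     | yes refl | refl = Glued-sym T′ g
  ... | no _     | no _     | eq′  = partnerIn-glued gs-glued s eq′

  AtBoundary : Side (size P) → Set
  AtBoundary s = ∃[ b ] source (Inverse.to sides ⟦ s ⟧) ≡ inj₂ b

  isInterval-sound : ∀ s → T (isInterval P s) → AtBoundary s
  isInterval-sound s ok with Equivalence.to T-∨ ok
  ... | inj₁ ok₁ = All.lookupWith (λ { (b , eq) refl → b , cong source eq }) isolated
        (toWitness {a? = Any.any? (s ≟ˢ_) (intervals P)} ok₁)
  ... | inj₂ ok₂ =
    let b , eq = bottom-interval ℛ s (toWitness {a? = kind P (proj₁ s) ≟ᵏ based (proj₂ s)} ok₂)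
    in b , cong source eq

  meetsBoundary-sound : ∀ fuel s → T (meetsBoundary fuel P s) → AtBoundary s
  meetsBoundary-sound (suc fuel) s ok with Equivalence.to (T-∨ {isInterval P s}) ok
  ... | inj₁ ok₁ = isInterval-sound s ok₁
  ... | inj₂ ok₂ with partnerIn (glue P) s in eq
  ...   | just s′@(t , i) =
    let b , at-b = meetsBoundary-sound fuel (t , next i) ok₂
    in b , trans (Glued-corner T′ (partnerIn-glued glued s eq))
             (trans (cong (λ j → source (side (τ t) j)) (sym (rotate-next (ρ t) i))) at-b)

  -- Two recorded pairs on one arc would share a side, since an arc has only two; `separated`
  -- forbids that.
  #glue≤#arcs : (∀ {δ i j} → ¬ Glued (δ , i) (δ , j)) → length (glue P) ≤ #arcs
  #glue≤#arcs noSelfGlue = Fin.injective⇒≤ {f = arcAt} injective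
    where
    gluedAt : ∀ i → Glued ⟦ proj₁ (lookup (glue P) i) ⟧ ⟦ proj₂ (lookup (glue P) i) ⟧
    gluedAt i = All.lookup glued (∈-lookup i)
    arcAt : Fin (length (glue P)) → Arc
    arcAt i = proj₁ (gluedAt i)
    same-direction : ∀ {s t e c d} → Inverse.to sides ⟦ s ⟧ ≡ arc e c → Inverse.to sides ⟦ t ⟧
        ≡ arc e d → c ≡ d → s ≡ t
    same-direction p q refl = ⟦⟧-injective (side-injective T′ (trans p (sym q)))
    not≢ : ∀ {c d} → c ≢ d → c ≡ not d
    not≢ {true}  {true}  c≢d = contradiction refl c≢d
    not≢ {true}  {false} _   = refl
    not≢ {false} {true}  _   = refl
    not≢ {false} {false} c≢d = contradiction refl c≢d
    clash : ∀ i j → Apart (proj₁ (lookup (glue P) i)) (lookup (glue P) j) → arcAt i ≢ arcAt j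
    clash i j (a≢a′ , a≢b′) eq with gluedAt i | gluedAt j
    ... | e , c , p , _ | _ , d , q , r with refl ← eq with c Bool.≟ d
    ...   | yes c≡d = a≢a′ (same-direction p q c≡d)
    ...   | no c≢d  = a≢b′ (same-direction p r (not≢ c≢d))
    injective : Injective _≡_ _≡_ arcAt
    injective {i} {j} eq with Fin.<-cmp i j
    ... | tri≈ _ i≡j _ = i≡j
    ... | tri< i<j _ _ = contradiction eq (clash i j (proj₁ (AllPairs-lookup separated i<j)))
    ... | tri> _ _ j<i = contradiction (sym eq) (clash j i (proj₁ (AllPairs-lookup separated j<i)))

-- Patches which do not occur in a once-punctured n-gon, because they have too
-- many triangles, the wrong number of arcs, or no corner at a puncture.
contradictory : ℕ → Patch → Bool
contradictory n P = (n <ᵇ size P) ∨ (null (freeSides P) ∧ ((1 ≤ᵇ size P) ∧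
  (not (length (glue P) ≡ᵇ n) ∨ isYes (All.all? (λ s → T? (meetsBoundary 50 P s)) (allSides (size P))))))

module _ {S : MarkedSurface} (T′ : Triangulation S) {n : ℕ} (polygon : IsOncePuncturedPolygon n S)
  (noSelfGlue : ∀ {δ i j} → ¬ Triangulation.Glued T′ (δ , i) (δ , j)) where
  open Triangulation T′
  open Realizations T′

  private
    F≡n = proj₁ (polygon-#triangles T′ polygon)
    a≡n = proj₂ (polygon-#triangles T′ polygon)

  contradictory-sound : ∀ {P} → Realization P → ¬ T (contradictory n P)
  contradictory-sound {P} ℛ ok with Equivalence.to T-∨ ok
  ... | inj₁ large = ℕ.<⇒≱ (ℕ.<ᵇ⇒< n (size P) large)
        (ℕ.≤-trans (Fin.injective⇒≤ (Realization.τ-injective ℛ)) (ℕ.≤-reflexive F≡n))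
  ... | inj₂ ok′ with freeSides P in closed
  ...   | _ ∷ _ = ok′
  ...   | [] with 1≤size , ok″ ← T-∧⁻ (1 ≤ᵇ size P) ok′ with Equivalence.to T-∨ ok″
  ...     | inj₁ wrong = T-not wrong (ℕ.≡⇒≡ᵇ _ _ (ℕ.≤-antisym
              (ℕ.≤-trans (#glue≤#arcs ℛ noSelfGlue) (ℕ.≤-reflexive a≡n))
              (ℕ.≤-trans (ℕ.≤-reflexive (sym a≡n)) (#arcs≤#glue t₀))))
    where
    open Closed ℛ closed
    t₀ : Fin (size P)
    t₀ = Fin.fromℕ< (ℕ.≤ᵇ⇒≤ 1 (size P) 1≤size)
    T-not : ∀ {b} → T (not b) → ¬ T b
    T-not {false} _ ()
  ...     | inj₂ unpunctured = absurd
    where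
    open Closed ℛ closed
    open Realization ℛ
    t₀ : Fin (size P)
    t₀ = Fin.fromℕ< (ℕ.≤ᵇ⇒≤ 1 (size P) 1≤size)
    absurd : ⊥
    -- A closed patch contains the corner at the puncture, while all its corners have been found to
    -- be boundary points.
    absurd with δ , i , at ← cornersCover (inj₁ (subst Fin (sym (proj₁ (proj₂ polygon))) 0F))
           with s@(t , j) , refl ← covered-side (covered t₀ δ) i
           with _ , at-b ← meetsBoundary-sound ℛ 50 s (All.lookup (toWitness {a? = All.all? (λ s → T? (meetsBoundary 50 P s)) (allSides (size P))} unpunctured)
             (∈-cartesianProduct⁺ (∈-allFin t) (∈-allFin j)))
      = case trans (sym at) at-b of λ ()

innerNodes-complete : ∀ k (y : InnerNode k) → y ∈ innerNodes k
innerNodes-complete k y@(inner a b c total) =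
  ∈-concatMap⁺ (λ a → concatMap (λ b → concatMap (λ c → innerNodeAt k a b c) (upTo k)) (upTo k))
      (lose (∈-upTo⁺ a<k)
    (∈-concatMap⁺ (λ b → concatMap (λ c → innerNodeAt k a b c) (upTo k)) (lose (∈-upTo⁺ b<k)
      (∈-concatMap⁺ (λ c → innerNodeAt k a b c) (lose (∈-upTo⁺ c<k) listed)))))
  where
  sum≡k : suc a + suc b + suc c ≡ k
  sum≡k = recompute (suc a + suc b + suc c ℕ.≟ k) total
  a<k : a < k
  a<k = ℕ.≤-trans (ℕ.m≤m+n (suc a) (suc b)) (ℕ.≤-trans (ℕ.m≤m+n _ (suc c)) (ℕ.≤-reflexive sum≡k))
  b<k : b < k
  b<k = ℕ.≤-trans (ℕ.m≤n+m (suc b) (suc a)) (ℕ.≤-trans (ℕ.m≤m+n _ (suc c)) (ℕ.≤-reflexive sum≡k))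
  c<k : c < k
  c<k = ℕ.≤-trans (ℕ.m≤n+m (suc c) (suc a + suc b)) (ℕ.≤-reflexive sum≡k)
  listed : y ∈ innerNodeAt k a b c
  listed with suc a + suc b + suc c ℕ.≟ k
  ... | yes _ = here refl
  ... | no ≢k = contradiction sum≡k ≢k

module FiniteLeaf (k : ℕ)
  (arrows : ∀ P → Fin (size P) → Local.Arrows k P)
  (IsInner : ∀ P → Fin (size P) → Set) (inner? : ∀ P t → Dec (IsInner P t)) where
  open Certificate k arrows IsInner inner?

  module _ (P : Patch) where
    open Local k P

    edge-listed : ∀ {g} q → g ∈ glue P → inj₁ (proj₁ g , q) ∈ vertices P
    edge-listed q g∈ = ∈-++⁺ˡ (∈-concatMap⁺ (λ (a , _) → map (λ s → inj₁ (a , s)) (allFin (k ∸ 1)))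
      (lose g∈ (∈-map⁺ _ (∈-allFin q))))

    inner-listed : ∀ t y → IsInner P t → inj₂ (t , y) ∈ vertices P
    inner-listed t y t-inner = ∈-++⁺ʳ
      (concatMap (λ (a , _) → map (λ s → inj₁ (a , s)) (allFin (k ∸ 1))) (glue P))
      (∈-concatMap⁺ (λ t → map (λ y → inj₂ (t , y)) (innerNodes k))
        (lose (∈-filter⁺ (inner? P) (∈-allFin t) t-inner) (∈-map⁺ _ (innerNodes-complete k y))))

    record FiniteBy (c : ClassCertificate) (us : List LocalVertex) : Set where
      constructor finiteBy
      field
        closed  : freeSides P ≡ []
        1≤size  : 1 ≤ size P
        usable  : All (Usable (IsInner P)) us
        unique  : Unique us
        isClass : IsClass c (class c (patchMatrix (arrows P) us))

    finiteBy? : ∀ c us → Dec (FiniteBy c us)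
    finiteBy? c us = map′
      (λ (closed , 1≤size , usable , unique , isClass) → finiteBy closed 1≤size usable unique isClass)
      (λ (finiteBy closed 1≤size usable unique isClass) → closed , 1≤size , usable , unique , isClass)
      (List.≡-dec _≟ˢ_ (freeSides P) [] ×-dec 1 ℕ.≤? size P ×-dec
       All.all? (usable? (inner? P)) us ×-dec Unique.unique? _≟ˡ_ us ×-dec
       isClass? c (class c (patchMatrix (arrows P) us)))

module _ {S : MarkedSurface} (T′ : Triangulation S) where
  open Triangulation T′
  open Realizations T′

  module _ (k : ℕ) (noSelfGlue : ∀ {δ i j} → ¬ Glued (δ , i) (δ , j)) {P : Patch} (ℛ : Realization P) where
    open Realization ℛ

    module Finite𝒜 where
      open Model𝒜 k T′ noSelfGlue ℛ
      open FiniteLeaf k (arrows𝒜 k) (λ _ _ → ⊤) (λ _ _ → yes tt)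
      open C𝒜 k using (vertices)

      -- A closed patch misses no arc and no triangle, so its matrix is the whole mutable part and
      -- not just a subquiver.
      onto : freeSides P ≡ [] → Fin (size P) → ∀ z →
        Σ[ x ∈ Local.LocalVertex k P ] x ∈ vertices P × Σ[ v ∈ Valid x ] vertexOf x v ≡ z
      onto closed t₀ (inj₁ (e , p)) with Closed.arc-in-glue ℛ closed t₀ e
      ... | g , g∈ , inj₁ (eq , _) = let q , v , eq′ = edge-onto g∈ eq p in _ , edge-listed P q g∈ , v , eq′
      ... | g , g∈ , inj₂ (eq , _) = let q , v , eq′ = edge-onto g∈ eq p in _ , edge-listed P q g∈ , v , eq′
      onto closed t₀ (inj₂ (δ , y)) with t , refl ← Closed.covered ℛ closed t₀ δ =
        inj₂ (t , unturnInner (ρ t) y) , inner-listed P t _ tt , tt , cong (λ y → inj₂ (τ t , y))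
            (turn-unturn (ρ t) y)

      finite : ∀ c → FiniteBy P c (vertices P) → FiniteMutationType (𝒜.quiver k T′)
      finite c (finiteBy closed 1≤size usable unique isClass) =
        isClass-finite c (Local.patchMatrix k P (arrows𝒜 k P) (vertices P)) isClass
          (embeds-onto (embeds (vertices P) usable unique) λ z →
             let x , x∈ , v , eq = onto closed (Fin.fromℕ< 1≤size) z
             in Any.index x∈ , trans (vertexOf-cong _ v (sym (Any.lookup-index x∈))) eq)

    module Finite𝒜′ (classified : ∀ t → kind P t ≢ unknown) where
      open Model𝒜′ k T′ noSelfGlue ℛ classified
      open FiniteLeaf k (arrows𝒜′ k) (λ P t → kind P t ≡ inner) (λ P t → kind P t ≟ᵏ inner)
      open C𝒜′ k using (vertices)

      isInner : ∀ t → .(¬ HasBoundarySide (τ t)) → kind P t ≡ inner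
      isInner t none with kind P t in κ | kinds-ok t
      ... | unknown | _       = contradiction κ (classified t)
      ... | inner   | _       = refl
      ... | based i | int , _ = ⊥-elim-irr (none (_ , int))

      onto : freeSides P ≡ [] → Fin (size P) → ∀ z →
        Σ[ x ∈ Local.LocalVertex k P ] x ∈ vertices P × Σ[ v ∈ Valid x ] vertexOf x v ≡ z
      onto closed t₀ (inj₁ (e , p)) with Closed.arc-in-glue ℛ closed t₀ e
      ... | g , g∈ , inj₁ (eq , _) = let q , v , eq′ = edge-onto g∈ eq p in _ , edge-listed P q g∈ , v , eq′
      ... | g , g∈ , inj₂ (eq , _) = let q , v , eq′ = edge-onto g∈ eq p in _ , edge-listed P q g∈ , v , eq′
      onto closed t₀ (inj₂ (𝒜′.innerTriangle δ none , y)) with t , refl ← Closed.covered ℛ closed t₀ δ =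
        inj₂ (t , unturnInner (ρ t) y) , inner-listed P t _ (isInner t none) , isInner t none ,
        cong (λ y → inj₂ (𝒜′.innerTriangle (τ t) none , y)) (turn-unturn (ρ t) y)

      finite : ∀ c → FiniteBy P c (vertices P) → FiniteMutationType (𝒜′.quiver k T′)
      finite c (finiteBy closed 1≤size usable unique isClass) =
        isClass-finite c (Local.patchMatrix k P (arrows𝒜′ k P) (vertices P)) isClass
          (embeds-onto (embeds (vertices P) usable unique) λ z →
             let x , x∈ , v , eq = onto closed (Fin.fromℕ< 1≤size) z
             in Any.index x∈ , trans (vertexOf-cong _ v (sym (Any.lookup-index x∈))) eq)

module _ (k n : ℕ) (c : ClassCertificate) where

  module F𝒜 = FiniteLeaf k (arrows𝒜 k) (λ _ _ → ⊤) (λ _ _ → yes tt)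
  module F𝒜′ = FiniteLeaf k (arrows𝒜′ k) (λ P t → kind P t ≡ inner) (λ P t → kind P t ≟ᵏ inner)

  finite𝒜? : ∀ P → Dec (F𝒜.FiniteBy P c (C𝒜.vertices k P))
  finite𝒜? P = F𝒜.finiteBy? P c (C𝒜.vertices k P)

  finite𝒜′? : ∀ P → Dec (F𝒜′.FiniteBy P c (C𝒜′.vertices k P))
  finite𝒜′? P = F𝒜′.finiteBy? P c (C𝒜′.vertices k P)

  -- A leaf labelled 0 is impossible, any other leaf has a finite class.
  leafFinite𝒜 leafFinite𝒜′ : Patch → ℕ → Bool
  leafFinite𝒜 P 0  = contradictory n P
  leafFinite𝒜 P _  = isYes (finite𝒜? P)
  leafFinite𝒜′ P 0 = contradictory n P
  leafFinite𝒜′ P _ = classified k P ∧ isYes (finite𝒜′? P)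

  module SF𝒜 = Search kinds𝒜 leafFinite𝒜
  module SF𝒜′ = Search kinds𝒜′ leafFinite𝒜′

-- Finite type of the exceptional polygons

boundaryTriangle : Patch
boundaryTriangle = patch (unknown ∷ []) [] ((0F , 0F) ∷ [])

module _ {S : MarkedSurface} (T′ : Triangulation S) (1≤p : 1 ≤ MarkedSurface.punctures S) {n : ℕ}
  (polygon : IsOncePuncturedPolygon (suc n) S) where
  open Triangulation T′
  open Realizations T′

  -- The boundary has at least one marked point, so the exploration can start at a triangle with a
  -- boundary side, and a single initial patch suffices.
  boundarySide : Σ[ δ ∈ Triangle ] Σ[ i ∈ Fin 3 ] IsInterval (side δ i)
  boundarySide = proj₁ s , proj₂ s , point , Inverse.strictlyInverseˡ sides (interval point)
    where
    point : MarkedSurface.BoundaryPoint S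
    point = Inverse.to (points↔ (MarkedSurface.boundary S))
      (subst (Fin ∘ sum) (sym (proj₂ (proj₂ polygon))) 0F)
    s : Triangle × Fin 3
    s = Inverse.from sides (interval point)

  polygon-finite𝒜 : ∀ k c t → SF𝒜.check k (suc n) c boundaryTriangle t ≡ true → Regular →
    FiniteMutationType (𝒜.quiver k T′)
  polygon-finite𝒜 k c t ok regular =
    let δ , i , int = boundarySide
    in SF𝒜.check-sound k (suc n) c T′ (λ _ _ _ → here tt) noSelfGlue sound boundaryTriangle t
      (record { τ = λ _ → δ ; ρ = λ _ → i ; τ-injective = λ { {0F} {0F} _ → refl } ; kinds-ok =
          λ { 0F → tt }
              ; glued = [] ; isolated = subst (IsInterval ∘ side δ) (sym (rotate-0 i)) int ∷ [] ;
                  separated = [] })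
      (subst T (sym ok) tt)
    where
    noSelfGlue : ∀ {δ i j} → ¬ Glued (δ , i) (δ , j)
    noSelfGlue = noSelfGluing T′ 1≤p regular
    sound : ∀ P l → Realization P → T (leafFinite𝒜 k (suc n) c P l) → FiniteMutationType (𝒜.quiver k T′)
    sound P zero    ℛ ok = contradiction ok (contradictory-sound T′ polygon noSelfGlue ℛ)
    sound P (suc _) ℛ ok = Finite𝒜.finite T′ k noSelfGlue ℛ c (toWitness {a? = finite𝒜? k (suc n) c P} ok)

  polygon-finite𝒜′ : ∀ k c t → SF𝒜′.check k (suc n) c (triangle (based 0F)) t ≡ true → Taut →
    FiniteMutationType (𝒜′.quiver k T′)
  polygon-finite𝒜′ k c t ok taut =
    let δ , i , int = boundarySide
    in SF𝒜′.check-sound k (suc n) c T′ (classify T′ 1≤p k taut) noSelfGlue sound (triangle (based 0F)) t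
      (triangle-realized T′ 1≤p k {δ} {i} (based-kind T′ 1≤p k taut i 0F
        (subst (IsInterval ∘ side δ) (sym (rotate-0 i)) int)))
      (subst T (sym ok) tt)
    where
    noSelfGlue : ∀ {δ i j} → ¬ Glued (δ , i) (δ , j)
    noSelfGlue = noSelfGluing T′ 1≤p (proj₁ taut)
    sound : ∀ P l → Realization P → T (leafFinite𝒜′ k (suc n) c P l) → FiniteMutationType (𝒜′.quiver k T′)
    sound P zero    ℛ ok = contradiction ok (contradictory-sound T′ polygon noSelfGlue ℛ)
    sound P (suc _) ℛ ok =
      let all-classified , ok′ = T-∧⁻ (classified k P) {isYes (finite𝒜′? k (suc n) c P)} ok
      in Finite𝒜′.finite T′ k noSelfGlue ℛ (toWitness all-classified) c
           (toWitness {a? = finite𝒜′? k (suc n) c P} ok′)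

-- Exploration trees

-- Subtrees stand in the order of `children`: a boundary interval if possible, then gluings to later
-- free sides, then new triangles.
tree𝒜-3 : Tree
tree𝒜-3 =
  branch (branch (branch (leaf 0 ∷ branch (branch (leaf 0 ∷ branch (branch (leaf 0 ∷
  branch (branch (leaf 0 ∷ leaf 80607040205111204080304 ∷ []) ∷
  leaf 51001091107120204010710070206 ∷ []) ∷ []) ∷ branch (branch (branch (leaf 0 ∷
  leaf 2030104081105120208110807 ∷ []) ∷ leaf 40105031009 ∷ leaf 1050704031208060204131003120211 ∷
  []) ∷ leaf 109010402 ∷ leaf 804100713020601031106011203 ∷ []) ∷ []) ∷ []) ∷
  branch (branch (branch (leaf 0 ∷ branch (branch (leaf 0 ∷ leaf 120501020603040712091204 ∷ []) ∷
  leaf 6131012020307041201130503 ∷ []) ∷ []) ∷ leaf 50104030807 ∷ branch (branch (branch (leaf 0 ∷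
  leaf 213051107040803061210040612 ∷ []) ∷ leaf 9060302050210 ∷ leaf 713050208030604021105030412 ∷
  []) ∷ leaf 30609090402 ∷ leaf 1050907030804111305030412 ∷ []) ∷ []) ∷ leaf 107010402 ∷
  branch (branch (branch (branch (leaf 0 ∷ leaf 71105060108030212050208 ∷ []) ∷ leaf 50208081011 ∷
  leaf 4080902131209071105090511 ∷ []) ∷ leaf 10504031009 ∷ leaf 50210100604 ∷
  leaf 11070203120506041106091104 ∷ []) ∷ leaf 109010402 ∷ leaf 60311110501 ∷
  leaf 3090411121308070305021210 ∷ []) ∷ []) ∷ []) ∷ []) ∷ branch (branch (branch (leaf 0 ∷
  branch (branch (leaf 0 ∷ branch (branch (leaf 0 ∷ leaf 1002061201051110050703081011 ∷ []) ∷
  leaf 708010612050403110301080511 ∷ []) ∷ []) ∷ branch (branch (branch (leaf 0 ∷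
  leaf 13090305110401060811090411 ∷ []) ∷ leaf 40105031009 ∷ leaf 80602040511041109011112110510 ∷
  []) ∷ leaf 109010402 ∷ leaf 8020111050411121001080604 ∷ []) ∷ []) ∷ []) ∷ leaf 0 ∷
  branch (branch (branch (leaf 0 ∷ branch (branch (leaf 0 ∷ leaf 5010313101208120307101302 ∷ []) ∷
  leaf 1312040609051213070105101203 ∷ []) ∷ []) ∷ leaf 7060302050208 ∷
  branch (branch (branch (leaf 0 ∷ leaf 405011213120207061312040212 ∷ []) ∷ leaf 510080402070411 ∷
  leaf 80607040205111204080304 ∷ []) ∷ leaf 2060908030204 ∷ leaf 51001091107120204010710070206 ∷
  []) ∷ []) ∷ leaf 40206030207 ∷ branch (branch (branch (branch (leaf 0 ∷
  leaf 308090506010213021207051312 ∷ []) ∷ leaf 5081002070211 ∷ leaf 2030104081105120208110807 ∷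
  []) ∷ leaf 40105031009 ∷ leaf 2080510100604 ∷ leaf 1050704031208060204131003120211 ∷ []) ∷
  leaf 109010402 ∷ leaf 410080109010602 ∷ leaf 804100713020601031106011203 ∷ []) ∷ []) ∷ []) ∷
  leaf 104020605 ∷ branch (branch (branch (branch (leaf 0 ∷ branch (branch (leaf 0 ∷
  leaf 13120305080702110613020504 ∷ []) ∷ leaf 8030509100604081205020813 ∷ []) ∷ []) ∷
  leaf 40205010809 ∷ branch (branch (branch (leaf 0 ∷ leaf 4060503011107060812031208 ∷ []) ∷
  leaf 4120108030809 ∷ leaf 120501020603040712091204 ∷ []) ∷ leaf 20809030204 ∷
  leaf 6131012020307041201130503 ∷ []) ∷ []) ∷ leaf 50104030807 ∷ leaf 60402050408 ∷
  branch (branch (branch (branch (leaf 0 ∷ leaf 413080703061301120710130611 ∷ []) ∷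
  leaf 10805051211 ∷ leaf 213051107040803061210040612 ∷ []) ∷ leaf 9060302050210 ∷
  leaf 2071104110806 ∷ leaf 713050208030604021105030412 ∷ []) ∷ leaf 30609090402 ∷
  leaf 80602090811030804 ∷ leaf 1050907030804111305030412 ∷ []) ∷ []) ∷ leaf 107010402 ∷
  leaf 20903020501 ∷ branch (branch (branch (branch (branch (leaf 0 ∷
  leaf 30611090112080512020904031312 ∷ []) ∷ leaf 10805051211 ∷ leaf 71105060108030212050208 ∷
  []) ∷ leaf 50208081011 ∷ leaf 70211110806 ∷ leaf 4080902131209071105090511 ∷ []) ∷
  leaf 10504031009 ∷ leaf 50210100604 ∷ leaf 603111002030804 ∷ leaf 11070203120506041106091104 ∷
  []) ∷ leaf 109010402 ∷ leaf 60311110501 ∷ leaf 2031205020701 ∷ leaf 3090411121308070305021210 ∷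
  []) ∷ []) ∷ []) ∷ []) ∷ branch (branch (branch (branch (leaf 0 ∷ branch (branch (leaf 0 ∷
  branch (branch (leaf 0 ∷ leaf 208050711130507040911020313 ∷ []) ∷
  leaf 21305120503080704111006021104 ∷ []) ∷ []) ∷ branch (branch (branch (leaf 0 ∷
  leaf 60306010507040611020311 ∷ []) ∷ leaf 40105031009 ∷ leaf 51004030705060204070311100309 ∷
  []) ∷ leaf 109010402 ∷ leaf 408020111050411121001070406 ∷ []) ∷ []) ∷ []) ∷
  branch (branch (branch (leaf 0 ∷ branch (branch (leaf 0 ∷ leaf 205081007131003050107 ∷ []) ∷
  leaf 20903070811131012060804071213 ∷ []) ∷ []) ∷ leaf 20503050709 ∷
  branch (branch (branch (leaf 0 ∷ leaf 105041312110907130501050313 ∷ []) ∷ leaf 12040601030609 ∷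
  leaf 1002061201051110050703081011 ∷ []) ∷ leaf 30906090402 ∷ leaf 708010612050403110301080511 ∷
  []) ∷ []) ∷ leaf 107010402 ∷ branch (branch (branch (branch (leaf 0 ∷
  leaf 13050806041107120105101304 ∷ []) ∷ leaf 120205041210 ∷ leaf 13090305110401060811090411 ∷
  []) ∷ leaf 40105031009 ∷ leaf 50210100604 ∷ leaf 80602040511041109011112110510 ∷ []) ∷
  leaf 109010402 ∷ leaf 30612120501 ∷ leaf 8020111050411121001080604 ∷ []) ∷ []) ∷ []) ∷
  branch (leaf 0 ∷ leaf 50104010809 ∷ []) ∷ leaf 104030605 ∷
  branch (branch (branch (branch (leaf 0 ∷ branch (branch (leaf 0 ∷
  leaf 106130910020810130307021007 ∷ []) ∷ leaf 10050308060413110108030412 ∷ []) ∷ []) ∷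
  branch (branch (branch (leaf 0 ∷ leaf 61303081102100405070312 ∷ []) ∷ leaf 30702070912 ∷
  leaf 5010313101208120307101302 ∷ []) ∷ leaf 309090402 ∷ leaf 1312040609051213070105101203 ∷
  []) ∷ []) ∷ leaf 7060302050208 ∷ leaf 10409090206 ∷ branch (branch (branch (branch (leaf 0 ∷
  leaf 30811041211090502021107 ∷ []) ∷ leaf 405011213120207061312040212 ∷ []) ∷
  leaf 510080402070411 ∷ leaf 8060412010802 ∷ leaf 80607040205111204080304 ∷ []) ∷
  leaf 2060908030204 ∷ leaf 810050111080307 ∷ leaf 51001091107120204010710070206 ∷ []) ∷ []) ∷
  leaf 40206030207 ∷ leaf 10408080305 ∷ branch (branch (branch (branch (branch (leaf 0 ∷
  leaf 801061102130811041105110212 ∷ []) ∷ leaf 308090506010213021207051312 ∷ []) ∷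
  leaf 5081002070211 ∷ leaf 10612120208 ∷ leaf 2030104081105120208110807 ∷ []) ∷
  leaf 40105031009 ∷ leaf 2080510100604 ∷ leaf 40812020410050806 ∷
  leaf 1050704031208060204131003120211 ∷ []) ∷ leaf 109010402 ∷ leaf 410080109010602 ∷
  leaf 6031101110507 ∷ leaf 804100713020601031106011203 ∷ []) ∷ []) ∷ []) ∷ leaf 104020605 ∷
  branch (branch (leaf 0 ∷ leaf 50104010809 ∷ []) ∷ leaf 70103060708 ∷ leaf 50204060809 ∷ []) ∷
  branch (branch (branch (branch (branch (leaf 0 ∷ branch (branch (leaf 0 ∷
  leaf 51203021304081213081306 ∷ []) ∷ leaf 90205081007131003020407 ∷ []) ∷ []) ∷
  branch (branch (branch (leaf 0 ∷ leaf 60210041312050812040813 ∷ []) ∷ leaf 30702070912 ∷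
  leaf 13120305080702110613020504 ∷ []) ∷ leaf 309090402 ∷ leaf 8030509100604081205020813 ∷ []) ∷
  []) ∷ leaf 40205010809 ∷ leaf 608060105 ∷ branch (branch (branch (branch (leaf 0 ∷
  leaf 80310040605040212020607 ∷ []) ∷ leaf 4060503011107060812031208 ∷ []) ∷ leaf 4120108030809 ∷
  leaf 10412120208 ∷ leaf 120501020603040712091204 ∷ []) ∷ leaf 20809030204 ∷ leaf 10411110307 ∷
  leaf 6131012020307041201130503 ∷ []) ∷ []) ∷ leaf 50104030807 ∷ leaf 60402050408 ∷
  leaf 20705070103 ∷ branch (branch (branch (branch (branch (leaf 0 ∷
  leaf 1050907030804111305010412 ∷ []) ∷ leaf 413080703061301120710130611 ∷ []) ∷
  leaf 10805051211 ∷ leaf 107020711 ∷ leaf 213051107040803061210040612 ∷ []) ∷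
  leaf 9060302050210 ∷ leaf 2071104110806 ∷ leaf 804051211050206 ∷
  leaf 713050208030604021105030412 ∷ []) ∷ leaf 30609090402 ∷ leaf 80602090811030804 ∷
  leaf 7010410100305 ∷ leaf 1050907030804111305030412 ∷ []) ∷ []) ∷ leaf 107010402 ∷
  leaf 20903020501 ∷ leaf 2050703060309 ∷ branch (branch (branch (branch (branch (branch (leaf 0 ∷
  leaf 6081302010512130802030612 ∷ []) ∷ leaf 30611090112080512020904031312 ∷ []) ∷
  leaf 10805051211 ∷ leaf 107020711 ∷ leaf 71105060108030212050208 ∷ []) ∷ leaf 50208081011 ∷
  leaf 70211110806 ∷ leaf 60710060105 ∷ leaf 4080902131209071105090511 ∷ []) ∷ leaf 10504031009 ∷
  leaf 50210100604 ∷ leaf 603111002030804 ∷ leaf 3090507020301 ∷ leaf 11070203120506041106091104 ∷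
  []) ∷ leaf 109010402 ∷ leaf 60311110501 ∷ leaf 2031205020701 ∷ leaf 401100507020509 ∷
  leaf 3090411121308070305021210 ∷ []) ∷ []) ∷ []) ∷ [])

tree𝒜-3-checks : S𝒜.check 3 (triangle unknown) tree𝒜-3 ≡ true
tree𝒜-3-checks = refl

tree𝒜-4 : Tree
tree𝒜-4 =
  branch (branch (branch (leaf 0 ∷ branch (branch (leaf 0 ∷ leaf 80112090305110910 ∷ []) ∷
  leaf 100809030501050911 ∷ []) ∷ []) ∷ branch (branch (branch (leaf 0 ∷
  leaf 14021308150501091303 ∷ []) ∷ leaf 31205120910 ∷ leaf 9021104061214091205 ∷ []) ∷
  leaf 41102010812 ∷ leaf 100809030501050911 ∷ []) ∷ []) ∷
  branch (branch (branch (branch (leaf 0 ∷ leaf 90513150301050815 ∷ []) ∷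
  leaf 15040211061214021214 ∷ []) ∷ leaf 60212051109 ∷ leaf 50107041208 ∷
  leaf 12100809030501040911 ∷ []) ∷ leaf 120210020401 ∷ leaf 50107071208 ∷
  leaf 100809030501050911 ∷ []) ∷ [])

tree𝒜-4-checks : S𝒜.check 4 (triangle unknown) tree𝒜-4 ≡ true
tree𝒜-4-checks = refl

-- For k = 5 two triangles glued along one arc suffice. The leaf 0 is a triangle with three boundary
-- sides, dismissed for having fewer arcs than triangles.
tree𝒜-5 : Tree
tree𝒜-5 =
  branch (branch (branch (leaf 0 ∷ leaf 16080306130905030602 ∷ []) ∷ leaf 80306130905130602 ∷
  []) ∷ leaf 80306130905150602 ∷ [])

tree𝒜-5-checks : S𝒜.check 5 (triangle unknown) tree𝒜-5 ≡ true
tree𝒜-5-checks = refl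

tree𝒜-6 : Tree
tree𝒜-6 =
  branch (branch (branch (leaf 0 ∷ leaf 4192419032322242103 ∷ []) ∷ leaf 15142004211723150321 ∷
  []) ∷ leaf 25070109031112111202 ∷ [])

tree𝒜-6-checks : S𝒜.check 6 (triangle unknown) tree𝒜-6 ≡ true
tree𝒜-6-checks = refl

tree𝒜′-3-inner : Tree
tree𝒜′-3-inner =
  branch (branch (leaf 104020605 ∷ branch (leaf 70103060708 ∷ leaf 50204060809 ∷
  leaf 60301010807 ∷ leaf 30106010807 ∷ []) ∷ branch (leaf 107010402 ∷ leaf 20903020501 ∷
  leaf 2050703060309 ∷ branch (leaf 109010402 ∷ leaf 60311110501 ∷ leaf 2031205020701 ∷
  leaf 401100507020509 ∷ leaf 3090411121308070305021210 ∷ leaf 905081101030602080110 ∷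
  leaf 120607100302121004050709011210 ∷ []) ∷ branch (leaf 206060309 ∷ leaf 20509090604 ∷
  leaf 1110504040703 ∷ leaf 705020103 ∷ leaf 80612100402110103080501 ∷
  leaf 7091008040910110501010803 ∷ leaf 8010506100203080209 ∷ []) ∷ branch (leaf 30402 ∷
  leaf 20503010310 ∷ leaf 1050311080107 ∷ leaf 7020305080311 ∷ leaf 80605020112090311080110 ∷
  leaf 2050809031006030901 ∷ leaf 20104060710020703091006010803 ∷ []) ∷ []) ∷
  branch (leaf 602060307 ∷ leaf 60801070503 ∷ leaf 5020103 ∷ branch (leaf 40206030209 ∷
  leaf 7030111040105 ∷ leaf 107040305 ∷ leaf 120111070408030905070503 ∷
  leaf 11010408110310081005080407 ∷ leaf 4100111030805010703 ∷ []) ∷ branch (leaf 20805080309 ∷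
  leaf 5020809060904 ∷ leaf 70603060105 ∷ leaf 701100811050203041003 ∷
  branch (leaf 2040507050311 ∷ leaf 804020611090810 ∷ leaf 3090508080107 ∷
  leaf 20501030409121008071310021206 ∷ leaf 7010305120809040705090502 ∷
  leaf 110901121005060407021106 ∷ []) ∷ leaf 408090103020510030701 ∷ []) ∷ branch (leaf 6030402 ∷
  leaf 8050204060209 ∷ leaf 107040305 ∷ leaf 4100111030805010703 ∷ leaf 106070309080510030904 ∷
  leaf 7030908100105020904 ∷ []) ∷ []) ∷ branch (leaf 30402 ∷ leaf 50208010803 ∷
  leaf 20503060308 ∷ branch (leaf 90504100602 ∷ leaf 1050311080107 ∷ leaf 1040507020509 ∷
  leaf 5020607030610040205070609 ∷ leaf 10110203040908020511020704 ∷ leaf 6070905010409040502 ∷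
  []) ∷ branch (leaf 2050604 ∷ leaf 3020609030804 ∷ leaf 705020103 ∷ leaf 111070408030905050310 ∷
  leaf 802030910040501020704 ∷ leaf 704090104080510010403 ∷ []) ∷ branch (leaf 602050204 ∷
  leaf 3051002010702 ∷ leaf 7020405080510 ∷ leaf 10110203040908020511030704 ∷
  leaf 204070907081005010703 ∷ branch (leaf 60407110802 ∷ leaf 703051012120901 ∷
  leaf 106070904120702 ∷ leaf 3080206080413010706090308 ∷ leaf 1110120609050704021105 ∷
  leaf 406090211071210031105 ∷ []) ∷ []) ∷ []) ∷ []) ∷ branch (branch (leaf 104010508 ∷
  leaf 104010507 ∷ leaf 104010507 ∷ []) ∷ leaf 20103 ∷ branch (leaf 10508040103 ∷ leaf 1040305 ∷
  branch (leaf 209030204 ∷ leaf 6030711070501 ∷ leaf 103060507 ∷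
  leaf 408020111050411121001120406 ∷ leaf 11005090103060211081007 ∷
  leaf 5110109020308060410110406 ∷ []) ∷ branch (leaf 206060309 ∷ leaf 3010710060305 ∷
  leaf 50107020703 ∷ leaf 210070104060203111005 ∷ branch (leaf 31102041105 ∷
  leaf 309081201110705 ∷ leaf 307090508070111 ∷ leaf 5070206100501030510090503 ∷
  leaf 407031006110205081009120411 ∷ leaf 90108070206120503070503 ∷ []) ∷
  leaf 2050109060307100209 ∷ []) ∷ branch (leaf 30402 ∷ leaf 2040809050206 ∷ leaf 103060507 ∷
  leaf 110905070210030706051001 ∷ leaf 309010207030106100905 ∷ leaf 31007090104060309090408 ∷
  []) ∷ []) ∷ branch (leaf 30705040702 ∷ leaf 105020503 ∷ branch (leaf 5070302010910 ∷
  leaf 50104060307 ∷ leaf 110901100506040710050602 ∷ branch (leaf 602060311 ∷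
  leaf 208110310040603 ∷ leaf 5010907020903 ∷ leaf 1081207030510071104050309 ∷
  leaf 907110104110206031112101108 ∷ leaf 502101101020603091107 ∷ []) ∷
  leaf 510010207090604070204 ∷ []) ∷ branch (leaf 7020805090308 ∷ leaf 70503020701 ∷
  branch (leaf 705021209020301 ∷ leaf 9050107040903 ∷ leaf 2060810090105070412081205 ∷
  leaf 3110206050711011004100609 ∷ leaf 3110206050711011004050609 ∷ []) ∷
  branch (leaf 703100502110209 ∷ leaf 7031005100109 ∷ leaf 10060408070201030605080501 ∷
  leaf 111001050904060803010804 ∷ leaf 8031004020107050302010709 ∷ []) ∷
  branch (leaf 100806030402 ∷ leaf 9050107040903 ∷ leaf 8010311050704101105030509 ∷
  leaf 5030604010207030205100308 ∷ leaf 8010311050704101105030509 ∷ []) ∷ []) ∷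
  branch (leaf 608030402 ∷ leaf 50104060307 ∷ branch (leaf 111081004010602 ∷ leaf 9010307060905 ∷
  leaf 21004010212080504070406 ∷ leaf 801030412070602100903040507 ∷
  leaf 110205010411050401081106 ∷ []) ∷ branch (leaf 100208050604 ∷ leaf 5010907020903 ∷
  leaf 6020510110907050103100307 ∷ leaf 10407031110050807050309 ∷
  leaf 703010610080903070503060304 ∷ []) ∷ branch (leaf 2100804050206 ∷ leaf 1070603080509 ∷
  leaf 3061104030205081210091107 ∷ leaf 305010408020503090706040511 ∷
  leaf 111090407100803060904070802 ∷ []) ∷ []) ∷ []) ∷ branch (leaf 6030402 ∷ leaf 1040305 ∷
  branch (leaf 7020310020501 ∷ leaf 103060507 ∷ leaf 100302070405080110100604 ∷
  branch (leaf 206060311 ∷ leaf 802050309090712 ∷ leaf 7010509020903 ∷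
  leaf 20604120501020603080212 ∷ leaf 403041104080706020711100406 ∷ leaf 5010806040203080211 ∷
  []) ∷ leaf 806090205060409080109 ∷ []) ∷ branch (leaf 208050604 ∷ leaf 50107020703 ∷
  branch (leaf 10712030109041205 ∷ leaf 3010705080509 ∷ leaf 50804060110041204120602 ∷
  leaf 408090206111207031006110905 ∷ leaf 201030605110406080211 ∷ []) ∷ branch (leaf 21004070806 ∷
  leaf 701100503100509 ∷ leaf 11080410050711030106040509 ∷ leaf 908040506100307010905 ∷
  leaf 908040506100307010905 ∷ []) ∷ branch (leaf 4080210070206 ∷ leaf 3010705080509 ∷
  leaf 110408090607020310040905 ∷ leaf 1020908040506100307020504 ∷
  leaf 80905110104030107050901050107 ∷ []) ∷ []) ∷ branch (leaf 60208050204 ∷ leaf 103060507 ∷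
  branch (leaf 809031205090701 ∷ leaf 10503080709 ∷ leaf 110608011207080406110307 ∷
  leaf 706101104090105070604010708 ∷ leaf 20611051004011107090205 ∷ []) ∷
  branch (leaf 6071002050804 ∷ leaf 1050709020903 ∷ leaf 110108030710080408060207081002 ∷
  leaf 211060308010405090709060309 ∷ leaf 11070105070908060305110201 ∷ []) ∷
  branch (leaf 4100106010802 ∷ leaf 10503080709 ∷ leaf 50710090208060103060406050408 ∷
  leaf 801090504020903061008011105 ∷ leaf 407030806010204080706041003 ∷ []) ∷ []) ∷ []) ∷ []) ∷
  branch (leaf 30402 ∷ branch (leaf 501010408 ∷ leaf 105010407 ∷ leaf 501010407 ∷ []) ∷
  branch (leaf 50704080602 ∷ leaf 40105020507 ∷ branch (leaf 209030204 ∷ leaf 1050311080107 ∷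
  leaf 3060701040710 ∷ leaf 90805030501110603110504 ∷ leaf 10810050203050806100903 ∷
  leaf 80107041006030407011003 ∷ []) ∷ branch (leaf 602060309 ∷ leaf 7060209060804 ∷
  leaf 705020103 ∷ leaf 10805100603031002 ∷ branch (leaf 20805080311 ∷ leaf 504080211051006 ∷
  leaf 9030607060105 ∷ leaf 402120807051008070308 ∷ leaf 10030807040205100411 ∷
  leaf 208061004091108020510 ∷ []) ∷ leaf 5080106021003080209 ∷ []) ∷ branch (leaf 30402 ∷
  leaf 5080206090603 ∷ leaf 7020305080310 ∷ leaf 801050610020309050602 ∷ leaf 10809050306080205 ∷
  leaf 708040109030607010403 ∷ []) ∷ []) ∷ branch (leaf 2050604 ∷ leaf 5020103 ∷
  branch (leaf 3070110040105 ∷ leaf 107040305 ∷ leaf 101103050106041008040602 ∷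
  branch (leaf 602060311 ∷ leaf 905031201060307 ∷ leaf 1050309060307 ∷
  leaf 901100607050203090212 ∷ leaf 12080304070310061102121107 ∷ leaf 102061101031207080105 ∷
  []) ∷ leaf 5010908060409040602 ∷ []) ∷ branch (leaf 204070806 ∷ leaf 10507020503 ∷
  branch (leaf 40305090112030107 ∷ leaf 9050104060307 ∷ leaf 12070502071301041207080206 ∷
  leaf 10305120809040705030708 ∷ leaf 80205060102071104080402 ∷ []) ∷ branch (leaf 20604091008 ∷
  leaf 2090305030107 ∷ leaf 9050801090406100308040503 ∷ leaf 21007080103060104060804 ∷
  leaf 11070208060109031105110501 ∷ []) ∷ branch (leaf 4061002090208 ∷ leaf 1080905080307 ∷
  leaf 10305120809040705030708 ∷ leaf 1090504020903061008040508 ∷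
  leaf 1105010407090203040705010807 ∷ []) ∷ []) ∷ branch (leaf 40806030602 ∷ leaf 107040305 ∷
  branch (leaf 905010312060107 ∷ leaf 10309060507 ∷ leaf 120608100312010406020607 ∷
  leaf 105081204101109060804081106 ∷ leaf 3101106070911080406020601 ∷ []) ∷
  branch (leaf 6100402090408 ∷ leaf 1050709020703 ∷ leaf 10305120809040705010708 ∷
  leaf 100806090203040501100307 ∷ leaf 509010811061007110302010804 ∷ []) ∷
  branch (leaf 906100804060802 ∷ leaf 10903060507 ∷ leaf 5020605060910060804110208 ∷
  leaf 901050208100706110703050804 ∷ leaf 1051009020603080604010608 ∷ []) ∷ []) ∷ []) ∷
  branch (leaf 405030602 ∷ leaf 70205030704 ∷ branch (leaf 1040608021009 ∷ leaf 4010607020709 ∷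
  leaf 10408070306090409020710 ∷ branch (leaf 206060311 ∷ leaf 306081002040211 ∷
  leaf 50709020103 ∷ leaf 20604120501020603080212 ∷ leaf 100708031106070209101104 ∷
  leaf 5010806040203080211 ∷ []) ∷ leaf 407050106020904100402 ∷ []) ∷ branch (leaf 60207050804 ∷
  leaf 507020103 ∷ branch (leaf 21207010503020903 ∷ leaf 70901040305 ∷
  leaf 8120201100605120204120604 ∷ leaf 307110510080401101106 ∷ leaf 102051108020604081104 ∷ []) ∷
  branch (leaf 2090804081006 ∷ leaf 5030907020501 ∷ leaf 1107050902010604100809020610 ∷
  leaf 1051009020603080604020806 ∷ leaf 801061109020407030607011105 ∷ []) ∷
  branch (leaf 4100608030602 ∷ leaf 70109040305 ∷ leaf 30912100706010704050908040702 ∷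
  leaf 90403020705101108010703090705 ∷ leaf 31007060501100408070602 ∷ []) ∷ []) ∷
  branch (leaf 40607090802 ∷ leaf 4010207010609 ∷ branch (leaf 507100312120901 ∷
  leaf 108090406020911 ∷ leaf 6100305010403080611080309 ∷ leaf 4100311100108060409081007 ∷
  leaf 4050406030710090806010509 ∷ []) ∷ branch (leaf 2090806081004 ∷ leaf 50907020103 ∷
  leaf 7050102120510030108120506 ∷ leaf 1030805070104100511030905 ∷
  leaf 10020603060511010803100706 ∷ []) ∷ branch (leaf 10020604090208 ∷ leaf 108090406110902 ∷
  leaf 120102050704090607010807 ∷ leaf 9060803100405081006010908 ∷
  leaf 10110605040901080603020903 ∷ []) ∷ []) ∷ []) ∷ []) ∷ [])

tree𝒜′-3-inner-checks : S𝒜′.check 3 (triangle inner) tree𝒜′-3-inner ≡ true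
tree𝒜′-3-inner-checks = refl

tree𝒜′-3-based : Tree
tree𝒜′-3-based =
  branch (branch (leaf 40301 ∷ branch (leaf 107010402 ∷ leaf 3060501 ∷ branch (leaf 209030204 ∷
  leaf 30211020501 ∷ leaf 305080701 ∷ leaf 51104080311091206090401 ∷
  leaf 11005090103060211080110 ∷ leaf 4080704110708031006010810 ∷ []) ∷ branch (leaf 602060309 ∷
  leaf 60402050409 ∷ leaf 80501010703 ∷ leaf 5080110031106031002 ∷ branch (leaf 20805080311 ∷
  leaf 2080511061104 ∷ leaf 9050703100501 ∷ leaf 1003080704021305100412 ∷
  leaf 708050703061005070212040812 ∷ leaf 406091002070104050309070503 ∷ []) ∷
  leaf 5080106021003080209 ∷ []) ∷ branch (leaf 30402 ∷ leaf 50210011003 ∷ leaf 305080701 ∷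
  leaf 80602110501090603080110 ∷ leaf 8021006050103080109 ∷ leaf 708010309061007030904 ∷ []) ∷
  []) ∷ branch (leaf 602060307 ∷ leaf 503060301 ∷ branch (leaf 50210020301 ∷ leaf 70305080501 ∷
  leaf 8011102040103061004020105 ∷ branch (leaf 602060311 ∷ leaf 12030702061205 ∷
  leaf 9050301060307 ∷ leaf 6110210081305010307100305 ∷ leaf 1003020104080701061112101107 ∷
  leaf 102061101031207070105 ∷ []) ∷ leaf 105080206091004080204 ∷ []) ∷ branch (leaf 20805080309 ∷
  leaf 80103010705 ∷ branch (leaf 5040712110301 ∷ leaf 9030705100701 ∷
  leaf 9040803050107081109050103 ∷ leaf 1105071103080110040705070509 ∷
  leaf 4111205070206041101120105 ∷ []) ∷ branch (leaf 5021007100311 ∷ leaf 5011003110907 ∷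
  leaf 120105070908060305030702 ∷ leaf 1009030501041108060503100807 ∷
  leaf 705061107090802050305030501 ∷ []) ∷ branch (leaf 806030402 ∷ leaf 3090705100701 ∷
  leaf 805060911080702090405010803 ∷ leaf 2050903060301030805090107 ∷
  leaf 211060308010405090709110903 ∷ []) ∷ []) ∷ branch (leaf 6030402 ∷ leaf 70305080501 ∷
  branch (leaf 7030212020501 ∷ leaf 3090507100701 ∷ leaf 40210080605120804060108 ∷
  leaf 504011106120507021003100503 ∷ leaf 70304080106091204020811 ∷ []) ∷ branch (leaf 208050604 ∷
  leaf 9050301060307 ∷ leaf 305010412080205030907090506 ∷ leaf 90203060107040508050704 ∷
  leaf 9040509080103010705040703 ∷ []) ∷ branch (leaf 10408010602 ∷ leaf 9050703100701 ∷
  leaf 11010408090107020305040705 ∷ leaf 5040111060507021003100503 ∷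
  leaf 1011030208040706011110040507 ∷ []) ∷ []) ∷ []) ∷ branch (leaf 30402 ∷ leaf 3060501 ∷
  branch (leaf 30210020501 ∷ leaf 305080701 ∷ leaf 60102080401100701070205 ∷
  branch (leaf 206060311 ∷ leaf 4020611070408 ∷ leaf 3010705100309 ∷ leaf 1080509020306080212 ∷
  leaf 603070804030711060102080907 ∷ leaf 5010806040203080211 ∷ []) ∷ leaf 6070905010409040502 ∷
  []) ∷ branch (leaf 2050604 ∷ leaf 10805020703 ∷ branch (leaf 4080211070206 ∷
  leaf 7090301040105 ∷ leaf 207010309040112080601040601 ∷ leaf 50806071004120801030512110603 ∷
  leaf 1102061101040811081105 ∷ []) ∷ branch (leaf 402070806 ∷ leaf 9050703100501 ∷
  leaf 70804090705080603010805 ∷ leaf 708040109030607010605 ∷ leaf 60504090108060307010507 ∷ []) ∷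
  branch (leaf 80402070206 ∷ leaf 9030507100501 ∷ leaf 111008040511030210060709110509 ∷
  leaf 5100803040705110807010507 ∷ leaf 809100104050311071105090705 ∷ []) ∷ []) ∷
  branch (leaf 602050204 ∷ leaf 503080701 ∷ branch (leaf 2031205020701 ∷ leaf 50703100901 ∷
  leaf 110608011207080406110307 ∷ leaf 8120103090709040607090411 ∷ leaf 91108070601110704070602 ∷
  []) ∷ branch (leaf 60207050804 ∷ leaf 3010705100309 ∷ leaf 1109080206070406020605 ∷
  leaf 9020810110607040106030605 ∷ leaf 1030805070104100511031105 ∷ []) ∷
  branch (leaf 20604070208 ∷ leaf 50703100901 ∷ leaf 8120103090709040607090402 ∷
  leaf 1006040807020103060511100105 ∷ leaf 90705020401060304090804 ∷ []) ∷ []) ∷ []) ∷ []) ∷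
  branch (leaf 0 ∷ branch (leaf 405050301 ∷ branch (leaf 402030209 ∷ leaf 30702020501 ∷
  leaf 1107010208061007040511071006 ∷ branch (leaf 206060311 ∷ leaf 31102030604 ∷
  leaf 3010905080307 ∷ leaf 10510090206031308090212 ∷ leaf 904010311120511010408030705 ∷
  leaf 801050612100203080211 ∷ []) ∷ leaf 7050601090110050804060102 ∷ []) ∷
  branch (leaf 602060309 ∷ leaf 30107060305 ∷ branch (leaf 20305011112 ∷ leaf 7030109040105 ∷
  leaf 708120309040501030413 ∷ leaf 107110312050908031204 ∷ leaf 701080304010905010412 ∷ []) ∷
  branch (leaf 20805080311 ∷ leaf 3090106060705 ∷ leaf 711031205090802031204 ∷
  leaf 1011030208040706011110100602 ∷ leaf 9080210010607050305070305 ∷ []) ∷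
  branch (leaf 6030402 ∷ leaf 7030109040105 ∷ leaf 107110312050908031204 ∷
  leaf 11040711090508010403 ∷ leaf 11040711090508010403 ∷ []) ∷ []) ∷ branch (leaf 30402 ∷
  leaf 70306080501 ∷ branch (leaf 10411010602 ∷ leaf 3090508100701 ∷
  leaf 70601020412010504060412 ∷ leaf 209070304071103090805041112 ∷ leaf 20611051004011107070205 ∷
  []) ∷ branch (leaf 2050604 ∷ leaf 9040105040703 ∷ leaf 111070408030905050312 ∷
  leaf 602080907010504070503 ∷ leaf 80402010709110305010305 ∷ []) ∷ branch (leaf 602050204 ∷
  leaf 2090305020701 ∷ leaf 512061103061204021005090607 ∷ leaf 1103020411050809010307 ∷
  leaf 81011030208040706011110030206 ∷ []) ∷ []) ∷ []) ∷ branch (leaf 0 ∷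
  branch (leaf 50704090301 ∷ branch (leaf 212020301 ∷ leaf 9070203020501 ∷
  leaf 407130806090313010408 ∷ leaf 91105010210030607050112 ∷ leaf 80709021204060312010804 ∷ []) ∷
  branch (leaf 602060311 ∷ leaf 9070104040503 ∷ leaf 2060812060201020703090205 ∷
  leaf 1040610070903050607100305 ∷ leaf 1107050601100203091102 ∷ []) ∷ branch (leaf 30402 ∷
  leaf 9070203020501 ∷ leaf 80709021204060312010804 ∷ leaf 502101101020603090207 ∷
  leaf 703021108110411090601110206 ∷ []) ∷ []) ∷ branch (leaf 6010503020508 ∷
  branch (leaf 7050209020301 ∷ leaf 12080906050410050701080304 ∷ leaf 60108110905100704080305 ∷
  leaf 60108110905100704080305 ∷ []) ∷ branch (leaf 1003090507040902 ∷
  leaf 5020608040103020510090307 ∷ branch (leaf 120210050907060904 ∷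
  leaf 100603080204051208070513110809 ∷ leaf 12060709010810070305031209 ∷
  leaf 12060709010810070305021209 ∷ []) ∷ leaf 7091001020506030508010305 ∷ []) ∷
  branch (leaf 60810030402 ∷ leaf 602010205090807051004070308 ∷ leaf 208060301050310090307 ∷
  leaf 10304080908071005030805 ∷ []) ∷ []) ∷ branch (leaf 608030402 ∷ branch (leaf 3020709020501 ∷
  leaf 20508060811040112061208 ∷ leaf 61102070403110405101108 ∷ leaf 8050206081101100405060201 ∷
  []) ∷ branch (leaf 100208050604 ∷ leaf 703010610080903070503060304 ∷
  leaf 10304080908071005010805 ∷ leaf 9020704080304100507010904 ∷ []) ∷
  branch (leaf 4010810010602 ∷ leaf 40802090104100302050711050407 ∷ leaf 61007090105020307100305 ∷
  branch (leaf 212041006070208 ∷ leaf 3080206080413010706100308 ∷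
  leaf 101206010409050110081106010403 ∷ leaf 20803061001070406090206 ∷ []) ∷ []) ∷ []) ∷ []) ∷
  branch (leaf 6030402 ∷ branch (leaf 50103060107 ∷ leaf 2050601100405080210 ∷
  branch (leaf 602060311 ∷ leaf 5040109040703 ∷ leaf 5010806040203080212 ∷
  leaf 70411080204030611100702 ∷ leaf 1080509020306080211 ∷ []) ∷ leaf 806090205060409080109 ∷
  []) ∷ branch (leaf 208050604 ∷ branch (leaf 7030109040105 ∷ leaf 201060905120406080212 ∷
  leaf 7020403070602040311100408 ∷ leaf 501100811060411040602 ∷ []) ∷ branch (leaf 40210070806 ∷
  leaf 908040506100307010905 ∷ leaf 301100706040806100206 ∷ leaf 908040506100307010905 ∷ []) ∷
  branch (leaf 7030109040105 ∷ leaf 401020908040506100307110405 ∷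
  leaf 307010206050807090703100305 ∷ branch (leaf 1006020412090208 ∷
  leaf 5090108110610071103030804 ∷ leaf 111080410050711030106010905 ∷
  leaf 9100401050607110403050608 ∷ []) ∷ []) ∷ []) ∷ branch (leaf 10307060105 ∷
  branch (leaf 3080905090701 ∷ leaf 120608100312010406090607 ∷ leaf 11010305071008060804100406 ∷
  leaf 70811040306041001081004 ∷ []) ∷ branch (leaf 6071002050804 ∷
  leaf 502110904010602100704110804 ∷ leaf 10408050209061007050604070903 ∷
  branch (leaf 100908040212080206 ∷ leaf 312100706050112100408070602 ∷
  leaf 7081004010305011107030901 ∷ leaf 7081004010305011107030901 ∷ []) ∷ []) ∷
  branch (leaf 1090305080107 ∷ leaf 301090502100708060406100608 ∷ branch (leaf 1107040501040903 ∷
  leaf 1009030204080709070612080411 ∷ leaf 1107060109020507091104060503 ∷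
  leaf 7050102120510030108100506 ∷ []) ∷ leaf 31008021004010706100206 ∷ []) ∷ []) ∷ []) ∷ []) ∷
  branch (leaf 40301 ∷ branch (leaf 3060501 ∷ branch (leaf 402030209 ∷ leaf 503080701 ∷
  leaf 41003081006071106010406 ∷ leaf 8100103070610030704 ∷ leaf 8100103070610030704 ∷ []) ∷
  branch (leaf 602060309 ∷ leaf 10805020703 ∷ leaf 508010704100603031002 ∷
  branch (leaf 20805080311 ∷ leaf 1030706060905 ∷ leaf 711031205090802031204 ∷
  leaf 10030711020508051104 ∷ leaf 10030711020508051104 ∷ []) ∷ leaf 50801060203080209 ∷ []) ∷
  branch (leaf 30402 ∷ leaf 305080701 ∷ leaf 8100103070610030704 ∷ leaf 80205090603030901 ∷
  leaf 1080306070906030604 ∷ []) ∷ []) ∷ branch (leaf 2050604 ∷ branch (leaf 70305080501 ∷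
  leaf 5080102061004080204 ∷ branch (leaf 602060311 ∷ leaf 9050301060307 ∷
  leaf 50209060501070309040503 ∷ leaf 2061009010405110608020811 ∷ leaf 5010911030607031102 ∷ []) ∷
  leaf 806090205060409040201 ∷ []) ∷ branch (leaf 402070806 ∷ branch (leaf 3090705100701 ∷
  leaf 6120201100409070612100208 ∷ leaf 101106040903010305080203100107 ∷
  leaf 20103060511040607080211 ∷ []) ∷ branch (leaf 40206091008 ∷ leaf 6100305040109110806010609 ∷
  leaf 103051009060810010406 ∷ leaf 1020809100304050608010504 ∷ []) ∷ branch (leaf 6100402090208 ∷
  leaf 30711051008040105020610080604 ∷ leaf 10302100409080506030906 ∷
  branch (leaf 311050907120901 ∷ leaf 206040905061202080409120610 ∷
  leaf 11081202061110040508060807 ∷ leaf 11081202061110040508060807 ∷ []) ∷ []) ∷ []) ∷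
  branch (leaf 80406030602 ∷ branch (leaf 9050703100701 ∷ leaf 70411080608030401110612 ∷
  leaf 90105110610080104110806 ∷ leaf 90105110610080104110806 ∷ []) ∷
  branch (leaf 10020608050804 ∷ leaf 100501110602090608041102010802 ∷
  leaf 1091002010506081004010406 ∷ branch (leaf 6070105110903060903 ∷
  leaf 807010305120809040705030711 ∷ leaf 1121108040307120109010503010907 ∷
  leaf 109100201120506081004020604 ∷ []) ∷ []) ∷ branch (leaf 5030907100701 ∷
  leaf 1007080210030601041007100406 ∷ branch (leaf 80212100607051004 ∷
  leaf 807010305120809040705010711 ∷ leaf 807010305120809040705010711 ∷
  leaf 807010305120809040705010711 ∷ []) ∷ leaf 7010402100503060401100208 ∷ []) ∷ []) ∷ []) ∷
  branch (leaf 3060501 ∷ branch (leaf 503080701 ∷ leaf 21007080103060104100408 ∷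
  branch (leaf 206060311 ∷ leaf 3010705100309 ∷ leaf 5010806040203080212 ∷
  leaf 100809020508060803050911 ∷ leaf 1080509020306080211 ∷ []) ∷ leaf 209070301080604090408 ∷
  []) ∷ branch (leaf 10508020703 ∷ branch (leaf 9030507100501 ∷ leaf 201060905120406080212 ∷
  leaf 31007060501100408070611 ∷ leaf 50309060108110406061102 ∷ []) ∷ branch (leaf 9040802081006 ∷
  leaf 110605030706080204020504101107 ∷ leaf 10090208060103060406100607 ∷
  branch (leaf 41208061110030802 ∷ leaf 211060308010405090709110903 ∷
  leaf 110801040207020501030901040205 ∷ leaf 51007020906041112071002100608 ∷ []) ∷ []) ∷
  branch (leaf 3070901040105 ∷ leaf 20701030603050804100203 ∷ branch (leaf 509110301060307 ∷
  leaf 100904071206041108061013021006 ∷ leaf 6120208100903051004010811120307 ∷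
  leaf 8011005080309040302060307080406 ∷ []) ∷ leaf 20701030603050804100203 ∷ []) ∷ []) ∷
  branch (leaf 503080701 ∷ branch (leaf 50703100901 ∷ leaf 4050406030710090806010509 ∷
  leaf 10050605090108050306050904 ∷ leaf 403080701090604020711 ∷ []) ∷
  branch (leaf 3010705100309 ∷ leaf 906110306100809020506030804 ∷ branch (leaf 903060701061105 ∷
  leaf 908010405080702030502070410 ∷ leaf 903020507120708070510060804 ∷
  leaf 5020409110607121008020812 ∷ []) ∷ leaf 100206030605010803100706 ∷ []) ∷
  branch (leaf 70305100901 ∷ leaf 10050605090108050306050904 ∷ leaf 61003050104030806080309 ∷
  leaf 61003050104030806080309 ∷ []) ∷ []) ∷ []) ∷ []) ∷ [])

tree𝒜′-3-based-checks : S𝒜′.check 3 (triangle (based 0F)) tree𝒜′-3-based ≡ true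
tree𝒜′-3-based-checks = refl

tree𝒜′-4-inner : Tree
tree𝒜′-4-inner =
  branch (branch (leaf 120210020401 ∷ leaf 50107071208 ∷ leaf 100809030501050911 ∷
  leaf 11080609120804021108 ∷ leaf 11080609120804021108 ∷ []) ∷ branch (leaf 304020508 ∷
  leaf 20104 ∷ leaf 4051008090103110409 ∷ branch (leaf 50908110803 ∷ leaf 107020704 ∷
  leaf 15130811030205110702 ∷ leaf 11060107030408010508 ∷ leaf 10120608030205120702 ∷ []) ∷
  branch (leaf 9050603 ∷ leaf 1050407 ∷ leaf 2081307040611120703 ∷ leaf 80210070512100307 ∷
  leaf 2120605100208050611 ∷ []) ∷ []) ∷ branch (leaf 50603 ∷ leaf 904030902 ∷
  leaf 120411020306081203 ∷ branch (leaf 3080906 ∷ leaf 7020104 ∷ leaf 70804020305110703 ∷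
  leaf 11120610050804021105 ∷ leaf 308020705110307 ∷ []) ∷ branch (leaf 602020903 ∷
  leaf 50107120702 ∷ leaf 140509150207031506 ∷ leaf 70203100705110208 ∷ leaf 20912060507021105 ∷
  []) ∷ []) ∷ [])

tree𝒜′-4-inner-checks : S𝒜′.check 4 (triangle inner) tree𝒜′-4-inner ≡ true
tree𝒜′-4-inner-checks = refl

tree𝒜′-4-based : Tree
tree𝒜′-4-based =
  branch (branch (leaf 50401 ∷ leaf 51008090103050911 ∷ branch (leaf 304020510 ∷ leaf 105050704 ∷
  leaf 70511030401020412 ∷ leaf 100807110206020705 ∷ leaf 20312100205070211 ∷ []) ∷
  branch (leaf 50603 ∷ leaf 4080701 ∷ leaf 11031402061104111302 ∷ leaf 31107101205041002 ∷
  leaf 11020804101106050403 ∷ []) ∷ []) ∷ branch (leaf 0 ∷ branch (leaf 107050104 ∷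
  leaf 13080305120114051402 ∷ leaf 3081206040211030511 ∷ leaf 8011207080406020811 ∷ []) ∷
  branch (leaf 9050107080207 ∷ leaf 4011208030511030205 ∷ branch (leaf 2070110080105 ∷
  leaf 5090107120804080711 ∷ leaf 11030705120408030905 ∷ leaf 30207080510090308 ∷ []) ∷
  branch (leaf 1108040502 ∷ leaf 14151113050402081404 ∷ leaf 30709080510050802 ∷
  leaf 3080702061104081102 ∷ []) ∷ []) ∷ branch (leaf 9050603 ∷ leaf 20807040611120703 ∷
  branch (leaf 1102070805 ∷ leaf 110208070512080703 ∷ leaf 2090803041006090703 ∷
  leaf 308020705110307 ∷ []) ∷ branch (leaf 81206060903 ∷ leaf 3130802111505100207 ∷
  leaf 308021105100207 ∷ leaf 5021211091007031006 ∷ []) ∷ []) ∷ []) ∷ branch (leaf 50401 ∷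
  branch (leaf 4080701 ∷ leaf 141507081405030713 ∷ leaf 8120705031009100711 ∷
  leaf 8120705031009100711 ∷ []) ∷ branch (leaf 3080906 ∷ leaf 308020705110307 ∷
  branch (leaf 502101108 ∷ leaf 140803020105140702 ∷ leaf 3071105100804111006 ∷
  leaf 70211090305110308 ∷ []) ∷ branch (leaf 41001050107 ∷ leaf 111405100208031006 ∷
  leaf 1006111008020605 ∷ leaf 1006111008020605 ∷ []) ∷ []) ∷ branch (leaf 4080701 ∷
  leaf 4011208030511020511 ∷ branch (leaf 50107051004 ∷ leaf 611100802021005 ∷
  leaf 206110508080510 ∷ leaf 61110080210020805 ∷ []) ∷ branch (leaf 805121102 ∷
  leaf 10131505040702020414 ∷ leaf 110207080510110308 ∷ leaf 40306111008041005 ∷ []) ∷ []) ∷ []) ∷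
  [])

tree𝒜′-4-based-checks : S𝒜′.check 4 (triangle (based 0F)) tree𝒜′-4-based ≡ true
tree𝒜′-4-based-checks = refl

tree𝒜′-5-inner : Tree
tree𝒜′-5-inner =
  branch (leaf 80306130905150602 ∷ branch (leaf 410100711 ∷ leaf 20105 ∷
  leaf 1901020317110619200305 ∷ leaf 1120513070611120207 ∷ leaf 2140310060912120313 ∷ []) ∷
  branch (leaf 70804 ∷ leaf 503060214 ∷ leaf 61309140312090714 ∷ leaf 3041214090206100213 ∷
  leaf 2140703020510110213 ∷ []) ∷ [])

tree𝒜′-5-inner-checks : S𝒜′.check 5 (triangle inner) tree𝒜′-5-inner ≡ true
tree𝒜′-5-inner-checks = refl

tree𝒜′-5-based : Tree
tree𝒜′-5-based =
  branch (branch (leaf 60501 ∷ leaf 1915020818051620161803 ∷ leaf 10071206011309041006 ∷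
  leaf 10071206011309041006 ∷ []) ∷ branch (leaf 20503080206 ∷ leaf 51106011303120513 ∷
  branch (leaf 4061110041003 ∷ leaf 1006051501040305060117 ∷ leaf 3050810020907050706 ∷
  leaf 306010811090510100907 ∷ []) ∷ branch (leaf 10050602 ∷ leaf 61711071603111807 ∷
  leaf 301080110010211050610080109 ∷ branch (leaf 81116071204 ∷ leaf 7091512141003041408 ∷
  leaf 111304030709130310 ∷ leaf 140602111309031307 ∷ []) ∷ []) ∷ []) ∷ branch (leaf 60501 ∷
  leaf 140706111203110613 ∷ branch (leaf 3101107 ∷ leaf 100104170307171103 ∷
  leaf 212111006040712100601050409 ∷ branch (leaf 71511061103 ∷ leaf 1304071410040614 ∷
  leaf 1304071410040614 ∷ leaf 60414071210100713 ∷ []) ∷ []) ∷ branch (leaf 7121103 ∷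
  leaf 11041001180207011003 ∷ branch (leaf 71204071608 ∷ leaf 1403070811031508 ∷
  leaf 704141310031306 ∷ leaf 1403070811031508 ∷ []) ∷ leaf 2060409080611070102110603 ∷ []) ∷
  []) ∷ [])

tree𝒜′-5-based-checks : S𝒜′.check 5 (triangle (based 0F)) tree𝒜′-5-based ≡ true
tree𝒜′-5-based-checks = refl

tree𝒜′-6-inner : Tree
tree𝒜′-6-inner =
  branch (leaf 25070109031112111202 ∷ leaf 1412030508101109091108 ∷ leaf 20613111014131103 ∷ [])

tree𝒜′-6-inner-checks : S𝒜′.check 6 (triangle inner) tree𝒜′-6-inner ≡ true
tree𝒜′-6-inner-checks = refl

tree𝒜′-6-based : Tree
tree𝒜′-6-based =
  branch (leaf 12031410090811011211 ∷ branch (leaf 20109070308 ∷ leaf 15180309041903041916 ∷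
  branch (leaf 1030706020612 ∷ leaf 172108022403220825030218 ∷ leaf 6111202030908060807 ∷
  leaf 70515140112110908150809 ∷ []) ∷ branch (leaf 14080904 ∷ leaf 5161324041008241404 ∷
  leaf 13070804110210040605091204051110 ∷ branch (leaf 140419130409 ∷
  leaf 61305170312070415030708 ∷ leaf 16041312081406081203 ∷ leaf 42012131718031409170818 ∷ []) ∷
  []) ∷ []) ∷ branch (leaf 70601 ∷ leaf 15131403191613150219 ∷ branch (leaf 4131409 ∷
  leaf 1103121107190302 ∷ leaf 81211051408091506050613021203 ∷ branch (leaf 81813071303 ∷
  leaf 12072718062302070624 ∷ leaf 171218080913031709 ∷ leaf 171218080913031709 ∷ []) ∷ []) ∷
  branch (leaf 7131202 ∷ leaf 14030510042509090413 ∷ branch (leaf 42014051909 ∷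
  leaf 161802071712020817 ∷ leaf 81417020712120716 ∷ leaf 81716021214021607 ∷ []) ∷
  leaf 8051407020411070813040713 ∷ []) ∷ []) ∷ [])

tree𝒜′-6-based-checks : S𝒜′.check 6 (triangle (based 0F)) tree𝒜′-6-based ≡ true
tree𝒜′-6-based-checks = refl

-- After cancellation the quiver is u → two vertices → v → two vertices → u, with u and v the inner
-- nodes of the two triangles. It is one mutation away from the quiver of the tetrahedral
-- triangulation of the sphere with four punctures, of type D_4^(1,1).
class𝒜-3-2 : ClassCertificate
class𝒜-3-2 = certificate
  ((0 ∷ []) ∷ (4 ∷ []) ∷ (0 ∷ 3 ∷ []) ∷ [])
  (((1 , 60504030201) ∷ (1 , 50603040201) ∷ (1 , 50603020401) ∷ (1 , 60503020104) ∷
   (2 , 60504030201) ∷ (2 , 30204060501) ∷ []) ∷ ((0 , 60504030201) ∷ (0 , 50603040201) ∷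
   (0 , 50603020401) ∷ (3 , 60504030201) ∷ (1 , 40605030201) ∷ (1 , 50406030201) ∷ []) ∷
   ((0 , 30206040105) ∷ (0 , 30204050601) ∷ (0 , 30204060501) ∷ (0 , 40106030205) ∷
   (0 , 60504030201) ∷ (0 , 50604030201) ∷ []) ∷ ((1 , 60503020104) ∷ (1 , 60503020401) ∷
   (1 , 60503040201) ∷ (1 , 60504030201) ∷ (3 , 50604030201) ∷ (3 , 50604030201) ∷ []) ∷ [])

finite𝒜-3-2 : Tree
finite𝒜-3-2 =
  branch (branch (leaf 0 ∷ branch (branch (leaf 0 ∷ leaf 0 ∷ []) ∷ leaf 0 ∷ []) ∷ []) ∷
  branch (branch (branch (leaf 0 ∷ leaf 0 ∷ []) ∷ leaf 1 ∷ leaf 0 ∷ []) ∷ branch (leaf 0 ∷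
  leaf 0 ∷ []) ∷ leaf 0 ∷ []) ∷ [])

finite𝒜-3-2-checks : SF𝒜.check 3 2 class𝒜-3-2 boundaryTriangle finite𝒜-3-2 ≡ true
finite𝒜-3-2-checks = refl

-- The arrows between equal indices cancel and leave an oriented four-cycle, which is of type D_4.
class𝒜′-3-2 : ClassCertificate
class𝒜′-3-2 = certificate
  ((0 ∷ []) ∷ (0 ∷ 1 ∷ []) ∷ (0 ∷ 3 ∷ []) ∷ (0 ∷ 1 ∷ 3 ∷ []) ∷ (0 ∷ 3 ∷ 1 ∷ []) ∷ [])
  (((1 , 4030201) ∷ (1 , 3020104) ∷ (1 , 2030401) ∷ (1 , 3040102) ∷ []) ∷ ((0 , 4030201) ∷
   (2 , 4030201) ∷ (0 , 2030401) ∷ (3 , 4030201) ∷ []) ∷ ((3 , 3020401) ∷ (1 , 4030201) ∷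
   (3 , 3010402) ∷ (4 , 4030201) ∷ []) ∷ ((2 , 2040301) ∷ (5 , 4030201) ∷ (2 , 2030104) ∷
   (1 , 4030201) ∷ []) ∷ ((2 , 3010204) ∷ (5 , 3020401) ∷ (2 , 3040201) ∷ (2 , 4030201) ∷ []) ∷
   ((3 , 4030102) ∷ (3 , 4030201) ∷ (3 , 4020301) ∷ (4 , 2040301) ∷ []) ∷ [])

finite𝒜′-3-2 : Tree
finite𝒜′-3-2 =
  branch (branch (branch (leaf 0 ∷ leaf 0 ∷ leaf 0 ∷ []) ∷ leaf 0 ∷ leaf 0 ∷ leaf 0 ∷ []) ∷
  branch (leaf 1 ∷ leaf 0 ∷ leaf 0 ∷ leaf 0 ∷ []) ∷ branch (leaf 0 ∷ leaf 0 ∷ leaf 0 ∷ leaf 0 ∷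
  []) ∷ [])

finite𝒜′-3-2-checks : SF𝒜′.check 3 2 class𝒜′-3-2 (triangle (based 0F)) finite𝒜′-3-2 ≡ true
finite𝒜′-3-2-checks = refl

-- The initial quiver is isomorphic to that of `class𝒜-3-2`; the two vertices of index 2 play the
-- role of u and v.
class𝒜′-4-2 : ClassCertificate
class𝒜′-4-2 = certificate
  ((0 ∷ []) ∷ (1 ∷ []) ∷ (0 ∷ 5 ∷ []) ∷ [])
  (((1 , 60504030201) ∷ (2 , 60504030201) ∷ (1 , 40206030501) ∷ (1 , 40203060501) ∷
   (2 , 60405020301) ∷ (1 , 40503010206) ∷ []) ∷ ((0 , 60504030201) ∷ (1 , 20604030501) ∷
   (0 , 40206030501) ∷ (0 , 40203060501) ∷ (1 , 50204030601) ∷ (3 , 60504030201) ∷ []) ∷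
   ((0 , 50406010302) ∷ (0 , 60504030201) ∷ (0 , 60402050301) ∷ (0 , 60405020301) ∷
   (0 , 60204030501) ∷ (0 , 50604030102) ∷ []) ∷ ((1 , 40503010206) ∷ (3 , 60204030501) ∷
   (1 , 40503060201) ∷ (1 , 40506030201) ∷ (3 , 60204030501) ∷ (1 , 60504030201) ∷ []) ∷ [])

finite𝒜′-4-2 : Tree
finite𝒜′-4-2 =
  branch (branch (branch (leaf 0 ∷ leaf 0 ∷ leaf 0 ∷ []) ∷ leaf 0 ∷ leaf 0 ∷ leaf 0 ∷ []) ∷
  branch (leaf 1 ∷ leaf 0 ∷ leaf 0 ∷ leaf 0 ∷ []) ∷ branch (leaf 0 ∷ leaf 0 ∷ leaf 0 ∷ leaf 0 ∷
  []) ∷ [])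

finite𝒜′-4-2-checks : SF𝒜′.check 4 2 class𝒜′-4-2 (triangle (based 0F)) finite𝒜′-4-2 ≡ true
finite𝒜′-4-2-checks = refl

-- The initial quiver is an octahedron with all eight faces cyclically oriented: the quiver of the
-- tetrahedral triangulation of the four-punctured sphere itself.
class𝒜′-3-3 : ClassCertificate
class𝒜′-3-3 = certificate
  ((0 ∷ []) ∷ (0 ∷ 1 ∷ []) ∷ (0 ∷ 1 ∷ 4 ∷ []) ∷ [])
  (((1 , 60504030201) ∷ (1 , 60105030402) ∷ (1 , 40605010302) ∷ (1 , 50604020301) ∷
   (1 , 60405030102) ∷ (1 , 10605040302) ∷ []) ∷ ((0 , 60504030201) ∷ (2 , 60504030201) ∷
   (2 , 50601030204) ∷ (0 , 50604020301) ∷ (2 , 60304020501) ∷ (2 , 60301050204) ∷ []) ∷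
   ((2 , 60105030204) ∷ (1 , 60504030201) ∷ (1 , 60504020301) ∷ (2 , 60401030205) ∷
   (3 , 60504030201) ∷ (1 , 50204060301) ∷ []) ∷ ((3 , 60501030204) ∷ (2 , 60304020501) ∷
   (2 , 60304050201) ∷ (3 , 60501030204) ∷ (2 , 60504030201) ∷ (2 , 50604030201) ∷ []) ∷ [])

finite𝒜′-3-3 : Tree
finite𝒜′-3-3 =
  branch (branch (branch (branch (leaf 0 ∷ leaf 0 ∷ leaf 0 ∷ []) ∷ branch (leaf 0 ∷ leaf 0 ∷
  leaf 0 ∷ []) ∷ branch (leaf 0 ∷ leaf 0 ∷ leaf 0 ∷ []) ∷ []) ∷ branch (branch (leaf 0 ∷ leaf 0 ∷
  leaf 0 ∷ leaf 0 ∷ []) ∷ branch (leaf 0 ∷ leaf 0 ∷ leaf 0 ∷ leaf 0 ∷ []) ∷ leaf 0 ∷ leaf 0 ∷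
  leaf 0 ∷ []) ∷ branch (branch (leaf 0 ∷ leaf 0 ∷ leaf 0 ∷ []) ∷ branch (leaf 0 ∷ leaf 0 ∷
  leaf 0 ∷ []) ∷ leaf 0 ∷ leaf 0 ∷ leaf 0 ∷ []) ∷ branch (branch (leaf 0 ∷ leaf 0 ∷ leaf 0 ∷ []) ∷
  branch (leaf 0 ∷ leaf 0 ∷ leaf 0 ∷ []) ∷ leaf 0 ∷ leaf 0 ∷ leaf 0 ∷ []) ∷ []) ∷ branch (leaf 0 ∷
  branch (branch (leaf 0 ∷ leaf 0 ∷ leaf 0 ∷ []) ∷ leaf 0 ∷ leaf 0 ∷ leaf 0 ∷ []) ∷
  branch (leaf 1 ∷ leaf 0 ∷ leaf 0 ∷ leaf 0 ∷ []) ∷ branch (leaf 0 ∷ leaf 0 ∷ leaf 0 ∷ leaf 0 ∷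
  []) ∷ []) ∷ branch (leaf 0 ∷ branch (branch (leaf 0 ∷ leaf 0 ∷ leaf 0 ∷ []) ∷ leaf 0 ∷ leaf 0 ∷
  leaf 0 ∷ []) ∷ branch (leaf 0 ∷ leaf 0 ∷ leaf 0 ∷ leaf 0 ∷ []) ∷ branch (leaf 0 ∷ leaf 0 ∷
  leaf 0 ∷ leaf 0 ∷ []) ∷ []) ∷ [])

finite𝒜′-3-3-checks : SF𝒜′.check 3 3 class𝒜′-3-3 (triangle (based 0F)) finite𝒜′-3-3 ≡ true
finite𝒜′-3-3-checks = refl

-- The two equivalences

module _ {S : MarkedSurface} (1≤p : 1 ≤ MarkedSurface.punctures S) (T′ : Triangulation S) where
  open Triangulation T′

  finite⇒bigon : ∀ k → 3 ≤ k → Regular → FiniteMutationType (𝒜.quiver k T′) → IsOncePuncturedBigon S × k ≡ 3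
  finite⇒bigon (suc (suc zero)) (s≤s (s≤s ())) _ _
  finite⇒bigon 3 _ regular finite with explore𝒜 T′ 1≤p 3 tree𝒜-3 tree𝒜-3-checks regular finite
  ... | 2 , _ , bigon = bigon , refl
  finite⇒bigon 4 _ regular finite =
    case proj₁ (proj₂ (explore𝒜 T′ 1≤p 4 tree𝒜-4 tree𝒜-4-checks regular finite)) of λ ()
  finite⇒bigon 5 _ regular finite =
    case proj₁ (proj₂ (explore𝒜 T′ 1≤p 5 tree𝒜-5 tree𝒜-5-checks regular finite)) of λ ()
  finite⇒bigon 6 _ regular finite =
    case proj₁ (proj₂ (explore𝒜 T′ 1≤p 6 tree𝒜-6 tree𝒜-6-checks regular finite)) of λ ()
  finite⇒bigon (suc (suc (suc (suc (suc (suc (suc n))))))) _ regular finite =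
    contradiction finite (large𝒜 T′ 1≤p n regular)

  bigon⇒finite : Regular → IsOncePuncturedBigon S → FiniteMutationType (𝒜.quiver 3 T′)
  bigon⇒finite regular bigon =
    polygon-finite𝒜 T′ 1≤p bigon 3 class𝒜-3-2 finite𝒜-3-2 finite𝒜-3-2-checks regular

  FiniteCase′ : ℕ → Set
  FiniteCase′ k = (IsOncePuncturedBigon S × (k ≡ 3 ⊎ k ≡ 4)) ⊎ (IsOncePuncturedTriangle S × k ≡ 3)

  finite⇒polygon : ∀ k → 3 ≤ k → Taut → FiniteMutationType (𝒜′.quiver k T′) → FiniteCase′ k
  finite⇒polygon (suc (suc zero)) (s≤s (s≤s ())) _ _
  finite⇒polygon 3 _ taut finite
    with explore𝒜′ T′ 1≤p 3 taut tree𝒜′-3-inner tree𝒜′-3-based tree𝒜′-3-inner-checks tree𝒜′-3-based-checks finite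
  ... | 2 , _ , bigon     = inj₁ (bigon , inj₁ refl)
  ... | 3 , _ , punctured = inj₂ (punctured , refl)
  finite⇒polygon 4 _ taut finite
    with explore𝒜′ T′ 1≤p 4 taut tree𝒜′-4-inner tree𝒜′-4-based tree𝒜′-4-inner-checks tree𝒜′-4-based-checks finite
  ... | 2 , _ , bigon = inj₁ (bigon , inj₂ refl)
  finite⇒polygon 5 _ taut finite = case proj₁ (proj₂ (explore𝒜′ T′ 1≤p 5 taut
    tree𝒜′-5-inner tree𝒜′-5-based tree𝒜′-5-inner-checks tree𝒜′-5-based-checks finite)) of λ ()
  finite⇒polygon 6 _ taut finite = case proj₁ (proj₂ (explore𝒜′ T′ 1≤p 6 taut
    tree𝒜′-6-inner tree𝒜′-6-based tree𝒜′-6-inner-checks tree𝒜′-6-based-checks finite)) of λ ()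
  finite⇒polygon (suc (suc (suc (suc (suc (suc (suc n))))))) _ taut finite =
    contradiction finite (large𝒜′ T′ 1≤p n taut)

  polygon⇒finite : ∀ {k} → Taut → FiniteCase′ k → FiniteMutationType (𝒜′.quiver k T′)
  polygon⇒finite taut (inj₁ (bigon , inj₁ refl)) =
    polygon-finite𝒜′ T′ 1≤p bigon 3 class𝒜′-3-2 finite𝒜′-3-2 finite𝒜′-3-2-checks taut
  polygon⇒finite taut (inj₁ (bigon , inj₂ refl)) =
    polygon-finite𝒜′ T′ 1≤p bigon 4 class𝒜′-4-2 finite𝒜′-4-2 finite𝒜′-4-2-checks taut
  polygon⇒finite taut (inj₂ (punctured , refl)) =
    polygon-finite𝒜′ T′ 1≤p punctured 3 class𝒜′-3-3 finite𝒜′-3-3 finite𝒜′-3-3-checks taut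

proposition10p1 : (S : MarkedSurface) (k : ℕ) → 1 ≤ MarkedSurface.punctures S → 3 ≤ k →
    ((T : Triangulation S) → Triangulation.Regular T →
    FiniteMutationType (𝒜.quiver k T)
    ⇔ (IsOncePuncturedBigon S × k ≡ 3))
    ×
    ((T : Triangulation S) → Triangulation.Taut T →
    FiniteMutationType (𝒜′.quiver k T)
    ⇔ ((IsOncePuncturedBigon S × (k ≡ 3 ⊎ k ≡ 4))
    ⊎ (IsOncePuncturedTriangle S × k ≡ 3)))
proposition10p1 S k 1≤p 3≤k =
  (λ T′ regular → mk⇔ (finite⇒bigon 1≤p T′ k 3≤k regular)
                      (λ { (bigon , refl) → bigon⇒finite 1≤p T′ regular bigon })) ,
  (λ T′ taut → mk⇔ (finite⇒polygon 1≤p T′ k 3≤k taut) (polygon⇒finite 1≤p T′ taut))
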